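{- There is an algorithm that, given an instance $(D,\ell,k)$ of Directed Component Order Connectivity in which $D$ is a semicomplete digraph on $n$ vertices, solves it in time $\mathcal{O}(2^{16k}\,\max\{k,1\}\,n^2)$. In particular, Directed Component Order Connectivity parameterized by $k$ is fixed-parameter tractable on semicomplete digraphs.
   Context: All digraphs are finite, without loops or parallel arcs. A digraph $D$ is semicomplete if for every pair $x,y$ of distinct vertices there is at least one arc between $x$ and $y$ (possibly both $xy$ and $yx$). For a digraph $H$, $\mathrm{mco}(H)$ denotes the number of vertices in a largest strongly connected component of $H$. Directed Component Order Connectivity (DCOC) is the following decision problem. Input: a digraph $D=(V,A)$ with $n=|V|$ and integers $\ell\ge 1$, $k\ge 0$. Question: is there a set $X\subseteq V$ of size $k$ such that $\mathrm{mco}(D-X)\le \ell$? Standing convention: $k+\ell<n$. The problem parameterized by $k$ is fixed-parameter tractable if it can be solved in time $f(k)\cdot n^{\mathcal{O}(1)}$ for some computable function $f$. -}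

module Defs where

open import Data.Bool using (Bool; true; false; T; if_then_else_)
open import Data.Bool.Properties using (T?)
open import Data.Fin using (Fin; fromℕ<; remQuot)
open import Data.Fin.Properties using () renaming (_≟_ to _≟ᶠ_)
open import Data.Fin.Subset using (Subset; _∈_; ∁; ∣_∣)
open import Data.Fin.Subset.Properties using (_∈?_)
open import Data.List using (List; []; _∷_; map; allFin)
open import Data.List.Extrema.Nat using (max)
open import Data.List.Membership.Propositional using () renaming (_∈_ to _∈ₗ_)
open import Data.List.Membership.Propositional.Properties using (∈-allFin)
open import Data.List.Relation.Unary.Any using (here; there)
open import Data.Nat using (ℕ; zero; suc; _+_; _*_; _∸_; _^_; _/_; _%_; _≤_; _<_; _≡ᵇ_; _<ᵇ_; _<?_)
open import Data.Nat.Properties using (m^n≢0)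
open import Data.Product using (_×_; _,_; ∃-syntax; Σ-syntax)
open import Data.Sum using (_⊎_; inj₁; inj₂)
open import Data.Vec using (tabulate)
open import Function using (id)
open import Function.Bundles using (_⇔_)
open import Level using (0ℓ)
open import Relation.Binary using (Rel; Decidable)
open import Relation.Binary.Construct.Closure.ReflexiveTransitive using (Star; ε; _◅_; _◅◅_)
open import Relation.Binary.PropositionalEquality using (_≡_; _≢_; refl)
open import Relation.Nullary using (yes; no; does)
open import Relation.Nullary.Decidable using (_×-dec_; _⊎-dec_; map′)

------------------------------------------------------------------------
-- Digraphs

record Digraph (n : ℕ) : Set where
  field
    arc      : Fin n → Fin n → Bool
    loopless : ∀ x → arc x x ≡ false

open Digraph public

DigraphClass : Set₁
DigraphClass = ∀ {n} → Digraph n → Set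

Semicomplete : DigraphClass
Semicomplete D = ∀ x y → x ≢ y → T (arc D x y) ⊎ T (arc D y x)

------------------------------------------------------------------------
-- Decidability of reachability in a finite digraph

module _ {n : ℕ} {R : Rel (Fin n) 0ℓ} (R? : Decidable R) where

  -- Walks all of whose inner vertices belong to xs.
  Via : List (Fin n) → Rel (Fin n) 0ℓ
  Via []       u v = u ≡ v ⊎ R u v
  Via (x ∷ xs) u v = Via xs u v ⊎ (Via xs u x × Via xs x v)

  via? : ∀ xs → Decidable (Via xs)
  via? []       u v = (u ≟ᶠ v) ⊎-dec R? u v
  via? (x ∷ xs) u v = via? xs u v ⊎-dec (via? xs u x ×-dec via? xs x v)

  via⇒star : ∀ xs {u v} → Via xs u v → Star R u v
  via⇒star []       (inj₁ refl)    = ε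
  via⇒star []       (inj₂ r)       = r ◅ ε
  via⇒star (x ∷ xs) (inj₁ p)       = via⇒star xs p
  via⇒star (x ∷ xs) (inj₂ (p , q)) = via⇒star xs p ◅◅ via⇒star xs q

  via-base : ∀ xs {u v} → u ≡ v ⊎ R u v → Via xs u v
  via-base []       p = p
  via-base (x ∷ xs) p = inj₁ (via-base xs p)

  via-trans : ∀ xs {u y v} → y ∈ₗ xs → Via xs u y → Via xs y v → Via xs u v
  via-trans (x ∷ xs) (here refl) p q = inj₂ (to p , from q)
    where
    to : ∀ {u} → Via (x ∷ xs) u x → Via xs u x
    to (inj₁ a)       = a
    to (inj₂ (a , _)) = a
    from : ∀ {v} → Via (x ∷ xs) x v → Via xs x v
    from (inj₁ a)       = a
    from (inj₂ (_ , a)) = a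
  via-trans (x ∷ xs) (there y∈) (inj₁ p)       (inj₁ q)       = inj₁ (via-trans xs y∈ p q)
  via-trans (x ∷ xs) (there y∈) (inj₁ p)       (inj₂ (q , r)) = inj₂ (via-trans xs y∈ p q , r)
  via-trans (x ∷ xs) (there y∈) (inj₂ (o , p)) (inj₁ q)       = inj₂ (o , via-trans xs y∈ p q)
  via-trans (x ∷ xs) (there y∈) (inj₂ (o , _)) (inj₂ (_ , r)) = inj₂ (o , r)

  star⇒via : ∀ {u v} → Star R u v → Via (allFin n) u v
  star⇒via ε        = via-base (allFin n) (inj₁ refl)
  star⇒via (r ◅ rs) =
    via-trans (allFin n) (∈-allFin _) (via-base (allFin n) (inj₂ r)) (star⇒via rs)

  star? : Decidable (Star R)
  star? u v = map′ (via⇒star (allFin n)) star⇒via (via? (allFin n) u v)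

------------------------------------------------------------------------
-- Strongly connected components and the problem

-- For S : Subset n, the arcs of the subdigraph of D induced by S.
InducedArc : ∀ {n} → Digraph n → Subset n → Rel (Fin n) 0ℓ
InducedArc D S u v = u ∈ S × v ∈ S × T (arc D u v)

inducedArc? : ∀ {n} (D : Digraph n) (S : Subset n) → Decidable (InducedArc D S)
inducedArc? D S u v = (u ∈? S) ×-dec ((v ∈? S) ×-dec T? (arc D u v))

SameComponent : ∀ {n} → Digraph n → Subset n → Rel (Fin n) 0ℓ
SameComponent D S u v =
  u ∈ S × v ∈ S × Star (InducedArc D S) u v × Star (InducedArc D S) v u

sameComponent? : ∀ {n} (D : Digraph n) (S : Subset n) → Decidable (SameComponent D S)
sameComponent? D S u v =
  (u ∈? S) ×-dec ((v ∈? S) ×-dec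
    (star? (inducedArc? D S) u v ×-dec star? (inducedArc? D S) v u))

-- The strongly connected component of u in the subdigraph induced by S
-- (the empty set when u is not a vertex of that subdigraph).
component : ∀ {n} → Digraph n → Subset n → Fin n → Subset n
component D S u = tabulate (λ v → does (sameComponent? D S u v))

-- mco of the subdigraph of D induced by S (0 when S is empty).
mco : ∀ {n} → Digraph n → Subset n → ℕ
mco {n} D S = max 0 (map (λ u → ∣ component D S u ∣) (allFin n))

-- D - X is the subdigraph induced by the complement of X.
DCOC : ∀ {n} → Digraph n → (ℓ k : ℕ) → Set
DCOC {n} D ℓ k = Σ[ X ∈ Subset n ] (∣ X ∣ ≡ k × mco D (∁ X) ≤ ℓ)

------------------------------------------------------------------------
-- Random access machines
--
-- Programs are structured programs for a random access machine with
-- countably many registers (a program names finitely many of them) and an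
-- indirectly addressed memory.  Every operation, memory access and test has
-- unit cost.

data Op : Set where
  add sub mul div mod lt eq : Op

data Expr : Set where
  lit : ℕ → Expr
  reg : ℕ → Expr
  mem : Expr → Expr
  op  : Op → Expr → Expr → Expr

infixr 5 _⨾_

data Cmd : Set where
  skip  : Cmd
  set   : ℕ → Expr → Cmd
  store : Expr → Expr → Cmd
  _⨾_   : Cmd → Cmd → Cmd
  cond  : Expr → Cmd → Cmd → Cmd
  while : Expr → Cmd → Cmd

record State : Set where
  constructor ⟨_,_⟩
  field
    registers : ℕ → ℕ
    memory    : ℕ → ℕ

open State public

_[_↦_] : (ℕ → ℕ) → ℕ → ℕ → (ℕ → ℕ)
(f [ a ↦ v ]) b = if b ≡ᵇ a then v else f b

-- Subtraction is truncated; division and remainder by zero give 0.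
⟦_⟧ : Op → ℕ → ℕ → ℕ
⟦ add ⟧ x y       = x + y
⟦ sub ⟧ x y       = x ∸ y
⟦ mul ⟧ x y       = x * y
⟦ div ⟧ x zero    = 0
⟦ div ⟧ x (suc y) = x / suc y
⟦ mod ⟧ x zero    = 0
⟦ mod ⟧ x (suc y) = x % suc y
⟦ lt ⟧  x y       = if x <ᵇ y then 1 else 0
⟦ eq ⟧  x y       = if x ≡ᵇ y then 1 else 0

costᵉ : Expr → ℕ
costᵉ (lit _)     = 1
costᵉ (reg _)     = 1
costᵉ (mem e)     = suc (costᵉ e)
costᵉ (op _ d e)  = suc (costᵉ d + costᵉ e)

-- wrap is applied to every literal and to the result of every operation: it
-- is reduction modulo 2 ^ w on a machine with words of w bits, and the
-- identity on a machine with unbounded words.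
module Semantics (wrap : ℕ → ℕ) where

  eval : State → Expr → ℕ
  eval σ (lit v)    = wrap v
  eval σ (reg r)    = registers σ r
  eval σ (mem e)    = memory σ (eval σ e)
  eval σ (op o d e) = wrap (⟦ o ⟧ (eval σ d) (eval σ e))

  -- Run c σ σ′ t : started in σ, c halts in σ′ after t steps.  A test
  -- succeeds when its value is nonzero.
  data Run : Cmd → State → State → ℕ → Set where
    run-skip   : ∀ {σ} → Run skip σ σ 1
    run-set    : ∀ {r e σ} →
                 Run (set r e) σ
                     ⟨ registers σ [ r ↦ eval σ e ] , memory σ ⟩
                     (suc (costᵉ e))
    run-store  : ∀ {a e σ} →
                 Run (store a e) σ
                     ⟨ registers σ , memory σ [ eval σ a ↦ eval σ e ] ⟩
                     (suc (costᵉ a + costᵉ e))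
    run-seq    : ∀ {c d σ σ′ σ″ s t} →
                 Run c σ σ′ s → Run d σ′ σ″ t → Run (c ⨾ d) σ σ″ (s + t)
    run-then   : ∀ {e c d σ σ′ t} → eval σ e ≢ 0 →
                 Run c σ σ′ t → Run (cond e c d) σ σ′ (suc (costᵉ e + t))
    run-else   : ∀ {e c d σ σ′ t} → eval σ e ≡ 0 →
                 Run d σ σ′ t → Run (cond e c d) σ σ′ (suc (costᵉ e + t))
    while-stop : ∀ {e c σ} → eval σ e ≡ 0 →
                 Run (while e c) σ σ (suc (costᵉ e))
    while-step : ∀ {e c σ σ′ σ″ s t} → eval σ e ≢ 0 →
                 Run c σ σ′ s → Run (while e c) σ′ σ″ t →
                 Run (while e c) σ σ″ (suc (costᵉ e + (s + t)))

modWord : ℕ → ℕ → ℕ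
modWord w x = _%_ x (2 ^ w) {{m^n≢0 2 w}}

output : State → ℕ
output σ = registers σ 0

-- The adjacency matrix is stored row by row at addresses 0, …, n * n - 1.
adjacencyMatrix : ∀ {n} → Digraph n → ℕ → ℕ
adjacencyMatrix {n} D a with a <? n * n
... | no  _ = 0
... | yes a<n² with remQuot {n} n (fromℕ< a<n²)
...   | i , j = if arc D i j then 1 else 0

instanceRegisters : (n ℓ k : ℕ) → ℕ → ℕ
instanceRegisters n ℓ k 0 = n
instanceRegisters n ℓ k 1 = ℓ
instanceRegisters n ℓ k 2 = k
instanceRegisters n ℓ k _ = 0

initial : ∀ {n} → Digraph n → (ℓ k : ℕ) → State
initial {n} D ℓ k = ⟨ instanceRegisters n ℓ k , adjacencyMatrix D ⟩

-- The program p decides every instance whose digraph lies in 𝒞, in at most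
-- T n k steps.  As usual for the word RAM, p has to be correct for every
-- sufficiently large word length, where c * (k + log₂ n) bits suffice for
-- some constant c: an algorithm with running time 2 ^ O(k) * n ^ O(1) must be
-- able to address the tables it builds.
SolvesDCOCWithin : DigraphClass → (ℕ → ℕ → ℕ) → Cmd → Set
SolvesDCOCWithin 𝒞 T p =
  ∃[ c ] (∀ n (D : Digraph n) ℓ k → 𝒞 D → 1 ≤ ℓ → k + ℓ < n →
          ∀ w → (2 ^ k * n) ^ c ≤ 2 ^ w →
          ∃[ σ ] ∃[ t ] (Semantics.Run (modWord w) p (initial D ℓ k) σ t
                         × t ≤ T n k
                         × (output σ ≡ 1 ⇔ DCOC D ℓ k)))

-- Computability is with respect to machines with unbounded words.
Computable : (ℕ → ℕ) → Set
Computable f =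
  ∃[ p ] (∀ m → ∃[ σ ] ∃[ t ]
    (Semantics.Run id p ⟨ (λ _ → 0) [ 0 ↦ m ] , (λ _ → 0) ⟩ σ t
     × output σ ≡ f m))

-- The constant hidden in n ^ O(1) is absorbed in f.
FixedParameterTractableOn : DigraphClass → Set
FixedParameterTractableOn 𝒞 =
  ∃[ p ] ∃[ f ] ∃[ d ] (Computable f × SolvesDCOCWithin 𝒞 (λ n k → f k * n ^ d) p)

{-# OPTIONS --safe #-}

-- A set X with mco (D - X) ≤ ℓ is found one cut at a time, from left to right.
-- A cut of the remaining graph R consists of a set C with at most ℓ vertices
-- and its in-boundary, which is deleted; the rest of R lies to the right of C.
-- Cuts without deletions are taken greedily, so each further cut costs b ≥ 1
-- deletions.  Two facts bound the number of candidates by 2 ^ O(b).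
--
-- (1) In a semicomplete digraph, a cut with |C| = c and at most b deletions is
-- determined by c up to the side of at most 5 b - 2 vertices, all others being
-- placed by their in- and out-degrees, and up to at most b binary choices: each
-- arc from right to left has to lose one of its ends.
--
-- (2) It suffices to consider O(b) sizes c.  If c is not close to ℓ, take a
-- subset A of C with |A| ≥ c - b and with the smallest boundary m, and the
-- largest cut C₀ with at most m deletions that is found with the same binary
-- choices as A.  Either |C₀| is close to c, or C is contained in C₀ and its
-- boundary; in this case the boundary of C ∪ C₀ has at most b vertices by
-- submodularity, so C can be replaced by C ∪ C₀, whose size is close to |C₀|.
--
-- All these choices are digits of an advice string with less than 15 bits per
-- deletion.  The program tries all 2 ^ (15 k) strings, each in O(k² n²) steps:
-- the in-degrees from the right of all degree cuts of R are tabulated in O(n²)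
-- steps, after which each cut is evaluated in O(k n) steps.

module Submission where

open import Defs
open import Data.Bool using (Bool; true; false; T; if_then_else_; _∧_; _∨_; not)
open import Data.Empty using (⊥; ⊥-elim)
open import Data.Fin using (Fin; toℕ; fromℕ<; remQuot; combine)
open import Data.Fin.Properties using (toℕ-fromℕ<; fromℕ<-toℕ; toℕ<n; toℕ-combine; remQuot-combine)
open import Data.Fin.Subset using (Subset; _∈_; _⊆_; ∁; ∣_∣)
open import Data.Fin.Subset.Properties using (p⊆q⇒∣p∣≤∣q∣; p⊂q⇒∣p∣<∣q∣; x∈∁p⇒x∉p; x∉p⇒x∈∁p; _∈?_)
open import Data.List using (List; []; _∷_; _++_; allFin; map)
open import Data.List.Extrema.Nat using (xs≤max; max≤v⁺)
open import Data.List.Membership.Propositional.Properties using (∈-allFin; ∈-map⁺)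
import Data.List.Relation.Unary.All as All
import Data.List.Relation.Unary.All.Properties as AllP
open import Data.Nat
open import Data.Nat.Divisibility using (divides)
open import Data.Nat.DivMod hiding (_mod_; _div_; _divMod_)
open import Data.Nat.Properties
open import Data.Nat.Solver
open import Data.Product using (_×_; _,_; proj₁; proj₂; Σ; ∃-syntax)
open import Data.Sum using (_⊎_; inj₁; inj₂)
open import Data.Unit using (⊤; tt)
open import Data.Vec using (tabulate; lookup; []; _∷_)
open import Data.Vec.Properties using (lookup∘tabulate; []=⇒lookup; lookup⇒[]=)
open import Function using (id; _∘_)
open import Function.Bundles using (_⇔_; mk⇔)
open import Relation.Binary.Construct.Closure.ReflexiveTransitive using (Star; ε; _◅_; _◅◅_)
open import Relation.Binary.PropositionalEquality
open import Relation.Nullary using (yes; no; ¬_; Dec; does)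
open import Relation.Nullary.Decidable using (dec-true)

-- Every string is tried, so soundness must not depend on its origin: a cut is checked for arcs from
-- right to left and charged for its deletions and for the vertices that it has on the left beyond
-- ℓ, and a rejected cut changes nothing. The charge for the surplus is needed because the cut that
-- is found need not be C. Vertices of the boundary of C may stay on the left; but the left and the
-- deleted vertices together number at most |C| + b, so b deletions still cover the surplus.
--
-- The count of bits behind 15: a cut with b deletions reads b bits while it waits, a string of 5 b
-- - 2 bits and one of b bits for A, the same again for the final cut, and two numbers below b + 2
-- and 4 b + 1, which take at most b + 1 and b + 2 bits. The sum is 15 b - 1. The step count has a
-- factor (k + 1)²; one k + 1 is absorbed into 2 ^ k, which turns 15 k into 16 k.
--
-- The machine computes modulo 2 ^ w. Registers and arrays hold numbers up to a bound B, a power of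
-- 2 ^ k * n, and intermediate results stay below B ^ 6 or equal it, so that the reduction never
-- takes effect.

b2n : Bool → ℕ
b2n b = if b then 1 else 0

∧-left : ∀ {x y} → x ∧ y ≡ true → x ≡ true
∧-left {true} _ = refl

∧-right : ∀ {x y} → x ∧ y ≡ true → y ≡ true
∧-right {true} q = q

∨-falseˡ : ∀ {x y} → x ∨ y ≡ false → x ≡ false
∨-falseˡ {false} _ = refl

∨-falseʳ : ∀ {x y} → x ∨ y ≡ false → y ≡ false
∨-falseʳ {false} q = q

T⇒≡ : ∀ {x} → T x → x ≡ true
T⇒≡ {true} _ = refl

≡⇒T : ∀ {x} → x ≡ true → T x
≡⇒T refl = tt

≡ᵇ-refl : ∀ x → (x ≡ᵇ x) ≡ true
≡ᵇ-refl x = T⇒≡ (≡⇒≡ᵇ x x refl)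

≡ᵇ-true : ∀ {x y} → (x ≡ᵇ y) ≡ true → x ≡ y
≡ᵇ-true {x} {y} q = ≡ᵇ⇒≡ x y (≡⇒T q)

≡ᵇ-false : ∀ {x y} → x ≢ y → (x ≡ᵇ y) ≡ false
≡ᵇ-false {x} {y} q with x ≡ᵇ y in ≡q
... | true  = ⊥-elim (q (≡ᵇ-true ≡q))
... | false = refl

<ᵇ-true : ∀ {x y} → (x <ᵇ y) ≡ true → x < y
<ᵇ-true {x} {y} q = <ᵇ⇒< x y (≡⇒T q)

<ᵇ-intro : ∀ {x y} → x < y → (x <ᵇ y) ≡ true
<ᵇ-intro q = T⇒≡ (<⇒<ᵇ q)

<ᵇ-false : ∀ {x y} → (x <ᵇ y) ≡ false → y ≤ x
<ᵇ-false {x} {y} q with x <? y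
... | yes p = ⊥-elim (true≢false (trans (sym (<ᵇ-intro p)) q))
  where true≢false : true ≢ false
        true≢false ()
... | no ¬p = ≮⇒≥ ¬p

<ᵇ-elimF : ∀ {x y} → y ≤ x → (x <ᵇ y) ≡ false
<ᵇ-elimF {x} {y} q with x <ᵇ y in ≡q
... | true  = ⊥-elim (<⇒≱ (<ᵇ-true ≡q) q)
... | false = refl

upd-same : (f : ℕ → ℕ) (i v : ℕ) → (f [ i ↦ v ]) i ≡ v
upd-same f i v rewrite ≡ᵇ-refl i = refl

upd-other : (f : ℕ → ℕ) {i j : ℕ} (v : ℕ) → j ≢ i → (f [ i ↦ v ]) j ≡ f j
upd-other f v j≢i rewrite ≡ᵇ-false j≢i = refl

-- A language with bounded loops and its compilation

data Ex : Set where
  num : ℕ → Ex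
  var : ℕ → Ex
  arr : ℕ → Ex → Ex
  adj : Ex → Ex → Ex
  bin : Op → Ex → Ex → Ex
  ite : Ex → Ex → Ex → Ex

data Bd : Set where
  bd-n bd-n+1 bd-k bd-6k bd-2^15k : Bd

infixr 5 _⨟_

data Pr : Set where
  nop : Pr
  asg : ℕ → Ex → Pr
  put : ℕ → Ex → Ex → Pr
  _⨟_ : Pr → Pr → Pr
  cnd : Ex → Pr → Pr → Pr
  -- Register r runs through 0, …, N - 1, where N is the content of
  -- register q.
  for : Bd → (r q : ℕ) → Pr → Pr

-- Register 3 holds n and register 4 holds n * n.  Sixteen arrays are
-- interleaved in the memory behind the adjacency matrix.
⌊_⌋ᵉ : Ex → Expr
⌊ num v ⌋ᵉ     = lit v
⌊ var r ⌋ᵉ     = reg r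
⌊ arr j e ⌋ᵉ   = mem (op add (reg 4) (op add (op mul ⌊ e ⌋ᵉ (lit 16)) (lit j)))
⌊ adj d e ⌋ᵉ   = mem (op mod (op add (op mul ⌊ d ⌋ᵉ (reg 3)) ⌊ e ⌋ᵉ) (reg 4))
⌊ bin o d e ⌋ᵉ = op o ⌊ d ⌋ᵉ ⌊ e ⌋ᵉ
⌊ ite c d e ⌋ᵉ = op add (op mul (op lt (lit 0) ⌊ c ⌋ᵉ) ⌊ d ⌋ᵉ)
                        (op mul (op eq ⌊ c ⌋ᵉ (lit 0)) ⌊ e ⌋ᵉ)

⌊_⌋ : Pr → Cmd
⌊ nop ⌋         = skip
⌊ asg r e ⌋     = set r ⌊ e ⌋ᵉ
⌊ put j d e ⌋   = store (op add (reg 4) (op add (op mul ⌊ d ⌋ᵉ (lit 16)) (lit j))) ⌊ e ⌋ᵉ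
⌊ p ⨟ q ⌋       = ⌊ p ⌋ ⨾ ⌊ q ⌋
⌊ cnd e p q ⌋   = cond ⌊ e ⌋ᵉ ⌊ p ⌋ ⌊ q ⌋
⌊ for _ r q p ⌋ = set r (lit 0) ⨾ while (op lt (reg r) (reg q)) (⌊ p ⌋ ⨾ set r (op add (reg r) (lit 1)))

record Store : Set where
  constructor ⟪_,_⟫
  field
    rg : ℕ → ℕ
    ar : ℕ → ℕ → ℕ

open Store public

setR : Store → ℕ → ℕ → Store
setR H r v = ⟪ rg H [ r ↦ v ] , ar H ⟫

setA : Store → ℕ → ℕ → ℕ → Store
setA H j i v = ⟪ rg H , (λ j′ → if j′ ≡ᵇ j then ar H j [ i ↦ v ] else ar H j′) ⟫

-- A bound for the exponent of B in the value of an expression.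
deg : Ex → ℕ
deg (num _)       = 1
deg (var _)       = 1
deg (arr _ _)     = 1
deg (adj _ _)     = 1
deg (bin add d e) = suc (deg d ⊔ deg e)
deg (bin sub d e) = deg d
deg (bin mul d e) = deg d + deg e
deg (bin div d e) = deg d
deg (bin mod d e) = deg d
deg (bin lt _ _)  = 1
deg (bin eq _ _)  = 1
deg (ite _ d e)   = suc (deg d ⊔ deg e)

-- Intermediate values must have degree at most 6, since B ^ 6 < 2 ^ w is what the word length
-- guarantees. An array index may have degree 3 only: in the address `n * n + (i * 16 + j)` the
-- product and the two sums raise the degree by one each.
wfE : Ex → Bool
wfE (num v)     = v <ᵇ 65536
wfE (var _)     = true
wfE (arr j e)   = wfE e ∧ ((deg e <ᵇ 4) ∧ (j <ᵇ 16))
wfE (adj d e)   = wfE d ∧ (wfE e ∧ (suc (suc (deg d) ⊔ deg e) <ᵇ 7))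
wfE (bin o d e) = wfE d ∧ (wfE e ∧ (deg (bin o d e) <ᵇ 7))
wfE (ite c d e) = wfE c ∧ (wfE d ∧ (wfE e ∧ (suc (deg d ⊔ deg e) <ᵇ 7)))

-- Such a value is bounded by a register, an array cell, a short literal or a truth value, hence by
-- B without further proof. Only the other expressions carry an obligation when they are stored, see
-- `Fits`.
tame : Ex → Bool
tame (num _)       = true
tame (var _)       = true
tame (arr _ _)     = true
tame (adj _ _)     = true
tame (bin add _ _) = false
tame (bin mul _ _) = false
tame (bin sub d _) = tame d
tame (bin div d _) = tame d
tame (bin mod d _) = tame d
tame (bin lt _ _)  = true
tame (bin eq _ _)  = true
tame (ite _ d e)   = tame d ∧ tame e

infix 4 _∈ᵇ_

_∈ᵇ_ : ℕ → List ℕ → Bool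
r ∈ᵇ []       = false
r ∈ᵇ (x ∷ xs) = (r ≡ᵇ x) ∨ (r ∈ᵇ xs)

∈ᵇ-++ : ∀ r xs {ys} → (r ∈ᵇ xs ++ ys) ≡ false → (r ∈ᵇ xs) ≡ false × (r ∈ᵇ ys) ≡ false
∈ᵇ-++ r []       q = refl , q
∈ᵇ-++ r (x ∷ xs) q with r ≡ᵇ x
... | false = ∈ᵇ-++ r xs q

writesR : Pr → List ℕ
writesR nop           = []
writesR (asg r _)     = r ∷ []
writesR (put _ _ _)   = []
writesR (p ⨟ q)       = writesR p ++ writesR q
writesR (cnd _ p q)   = writesR p ++ writesR q
writesR (for _ r _ p) = r ∷ writesR p

writesA : Pr → List ℕ
writesA nop           = []
writesA (asg _ _)     = []
writesA (put j _ _)   = j ∷ []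
writesA (p ⨟ q)       = writesA p ++ writesA q
writesA (cnd _ p q)   = writesA p ++ writesA q
writesA (for _ _ _ p) = writesA p

-- Registers 0 to 4 hold the instance, n and n², on which the addresses of the compiled code depend.
safeR : ℕ → Bool
safeR r = 4 <ᵇ r

wf : Pr → Bool
wf nop           = true
wf (asg r e)     = safeR r ∧ wfE e
wf (put j d e)   = (j <ᵇ 16) ∧ (wfE d ∧ ((deg d <ᵇ 4) ∧ wfE e))
wf (p ⨟ q)       = wf p ∧ wf q
wf (cnd e p q)   = wfE e ∧ (wf p ∧ wf q)
-- The body changes neither the counter nor the limit, so the number of rounds is known on entry.
wf (for _ r q p) = safeR r ∧ (wf p ∧ (not (r ∈ᵇ writesR p) ∧ (not (q ∈ᵇ writesR p) ∧ not (q ≡ᵇ r))))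

wc : (Bd → ℕ) → Pr → ℕ
wc β nop           = 1
wc β (asg r e)     = suc (costᵉ ⌊ e ⌋ᵉ)
wc β (put j d e)   = suc (costᵉ (op add (reg 4) (op add (op mul ⌊ d ⌋ᵉ (lit 16)) (lit j))) + costᵉ ⌊ e ⌋ᵉ)
wc β (p ⨟ q)       = wc β p + wc β q
wc β (cnd e p q)   = suc (costᵉ ⌊ e ⌋ᵉ + (wc β p ⊔ wc β q))
-- Initialisation costs 2 and the failing test 4; every round costs 4 for its test and 4 for the
-- increment.
wc β (for x r q p) = 6 + β x * (8 + wc β p)

-- Weakest preconditions for the language with bounded loops

module Machine (n : ℕ) .{{n≢0 : NonZero n}} (E : ℕ → ℕ → Bool) (β : Bd → ℕ) (B : ℕ) (B-large : 65536 ≤ B) where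

  instance
    n²≢0 : NonZero (n * n)
    n²≢0 = m*n≢0 n n

  ev : Store → Ex → ℕ
  ev H (num v)     = v
  ev H (var r)     = rg H r
  ev H (arr j e)   = ar H j (ev H e)
  ev H (adj d e)   = b2n (E (ev H d) (ev H e))
  ev H (bin o d e) = ⟦ o ⟧ (ev H d) (ev H e)
  ev H (ite c d e) = if ev H c ≡ᵇ 0 then ev H e else ev H d

  Fits : Ex → Store → Set
  Fits e H = if tame e then ⊤ else (ev H e ≤ B)

  -- Here m is the number of rounds that are left. The counter is assigned instead of incremented;
  -- this agrees with the compiled loop because `wf` keeps the body from writing it.
  for-from : ((Store → Set) → Store → Set) → ℕ → (Store → Set) → ℕ → ℕ → Store → Set
  for-from W r Q zero    i H = Q H
  for-from W r Q (suc m) i H = W (λ H′ → for-from W r Q m (suc i) (setR H′ r (suc i))) H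

  WP : Pr → (Store → Set) → Store → Set
  WP nop           Q H = Q H
  WP (asg r e)     Q H = Fits e H × Q (setR H r (ev H e))
  WP (put j d e)   Q H = Fits e H × Q (setA H j (ev H d) (ev H e))
  WP (p ⨟ q)       Q H = WP p (WP q Q) H
  WP (cnd e p q)   Q H = (ev H e ≢ 0 → WP p Q H) × (ev H e ≡ 0 → WP q Q H)
  WP (for x r q p) Q H = rg H q ≤ β x × for-from (WP p) r Q (rg H q) 0 (setR H r 0)

  mutual
    WP-mono : ∀ p {Q Q′} {H} → (∀ H′ → Q H′ → Q′ H′) → WP p Q H → WP p Q′ H
    WP-mono nop           f w       = f _ w
    WP-mono (asg r e)     f (a , w) = a , f _ w
    WP-mono (put j d e)   f (a , w) = a , f _ w
    WP-mono (p ⨟ q)       f w       = WP-mono p (λ _ → WP-mono q f) w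
    WP-mono (cnd e p q)   f (a , b) = (λ x → WP-mono p f (a x)) , (λ x → WP-mono q f (b x))
    WP-mono (for x r q p) {H = H} f (a , w) = a , for-mono p r (rg H q) 0 f w

    for-mono : ∀ p r m i {Q Q′} {H} → (∀ H′ → Q H′ → Q′ H′) →
               for-from (WP p) r Q m i H → for-from (WP p) r Q′ m i H
    for-mono p r zero    i f w = f _ w
    for-mono p r (suc m) i f w = WP-mono p (λ _ → for-mono p r m (suc i) f) w

  record Frame (rs as : List ℕ) (H H′ : Store) : Set where
    constructor frame
    field
      keepR : ∀ r → (r ∈ᵇ rs) ≡ false → rg H′ r ≡ rg H r
      keepA : ∀ j i → (j ∈ᵇ as) ≡ false → ar H′ j i ≡ ar H j i

  open Frame public

  Frame-refl : ∀ {rs as H} → Frame rs as H H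
  Frame-refl = frame (λ _ _ → refl) (λ _ _ _ → refl)

  Frame-trans : ∀ {rs as H H′ H″} → Frame rs as H H′ → Frame rs as H′ H″ → Frame rs as H H″
  Frame-trans f g = frame (λ r x → trans (keepR g r x) (keepR f r x))
                          (λ j i x → trans (keepA g j i x) (keepA f j i x))

  Frame-join : ∀ {rs rs′ as as′ H H′ H″} → Frame rs as H H′ → Frame rs′ as′ H′ H″ →
               Frame (rs ++ rs′) (as ++ as′) H H″
  Frame-join {rs} {as = as} f g =
    frame (λ r x → trans (keepR g r (proj₂ (∈ᵇ-++ r rs x))) (keepR f r (proj₁ (∈ᵇ-++ r rs x))))
          (λ j i x → trans (keepA g j i (proj₂ (∈ᵇ-++ j as x))) (keepA f j i (proj₁ (∈ᵇ-++ j as x))))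

  Frame-left : ∀ {rs rs′ as as′ H H′} → Frame rs as H H′ → Frame (rs ++ rs′) (as ++ as′) H H′
  Frame-left {rs} {as = as} f =
    frame (λ r x → keepR f r (proj₁ (∈ᵇ-++ r rs x))) (λ j i x → keepA f j i (proj₁ (∈ᵇ-++ j as x)))

  Frame-right : ∀ {rs rs′ as as′ H H′} → Frame rs′ as′ H H′ → Frame (rs ++ rs′) (as ++ as′) H H′
  Frame-right {rs} {as = as} f =
    frame (λ r x → keepR f r (proj₂ (∈ᵇ-++ r rs x))) (λ j i x → keepA f j i (proj₂ (∈ᵇ-++ j as x)))

  Frame-setR : ∀ {rs as} H r v → Frame (r ∷ rs) as H (setR H r v)
  Frame-setR {rs} H r v = frame (λ s x → keep s x) (λ _ _ _ → refl)
    where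
    keep : ∀ s → (s ∈ᵇ r ∷ rs) ≡ false → (rg H [ r ↦ v ]) s ≡ rg H s
    keep s x with s ≡ᵇ r
    ... | false = refl

  Frame-setA : ∀ {rs} H j i v → Frame rs (j ∷ []) H (setA H j i v)
  Frame-setA H j i v = frame (λ _ _ → refl) keep
    where
    keep : ∀ j′ i′ → (j′ ∈ᵇ j ∷ []) ≡ false → ar (setA H j i v) j′ i′ ≡ ar H j′ i′
    keep j′ i′ x with j′ ≡ᵇ j
    ... | false = refl

  Frame-weaken : ∀ {r rs as H H′} → Frame rs as H H′ → Frame (r ∷ rs) as H H′
  Frame-weaken {r} f = frame (λ s x → keepR f s (∨-falseʳ {s ≡ᵇ r} x)) (keepA f)

  mutual
    -- What a program leaves alone can be read off its syntax. Specifications therefore state only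
    -- what changes, and at concrete registers and arrays the membership tests of a frame are closed
    -- by `refl`.
    WP-frame : ∀ p {Q} {H} → WP p Q H → WP p (λ H′ → Q H′ × Frame (writesR p) (writesA p) H H′) H
    WP-frame nop         w       = w , Frame-refl
    WP-frame (asg r e)   {H = H} (a , w) = a , w , Frame-setR H r _
    WP-frame (put j d e) {H = H} (a , w) = a , w , Frame-setA H j _ _
    WP-frame (p ⨟ q)     w       =
      WP-mono p (λ H′ (x , f) → WP-mono q (λ H″ (y , g) → y , Frame-join f g) (WP-frame q x)) (WP-frame p w)
    WP-frame (cnd e p q) (a , b) =
      (λ x → WP-mono p (λ _ (y , f) → y , Frame-left f) (WP-frame p (a x))) ,
      (λ x → WP-mono q (λ _ (y , f) → y , Frame-right {writesR p} {as = writesA p} f) (WP-frame q (b x)))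
    WP-frame (for x r q p) {H = H} (a , w) = a , for-frame p r (rg H q) 0 (Frame-setR H r 0) w

    for-frame : ∀ p r m i {Q} {H₀ H} → Frame (r ∷ writesR p) (writesA p) H₀ H → for-from (WP p) r Q m i H →
                for-from (WP p) r (λ H′ → Q H′ × Frame (r ∷ writesR p) (writesA p) H₀ H′) m i H
    for-frame p r zero    i f w = w , f
    for-frame p r (suc m) i f w =
      WP-mono p (λ H′ (x , g) → for-frame p r m (suc i)
                   (Frame-trans f (Frame-trans (Frame-weaken g) (Frame-setR H′ r (suc i)))) x)
                (WP-frame p w)

  bind : ∀ p {Q Q′} {H} → WP p Q H → (∀ H′ → Q H′ → Frame (writesR p) (writesA p) H H′ → Q′ H′) → WP p Q′ H
  bind p w f = WP-mono p (λ H′ (x , g) → f H′ x g) (WP-frame p w)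

  -- A record, so that two specifications are compared by their programs
  -- instead of their weakest preconditions.
  record Spec (p : Pr) (Q : Store → Set) (H : Store) : Set where
    constructor spec
    field
      wp : WP p Q H

  open Spec public

  Spec-mono : ∀ {p Q Q′ H} → (∀ H′ → Q H′ → Q′ H′) → Spec p Q H → Spec p Q′ H
  Spec-mono {p} f s = spec (WP-mono p f (wp s))

  Spec-frame : ∀ {p Q Q′ H} → Spec p Q H → (∀ H′ → Q H′ → Frame (writesR p) (writesA p) H H′ → Q′ H′) → Spec p Q′ H
  Spec-frame {p} s f = spec (bind p (wp s) f)

  Spec-seq : ∀ {p q Q Q′ H} → Spec p Q H → (∀ H′ → Q H′ → Frame (writesR p) (writesA p) H H′ → Spec q Q′ H′) → Spec (p ⨟ q) Q′ H
  Spec-seq {p} s f = spec (bind p (wp s) (λ H′ x fr → wp (f H′ x fr)))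

  LoopFrame : ℕ → Pr → Store → Store → Set
  LoopFrame r p = Frame (r ∷ writesR p) (writesA p)

  Step : ℕ → Pr → (ℕ → Store → Set) → ℕ → Store → Set
  Step r p Inv N H = ∀ i H′ → i < N → rg H′ r ≡ i → LoopFrame r p H H′ → Inv i H′ →
                     WP p (λ H″ → Inv (suc i) (setR H″ r (suc i))) H′

  WP-for : ∀ x r q p {H Q} (Inv : ℕ → Store → Set) N → rg H q ≡ N → N ≤ β x → Inv 0 (setR H r 0) → Step r p Inv N H →
           (∀ H′ → Inv N H′ → LoopFrame r p H H′ → Q H′) → WP (for x r q p) Q H
  WP-for x r q p {H} {Q} Inv N refl bound start step end =
    bound , go (rg H q) 0 (+-identityʳ _) (upd-same (rg H) r 0) (Frame-setR H r 0) start
    where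
    go : ∀ m i {H′} → m + i ≡ rg H q → rg H′ r ≡ i → LoopFrame r p H H′ → Inv i H′ → for-from (WP p) r Q m i H′
    go zero    i refl _  fr inv = end _ inv fr
    go (suc m) i ≡q   ri fr inv =
      WP-mono p (λ H′ (inv′ , g) → go m (suc i) (trans (+-suc m i) ≡q) (upd-same (rg H′) r (suc i))
                    (Frame-trans fr (Frame-trans (Frame-weaken g) (Frame-setR H′ r (suc i)))) inv′)
        (WP-frame p (step i _ (subst (i <_) ≡q (s≤s (m≤n+m i m))) ri fr inv))

  Spec-asg : ∀ {r e q Q H} → Fits e H → Spec q Q (setR H r (ev H e)) → Spec (asg r e ⨟ q) Q H
  Spec-asg f s = spec (f , wp s)

  Spec-cnd : ∀ {e p q Q H} → (ev H e ≢ 0 → Spec p Q H) → (ev H e ≡ 0 → Spec q Q H) → Spec (cnd e p q) Q H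
  Spec-cnd f g = spec ((λ x → wp (f x)) , (λ x → wp (g x)))

  Spec-for : ∀ {x r q p H Q} (Inv : ℕ → Store → Set) N → rg H q ≡ N → N ≤ β x → Inv 0 (setR H r 0) →
             (∀ i H′ → i < N → rg H′ r ≡ i → LoopFrame r p H H′ → Inv i H′ → Spec p (λ H″ → Inv (suc i) (setR H″ r (suc i))) H′) →
             (∀ H′ → Inv N H′ → LoopFrame r p H H′ → Q H′) → Spec (for x r q p) Q H
  Spec-for {x} {r} {q} {p} Inv N hq bound start step end =
    spec (WP-for x r q p Inv N hq bound start (λ i H′ a b c d → wp (step i H′ a b c d)) end)

  -- Faithful simulation on machines with long words

  record Small (H : Store) : Set where
    constructor small
    field
      smallR : ∀ r → rg H r ≤ B
      smallA : ∀ j i → ar H j i ≤ B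

  open Small public

  record Rep (σ : State) (H : Store) : Set where
    field
      regs : ∀ r → registers σ r ≡ rg H r
      arrs : ∀ j i → j < 16 → memory σ (n * n + (i * 16 + j)) ≡ ar H j i
      -- The address is reduced modulo n² as in the compiled `adj`. A lookup thus stays inside the
      -- matrix for arbitrary arguments, and no range condition has to be carried along.
      inp  : ∀ u v → memory σ ((u * n + v) % (n * n)) ≡ b2n (E u v)
      reg3 : rg H 3 ≡ n
      reg4 : rg H 4 ≡ n * n

  open Rep public

  1≤B : 1 ≤ B
  1≤B = ≤-trans (s≤s z≤n) B-large

  instance
    B≢0 : NonZero B
    B≢0 = >-nonZero 1≤B

  B^-mono : ∀ {x y} → x ≤ y → B ^ x ≤ B ^ y
  B^-mono = ^-monoʳ-≤ B

  B≤B^1 : ∀ {v} → v ≤ B → v ≤ B ^ 1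
  B≤B^1 p = ≤-trans p (≤-reflexive (sym (*-identityʳ B)))

  1≤B^ : ∀ x → 1 ≤ B ^ x
  1≤B^ x = m^n>0 B x

  add-bound : ∀ {u v} x y → u ≤ B ^ x → v ≤ B ^ y → u + v ≤ B ^ suc (x ⊔ y)
  add-bound {u} {v} x y p q = begin
    u + v                          ≤⟨ +-mono-≤ (≤-trans p (B^-mono (m≤m⊔n x y))) (≤-trans q (B^-mono (m≤n⊔m x y))) ⟩
    B ^ (x ⊔ y) + B ^ (x ⊔ y)       ≡⟨ cong (B ^ (x ⊔ y) +_) (sym (+-identityʳ _)) ⟩
    2 * B ^ (x ⊔ y)                 ≤⟨ *-monoˡ-≤ (B ^ (x ⊔ y)) (≤-trans (s≤s (s≤s z≤n)) B-large) ⟩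
    B * B ^ (x ⊔ y)                 ∎
    where open ≤-Reasoning

  mul-bound : ∀ {u v} x y → u ≤ B ^ x → v ≤ B ^ y → u * v ≤ B ^ (x + y)
  mul-bound x y p q = ≤-trans (*-mono-≤ p q) (≤-reflexive (sym (^-distribˡ-+-* B x y)))

  bool-bound : ∀ (b : Bool) x → (if b then 1 else 0) ≤ B ^ x
  bool-bound true  x = 1≤B^ x
  bool-bound false x = z≤n

  div-bound : ∀ x y → ⟦ div ⟧ x y ≤ x
  div-bound x zero    = z≤n
  div-bound x (suc y) = m/n≤m x (suc y)

  mod-bound : ∀ x y → ⟦ mod ⟧ x y ≤ x
  mod-bound x zero    = z≤n
  mod-bound x (suc y) = m%n≤m x (suc y)

  mod-% : ∀ x y .{{_ : NonZero y}} → ⟦ mod ⟧ x y ≡ x % y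
  mod-% x (suc y) = refl

  bin-bound : ∀ o d e {u v} → u ≤ B ^ deg d → v ≤ B ^ deg e → ⟦ o ⟧ u v ≤ B ^ deg (bin o d e)
  bin-bound add d e p q = add-bound (deg d) (deg e) p q
  bin-bound sub d e {u} {v} p q = ≤-trans (m∸n≤m u v) p
  bin-bound mul d e p q = mul-bound (deg d) (deg e) p q
  bin-bound div d e {u} {v} p q = ≤-trans (div-bound u v) p
  bin-bound mod d e {u} {v} p q = ≤-trans (mod-bound u v) p
  bin-bound lt  d e {u} {v} p q = bool-bound (u <ᵇ v) 1
  bin-bound eq  d e {u} {v} p q = bool-bound (u ≡ᵇ v) 1

  -- A conditional expression is compiled to a sum of two products whose 0-1 factors are
  -- complementary. Both branches are always evaluated, which is harmless since expressions have no
  -- effects.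
  ite-arith : ∀ c x y → (if 0 <ᵇ c then 1 else 0) * x + (if c ≡ᵇ 0 then 1 else 0) * y ≡ (if c ≡ᵇ 0 then y else x)
  ite-arith zero    x y = +-identityʳ y
  ite-arith (suc c) x y = trans (+-identityʳ _) (+-identityʳ x)

  if-bound : ∀ (b : Bool) {x y z : ℕ} → x ≤ z → y ≤ z → (if b then x else y) ≤ z
  if-bound true  p q = p
  if-bound false p q = q

  module _ (w : ℕ) (B^6<2^w : B ^ 6 < 2 ^ w) where

    open Semantics (modWord w)

    wrap-id : ∀ {v} x → v ≤ B ^ x → x ≤ 6 → modWord w v ≡ v
    wrap-id x p q = m<n⇒m%n≡m {{m^n≢0 2 w}} (≤-<-trans (≤-trans p (B^-mono q)) B^6<2^w)

    private
      lit-ok : ∀ {v} → v ≤ B → modWord w v ≡ v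
      lit-ok p = wrap-id 1 (B≤B^1 p) (s≤s z≤n)

      bool-ok : ∀ b → modWord w (if b then 1 else 0) ≡ (if b then 1 else 0)
      bool-ok b = wrap-id 1 (bool-bound b 1) (s≤s z≤n)

    address : ∀ {σ H} j i → Rep σ H → Small H → ∀ x → i ≤ B ^ x → x ≤ 3 → j < 16 → ∀ e → eval σ e ≡ i →
              eval σ (op add (reg 4) (op add (op mul e (lit 16)) (lit j))) ≡ n * n + (i * 16 + j)
    address {σ} {H} j i rep sm x i≤ x≤3 j<16 e refl
      = trans (cong W (cong₂ _+_ (trans (regs rep 4) (reg4 rep)) inner))
              (wrap-id (suc (1 ⊔ suc ((x + 1) ⊔ 1))) (add-bound 1 (suc ((x + 1) ⊔ 1)) O≤ i16j)
                (s≤s (⊔-lub (s≤s z≤n) (s≤s (⊔-lub (+-monoˡ-≤ 1 x≤3) (s≤s z≤n))))))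
      where
      j≤B : j ≤ B
      j≤B = ≤-trans (<⇒≤ j<16) (≤-trans (m≤m+n 16 _) B-large)
      i16 : eval σ e * 16 ≤ B ^ (x + 1)
      i16 = mul-bound x 1 i≤ (B≤B^1 (≤-trans (m≤m+n 16 _) B-large))
      i16j : eval σ e * 16 + j ≤ B ^ suc ((x + 1) ⊔ 1)
      i16j = add-bound (x + 1) 1 i16 (B≤B^1 j≤B)
      O≤ : n * n ≤ B ^ 1
      O≤ = B≤B^1 (subst (_≤ B) (reg4 rep) (smallR sm 4))
      W = modWord w
      scaled : W (i * W 16) ≡ i * 16
      scaled = trans (cong (λ y → W (i * y)) (lit-ok {16} (≤-trans (m≤m+n 16 _) B-large)))
                     (wrap-id (x + 1) i16 (≤-trans (+-monoˡ-≤ 1 x≤3) (m≤m+n 4 2)))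
      inner : W (W (i * W 16) + W j) ≡ i * 16 + j
      inner = trans (cong W (cong₂ _+_ scaled (lit-ok j≤B)))
                    (wrap-id (suc ((x + 1) ⊔ 1)) i16j (s≤s (⊔-lub (≤-trans (+-monoˡ-≤ 1 x≤3) (m≤m+n 4 1)) (s≤s z≤n))))

    -- The bound is proved together with the equation: the bounds of the operands show that the next
    -- operation does not wrap around.
    eval-ev : ∀ {σ H} → Rep σ H → Small H → ∀ e → wfE e ≡ true → eval σ ⌊ e ⌋ᵉ ≡ ev H e × ev H e ≤ B ^ deg e
    eval-ev rep sm (num v) q = lit-ok v≤B , B≤B^1 v≤B
      where v≤B = ≤-trans (<⇒≤ (<ᵇ-true q)) B-large
    eval-ev rep sm (var r) q = regs rep r , B≤B^1 (smallR sm r)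
    eval-ev {σ} {H} rep sm (arr j e) q with eval-ev rep sm e (∧-left q)
    ... | p , b = trans (cong (memory σ) (address j (ev H e) rep sm (deg e) b
                                            (s≤s⁻¹ (<ᵇ-true {deg e} (∧-left (∧-right {wfE e} q)))) j<16 ⌊ e ⌋ᵉ p))
                        (arrs rep j (ev H e) j<16)
                , B≤B^1 (smallA sm j (ev H e))
      where j<16 = <ᵇ-true {j} (∧-right {deg e <ᵇ 4} (∧-right {wfE e} q))
    eval-ev {σ} {H} rep sm (adj d e) q
      with eval-ev rep sm d (∧-left q) | eval-ev rep sm e (∧-left (∧-right {wfE d} q))
    ... | p , b | p′ , b′ = trans (cong (memory σ) whole) (inp rep (ev H d) (ev H e)) , bool-bound (E (ev H d) (ev H e)) 1
      where
      dg : suc (suc (deg d) ⊔ deg e) ≤ 6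
      dg = s≤s⁻¹ (<ᵇ-true {suc (suc (deg d) ⊔ deg e)} (∧-right {wfE e} (∧-right {wfE d} q)))
      dn : ev H d * n ≤ B ^ (deg d + 1)
      dn = mul-bound (deg d) 1 b (B≤B^1 (subst (_≤ B) (reg3 rep) (smallR sm 3)))
      W = modWord w
      dg′ : suc ((deg d + 1) ⊔ deg e) ≤ 6
      dg′ = subst (λ x → suc (x ⊔ deg e) ≤ 6) (+-comm 1 (deg d)) dg
      row : W (eval σ ⌊ d ⌋ᵉ * registers σ 3) ≡ ev H d * n
      row = trans (cong W (cong₂ _*_ p (trans (regs rep 3) (reg3 rep))))
                  (wrap-id (deg d + 1) dn (≤-trans (m≤m⊔n (deg d + 1) (deg e)) (≤-trans (n≤1+n _) dg′)))
      cell : W (W (eval σ ⌊ d ⌋ᵉ * registers σ 3) + eval σ ⌊ e ⌋ᵉ) ≡ ev H d * n + ev H e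
      cell = trans (cong W (cong₂ _+_ row p′)) (wrap-id _ (add-bound (deg d + 1) (deg e) dn b′) dg′)
      whole : eval σ (op mod (op add (op mul ⌊ d ⌋ᵉ (reg 3)) ⌊ e ⌋ᵉ) (reg 4)) ≡ (ev H d * n + ev H e) % (n * n)
      whole = trans (cong W (trans (cong₂ ⟦ mod ⟧ cell (trans (regs rep 4) (reg4 rep))) (mod-% (ev H d * n + ev H e) (n * n))))
                    (wrap-id _ (≤-trans (m%n≤m (ev H d * n + ev H e) (n * n)) (add-bound (deg d + 1) (deg e) dn b′)) dg′)
    eval-ev {σ} {H} rep sm (bin o d e) q
      with eval-ev rep sm d (∧-left q) | eval-ev rep sm e (∧-left (∧-right {wfE d} q))
    ... | p , b | p′ , b′ rewrite p | p′ =
      wrap-id (deg (bin o d e)) bb (s≤s⁻¹ (<ᵇ-true {deg (bin o d e)} (∧-right {wfE e} (∧-right {wfE d} q)))) , bb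
      where bb = bin-bound o d e b b′
    eval-ev {σ} {H} rep sm (ite c d e) q
      with eval-ev rep sm c (∧-left q) | eval-ev rep sm d (∧-left (∧-right {wfE c} q))
         | eval-ev rep sm e (∧-left (∧-right {wfE d} (∧-right {wfE c} q)))
    ... | p , _ | p′ , b′ | p″ , b″ =
      trans (cong W (cong₂ _+_ thenPart elsePart))
            (trans (cong W (ite-arith (ev H c) (ev H d) (ev H e))) (wrap-id (suc (deg d ⊔ deg e)) bb dg)) , bb
      where
      dg : suc (deg d ⊔ deg e) ≤ 6
      dg = s≤s⁻¹ (<ᵇ-true {suc (deg d ⊔ deg e)} (∧-right {wfE e} (∧-right {wfE d} (∧-right {wfE c} q))))
      dg′ : deg d ⊔ deg e ≤ 6
      dg′ = ≤-trans (n≤1+n _) dg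
      scaled : ∀ b {x z} → x ≤ z → (if b then 1 else 0) * x ≤ z
      scaled true  {x} p = ≤-trans (≤-reflexive (+-identityʳ x)) p
      scaled false p = z≤n
      W = modWord w
      thenPart : W (W (if W 0 <ᵇ eval σ ⌊ c ⌋ᵉ then 1 else 0) * eval σ ⌊ d ⌋ᵉ) ≡ (if 0 <ᵇ ev H c then 1 else 0) * ev H d
      thenPart = trans (cong W (cong₂ _*_ (trans (cong₂ (λ a b → W (if a <ᵇ b then 1 else 0)) (lit-ok {0} z≤n) p) (bool-ok (0 <ᵇ ev H c))) p′))
                       (wrap-id (deg d) (scaled (0 <ᵇ ev H c) b′) (≤-trans (m≤m⊔n (deg d) (deg e)) dg′))
      elsePart : W (W (if eval σ ⌊ c ⌋ᵉ ≡ᵇ W 0 then 1 else 0) * eval σ ⌊ e ⌋ᵉ) ≡ (if ev H c ≡ᵇ 0 then 1 else 0) * ev H e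
      elsePart = trans (cong W (cong₂ _*_ (trans (cong₂ (λ a b → W (if a ≡ᵇ b then 1 else 0)) p (lit-ok {0} z≤n)) (bool-ok (ev H c ≡ᵇ 0))) p″))
                       (wrap-id (deg e) (scaled (ev H c ≡ᵇ 0) b″) (≤-trans (m≤n⊔m (deg d) (deg e)) dg′))
      bb : (if ev H c ≡ᵇ 0 then ev H e else ev H d) ≤ B ^ suc (deg d ⊔ deg e)
      bb = if-bound (ev H c ≡ᵇ 0) (≤-trans b″ (B^-mono (≤-trans (m≤n⊔m (deg d) (deg e)) (n≤1+n _))))
                                  (≤-trans b′ (B^-mono (≤-trans (m≤m⊔n (deg d) (deg e)) (n≤1+n _))))

    tame-small : ∀ {H} → Small H → ∀ e → wfE e ≡ true → tame e ≡ true → ev H e ≤ B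
    tame-small sm (num v) q t = ≤-trans (<⇒≤ (<ᵇ-true q)) B-large
    tame-small sm (var r) q t = smallR sm r
    tame-small sm (arr j e) q t = smallA sm j _
    tame-small {H} sm (adj d e) q t = ≤-trans (bool-bound (E (ev H d) (ev H e)) 0) 1≤B
    tame-small {H} sm (bin sub d e) q t = ≤-trans (m∸n≤m (ev H d) (ev H e)) (tame-small sm d (∧-left q) t)
    tame-small {H} sm (bin div d e) q t = ≤-trans (div-bound (ev H d) (ev H e)) (tame-small sm d (∧-left q) t)
    tame-small {H} sm (bin mod d e) q t = ≤-trans (mod-bound (ev H d) (ev H e)) (tame-small sm d (∧-left q) t)
    tame-small {H} sm (bin lt d e) q t = ≤-trans (bool-bound (ev H d <ᵇ ev H e) 0) 1≤B
    tame-small {H} sm (bin eq d e) q t = ≤-trans (bool-bound (ev H d ≡ᵇ ev H e) 0) 1≤B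
    tame-small {H} sm (ite c d e) q t =
      if-bound (ev H c ≡ᵇ 0) (tame-small sm e (∧-left (∧-right {wfE d} (∧-right {wfE c} q))) (∧-right {tame d} t))
                             (tame-small sm d (∧-left (∧-right {wfE c} q)) (∧-left t))

    fits-small : ∀ {H} → Small H → ∀ e → wfE e ≡ true → Fits e H → ev H e ≤ B
    fits-small sm e q f with tame e in t
    ... | true  = tame-small sm e q t
    ... | false = f

    upd-small : ∀ {f : ℕ → ℕ} {v} i → (∀ r → f r ≤ B) → v ≤ B → ∀ r → (f [ i ↦ v ]) r ≤ B
    upd-small i p q r = if-bound (r ≡ᵇ i) q (p r)

    setR-small : ∀ {H r v} → Small H → v ≤ B → Small (setR H r v)
    setR-small {r = r} sm q = small (upd-small r (smallR sm) q) (smallA sm)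

    setA-small : ∀ {H j i v} → Small H → v ≤ B → Small (setA H j i v)
    setA-small {H} {j} {i} sm q = small (smallR sm) bound
      where
      bound : ∀ j′ i′ → ar (setA H j i _) j′ i′ ≤ B
      bound j′ i′ with j′ ≡ᵇ j
      ... | true  = upd-small i (smallA sm j) q i′
      ... | false = smallA sm j′ i′

    setR-rep : ∀ {σ H r v} → Rep σ H → safeR r ≡ true → Rep ⟨ registers σ [ r ↦ v ] , memory σ ⟩ (setR H r v)
    setR-rep {σ} {H} {r} {v} rep q = record
      { regs = λ s → cong (λ x → if s ≡ᵇ r then v else x) (regs rep s)
      ; arrs = arrs rep
      ; inp  = inp rep
      ; reg3 = trans (upd-other (rg H) v (<⇒≢ (<-trans (n<1+n 3) r>4))) (reg3 rep)
      ; reg4 = trans (upd-other (rg H) v (<⇒≢ r>4)) (reg4 rep) }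
      where r>4 = <ᵇ-true {4} {r} q

    -- The number of the array is the residue of the address offset modulo 16, so a store into one
    -- array disturbs no other.
    interleave-injective : ∀ {i j i′ j′} → j < 16 → j′ < 16 → i * 16 + j ≡ i′ * 16 + j′ → i ≡ i′ × j ≡ j′
    interleave-injective {i} {j} {i′} {j′} p q ≡q = *-cancelʳ-≡ i i′ 16 (+-cancelʳ-≡ j (i * 16) (i′ * 16) (trans ≡q (cong (i′ * 16 +_) (sym j≡j′)))) , j≡j′
      where
      residue : ∀ i {j} → j < 16 → (i * 16 + j) % 16 ≡ j
      residue i {j} p = trans (cong (_% 16) (+-comm (i * 16) j)) (trans ([m+kn]%n≡m%n j i 16) (m<n⇒m%n≡m p))
      j≡j′ : j ≡ j′
      j≡j′ = trans (sym (residue i p)) (trans (cong (_% 16) ≡q) (residue i′ q))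

    setA-rep : ∀ {σ H j i v} → Rep σ H → j < 16 →
               Rep ⟨ registers σ , memory σ [ n * n + (i * 16 + j) ↦ v ] ⟩ (setA H j i v)
    setA-rep {σ} {H} {j} {i} {v} rep q = record
      { regs = regs rep
      ; arrs = arrays
      ; inp  = λ a b → trans (upd-other (memory σ) v
                 (<⇒≢ (<-≤-trans (m%n<n (a * n + b) (n * n)) (m≤m+n (n * n) (i * 16 + j))))) (inp rep a b)
      ; reg3 = reg3 rep
      ; reg4 = reg4 rep }
      where
      arrays : ∀ j′ i′ → j′ < 16 →
               (memory σ [ n * n + (i * 16 + j) ↦ v ]) (n * n + (i′ * 16 + j′)) ≡ ar (setA H j i v) j′ i′
      arrays j′ i′ p with j′ ≟ j
      arrays j′ i′ p | no ne rewrite ≡ᵇ-false ne =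
        trans (upd-other (memory σ) v (λ ≡q → ne (proj₂ (interleave-injective {i′} {j′} {i} {j} p q (+-cancelˡ-≡ (n * n) _ _ ≡q)))))
              (arrs rep j′ i′ p)
      arrays j′ i′ p | yes refl rewrite ≡ᵇ-refl j with i′ ≟ i
      ... | yes refl = trans (upd-same (memory σ) _ v) (sym (upd-same (ar H j) i v))
      ... | no ne = trans (upd-other (memory σ) v (λ ≡q → ne (proj₁ (interleave-injective {i′} {j} {i} {j} p q (+-cancelˡ-≡ (n * n) _ _ ≡q)))))
                      (trans (arrs rep j i′ p) (sym (upd-other (ar H j) v ne)))

    lt-reg : ∀ {σ H} r q → Rep σ H → eval σ (op lt (reg r) (reg q)) ≡ (if rg H r <ᵇ rg H q then 1 else 0)
    lt-reg {σ} {H} r q rep rewrite regs rep r | regs rep q = bool-ok (rg H r <ᵇ rg H q)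

    Halts : Cmd → ℕ → State → (Store → Set) → Set
    Halts c b σ Q = ∃[ σ′ ] ∃[ t ] ∃[ H′ ] (Run c σ σ′ t × t ≤ b × Rep σ′ H′ × Small H′ × Q H′)

    not-true : ∀ {b} → not b ≡ true → b ≡ false
    not-true {false} _ = refl

    mutual
      -- The time bound depends on the program alone: the weakest precondition of each loop contains
      -- the bound on its limit register, and this bounds the number of rounds.
      WP-sound : ∀ p {Q σ H} → wf p ≡ true → Rep σ H → Small H → WP p Q H → Halts ⌊ p ⌋ (wc β p) σ Q
      WP-sound nop q rep sm w = _ , _ , _ , run-skip , ≤-refl , rep , sm , w
      WP-sound (asg r e) {Q} {σ} {H} q rep sm (f , w) =
        _ , _ , setR H r (ev H e) , subst (λ x → Run ⌊ asg r e ⌋ σ ⟨ registers σ [ r ↦ x ] , memory σ ⟩ (wc β (asg r e))) (proj₁ (eval-ev rep sm e qe)) run-set , ≤-refl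
          , setR-rep rep (∧-left q) , setR-small sm (fits-small sm e qe f) , w
        where qe = ∧-right {safeR r} q
      WP-sound (put j d e) {Q} {σ} {H} q rep sm (f , w) =
        _ , _ , setA H j (ev H d) (ev H e)
          , subst₂ (λ x y → Run ⌊ put j d e ⌋ σ ⟨ registers σ , memory σ [ x ↦ y ] ⟩ (wc β (put j d e)))
              (address j (ev H d) rep sm (deg d) (proj₂ (eval-ev rep sm d qd))
                 (s≤s⁻¹ (<ᵇ-true {deg d} (∧-left (∧-right {wfE d} (∧-right {j <ᵇ 16} q))))) j<16 ⌊ d ⌋ᵉ (proj₁ (eval-ev rep sm d qd)))
              (proj₁ (eval-ev rep sm e qe)) run-store
          , ≤-refl , setA-rep rep j<16 , setA-small sm (fits-small sm e qe f) , w
        where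
        j<16 = <ᵇ-true {j} (∧-left q)
        qd = ∧-left (∧-right {j <ᵇ 16} q)
        qe = ∧-right {deg d <ᵇ 4} (∧-right {wfE d} (∧-right {j <ᵇ 16} q))
      WP-sound (p ⨟ p′) q rep sm w
        with WP-sound p (∧-left q) rep sm w
      ... | _ , _ , _ , r , b , rep′ , sm′ , w′
        with WP-sound p′ (∧-right {wf p} q) rep′ sm′ w′
      ... | _ , _ , _ , r′ , b′ , rep″ , sm″ , w″ =
        _ , _ , _ , run-seq r r′ , +-mono-≤ b b′ , rep″ , sm″ , w″
      WP-sound (cnd e p p′) {H = H} q rep sm (w , w′) with eval-ev rep sm e (∧-left q) | ev H e ≟ 0
      ... | ee , _ | yes z with WP-sound p′ (∧-right {wf p} (∧-right {wfE e} q)) rep sm (w′ z)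
      ...   | _ , _ , _ , r , b , rest =
        _ , _ , _ , run-else (trans ee z) r , s≤s (+-monoʳ-≤ (costᵉ ⌊ e ⌋ᵉ) (≤-trans b (m≤n⊔m (wc β p) (wc β p′)))) , rest
      WP-sound (cnd e p p′) {H = H} q rep sm (w , w′) | ee , _ | no nz
        with WP-sound p (∧-left (∧-right {wfE e} q)) rep sm (w nz)
      ...   | _ , _ , _ , r , b , rest =
        _ , _ , _ , run-then (λ x → nz (trans (sym ee) x)) r , s≤s (+-monoʳ-≤ (costᵉ ⌊ e ⌋ᵉ) (≤-trans b (m≤m⊔n (wc β p) (wc β p′)))) , rest
      WP-sound (for x r q p) {Q} {σ} {H} ok rep sm (bound , w)
        with loop-sound p r q (rg H q) 0 {x = x} ok (setR-rep rep (∧-left ok)) (setR-small sm z≤n)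
               (upd-same (rg H) r 0) (trans (upd-other (rg H) 0 q≢r) (sym (+-identityʳ (rg H q)))) w
        where
        q≢r : q ≢ r
        q≢r refl with trans (sym (not-true (∧-right {not (r ∈ᵇ writesR p)} (∧-right {not (r ∈ᵇ writesR p)} (∧-right {wf p} (∧-right {safeR r} ok)))))) (≡ᵇ-refl r)
        ... | ()
      ... | _ , _ , _ , run , b , rest =
        _ , _ , _ , run-seq (subst (λ v → Run (set r (lit 0)) σ ⟨ registers σ [ r ↦ v ] , memory σ ⟩ 2) (lit-ok {0} z≤n) run-set) run
          , +-monoʳ-≤ 2 (≤-trans b (+-monoʳ-≤ 4 (*-monoˡ-≤ (8 + wc β p) bound))) , rest

      loop-sound : ∀ p r q m i {Q σ H x} → wf (for x r q p) ≡ true → Rep σ H → Small H →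
                   rg H r ≡ i → rg H q ≡ m + i → for-from (WP p) r Q m i H →
                   Halts (while (op lt (reg r) (reg q)) (⌊ p ⌋ ⨾ set r (op add (reg r) (lit 1)))) (4 + m * (8 + wc β p)) σ Q
      loop-sound p r q zero i {H = H} ok rep sm ri qi w =
        _ , _ , H , while-stop (trans (lt-reg r q rep) (subst₂ (λ a b → (if a <ᵇ b then 1 else 0) ≡ 0) (sym ri) (sym qi) (cong b2n (<ᵇ-elimF {i} {i} ≤-refl))))
          , ≤-refl , rep , sm , w
      loop-sound p r q (suc m) i {Q} {σ} {H} {x} ok rep sm ri qi inv
        with WP-sound p (∧-left (∧-right {safeR r} ok)) rep sm (WP-frame p inv)
      ... | σ₁ , t₁ , H₁ , run₁ , b₁ , rep₁ , sm₁ , w₁ , fr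
        with loop-sound p r q m (suc i) {x = x} ok (setR-rep {v = suc i} rep₁ (∧-left ok)) (setR-small sm₁ i<B)
               (upd-same (rg H₁) r (suc i)) (trans (upd-other (rg H₁) (suc i) q≢r) (trans kq (trans qi (sym (+-suc m i))))) w₁
        where
        rest = ∧-right {wf p} (∧-right {safeR r} ok)
        kq : rg H₁ q ≡ rg H q
        kq = keepR fr q (not-true (∧-left (∧-right {not (r ∈ᵇ writesR p)} rest)))
        q≢r : q ≢ r
        q≢r refl with trans (sym (not-true (∧-right {not (r ∈ᵇ writesR p)} (∧-right {not (r ∈ᵇ writesR p)} rest)))) (≡ᵇ-refl r)
        ... | ()
        -- The counter never exceeds the limit register, which is small.
        i<B : suc i ≤ B
        i<B = ≤-trans (s≤s (m≤n+m i m)) (subst (_≤ B) qi (smallR sm q))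
      ... | σ₂ , t₂ , H₂ , run₂ , b₂ , res =
        _ , _ , _
          , while-step test (run-seq run₁ (subst (λ v → Run (set r (op add (reg r) (lit 1))) σ₁ ⟨ registers σ₁ [ r ↦ v ] , memory σ₁ ⟩ 4) incr run-set)) run₂
          , ≤-trans (s≤s (+-monoʳ-≤ 3 (+-mono-≤ (+-monoˡ-≤ 4 b₁) b₂))) (≤-reflexive arith)
          , res
        where
        rest = ∧-right {wf p} (∧-right {safeR r} ok)
        kr : rg H₁ r ≡ i
        kr = trans (keepR fr r (not-true (∧-left rest))) ri
        incr : eval σ₁ (op add (reg r) (lit 1)) ≡ suc i
        incr rewrite lit-ok {1} 1≤B | regs rep₁ r | kr =
          trans (cong (modWord w) (+-comm i 1)) (wrap-id 1 (B≤B^1 (≤-trans (s≤s (m≤n+m i m)) (subst (_≤ B) qi (smallR sm q)))) (s≤s z≤n))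
        test : eval σ (op lt (reg r) (reg q)) ≢ 0
        test ≡q with trans (sym ≡q) (trans (lt-reg r q rep) (subst₂ (λ a b → (if a <ᵇ b then 1 else 0) ≡ 1) (sym ri) (sym qi) (cong b2n (<ᵇ-intro {i} {suc m + i} (s≤s (m≤n+m i m))))))
        ... | ()
        open ≡-Reasoning
        arith : 4 + (wc β p + 4 + (4 + m * (8 + wc β p))) ≡ 4 + (8 + wc β p + m * (8 + wc β p))
        arith = cong (4 +_) (begin
          wc β p + 4 + (4 + m * (8 + wc β p)) ≡⟨ +-assoc (wc β p) 4 _ ⟩
          wc β p + (8 + m * (8 + wc β p))     ≡⟨ sym (+-assoc (wc β p) 8 _) ⟩
          wc β p + 8 + m * (8 + wc β p)       ≡⟨ cong (_+ m * (8 + wc β p)) (+-comm (wc β p) 8) ⟩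
          8 + wc β p + m * (8 + wc β p)       ∎)

-- Sums and sets of vertices

sum : ℕ → (ℕ → ℕ) → ℕ
sum zero    f = 0
sum (suc i) f = sum i f + f i

sum-mono : ∀ n {f g} → (∀ i → i < n → f i ≤ g i) → sum n f ≤ sum n g
sum-mono zero    p = z≤n
sum-mono (suc n) p = +-mono-≤ (sum-mono n (λ i q → p i (m<n⇒m<1+n q))) (p n ≤-refl)

sum-cong : ∀ n {f g} → (∀ i → i < n → f i ≡ g i) → sum n f ≡ sum n g
sum-cong zero    p = refl
sum-cong (suc n) p = cong₂ _+_ (sum-cong n (λ i q → p i (m<n⇒m<1+n q))) (p n ≤-refl)

+-interchange : ∀ a b c d → a + b + (c + d) ≡ a + c + (b + d)
+-interchange a b c d = begin
  a + b + (c + d)   ≡⟨ +-assoc a b (c + d) ⟩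
  a + (b + (c + d)) ≡⟨ cong (a +_) (sym (+-assoc b c d)) ⟩
  a + (b + c + d)   ≡⟨ cong (λ x → a + (x + d)) (+-comm b c) ⟩
  a + (c + b + d)   ≡⟨ cong (a +_) (+-assoc c b d) ⟩
  a + (c + (b + d)) ≡⟨ sym (+-assoc a c (b + d)) ⟩
  a + c + (b + d)   ∎
  where open ≡-Reasoning

sum-+ : ∀ n f g → sum n (λ i → f i + g i) ≡ sum n f + sum n g
sum-+ zero    f g = refl
sum-+ (suc n) f g = trans (cong (_+ (f n + g n)) (sum-+ n f g)) (+-interchange (sum n f) (sum n g) (f n) (g n))

sum-zero : ∀ n → sum n (λ _ → 0) ≡ 0
sum-zero zero    = refl
sum-zero (suc n) = trans (+-identityʳ _) (sum-zero n)

sum-one : ∀ n → sum n (λ _ → 1) ≡ n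
sum-one zero    = refl
sum-one (suc n) = trans (+-comm _ 1) (cong suc (sum-one n))

sum-* : ∀ n c f → sum n (λ i → c * f i) ≡ c * sum n f
sum-* zero    c f = sym (*-zeroʳ c)
sum-* (suc n) c f = trans (cong (_+ c * f n) (sum-* n c f)) (sym (*-distribˡ-+ c (sum n f) (f n)))

sum-swap : ∀ m n (f : ℕ → ℕ → ℕ) → sum m (λ i → sum n (f i)) ≡ sum n (λ j → sum m (λ i → f i j))
sum-swap zero    n f = sym (sum-zero n)
sum-swap (suc m) n f = trans (cong (_+ sum n (f m)) (sum-swap m n f)) (sym (sum-+ n _ (f m)))

term≤sum : ∀ {n v} f → v < n → f v ≤ sum n f
term≤sum {suc n} {v} f p with m<1+n⇒m<n∨m≡n p
... | inj₁ q    = ≤-trans (term≤sum f q) (m≤m+n (sum n f) (f n))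
... | inj₂ refl = m≤n+m (f v) (sum n f)

sum-pos : ∀ n f → 1 ≤ sum n f → ∃[ v ] (v < n × 1 ≤ f v)
sum-pos (suc n) f p with f n in q
... | suc _ = n , ≤-refl , subst (1 ≤_) (sym q) (s≤s z≤n)
... | zero with sum-pos n f (subst (1 ≤_) (+-identityʳ _) p)
...   | v , a , b = v , m<n⇒m<1+n a , b

sum-mono-< : ∀ n {f g} → (∀ i → i < n → f i ≤ g i) → ∀ {v} → v < n → f v < g v → sum n f < sum n g
sum-mono-< (suc n) {f} {g} p {v} v<n q with m<1+n⇒m<n∨m≡n v<n
... | inj₁ r    = +-mono-<-≤ (sum-mono-< n (λ i z → p i (m<n⇒m<1+n z)) r q) (p n ≤-refl)
... | inj₂ refl = +-mono-≤-< (sum-mono n (λ i z → p i (m<n⇒m<1+n z))) q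

sum-δ : ∀ {n v} → v < n → sum n (λ i → b2n (i ≡ᵇ v)) ≡ 1
sum-δ {n} {v} p = ≤-antisym (upper n) (subst (_≤ sum n (λ i → b2n (i ≡ᵇ v))) (cong b2n (≡ᵇ-refl v)) (term≤sum (λ i → b2n (i ≡ᵇ v)) p))
  where
  below : ∀ n → n ≤ v → sum n (λ i → b2n (i ≡ᵇ v)) ≡ 0
  below zero    _ = refl
  below (suc n) q = cong₂ _+_ (below n (<⇒≤ q)) (cong b2n (≡ᵇ-false (<⇒≢ q)))
  upper : ∀ n → sum n (λ i → b2n (i ≡ᵇ v)) ≤ 1
  upper zero = z≤n
  upper (suc n) with n ≟ v
  ... | yes refl rewrite below n ≤-refl | ≡ᵇ-refl n = ≤-refl
  ... | no ne    rewrite ≡ᵇ-false ne = subst (_≤ 1) (sym (+-identityʳ _)) (upper n)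

b2n≤1 : ∀ b → b2n b ≤ 1
b2n≤1 true  = ≤-refl
b2n≤1 false = z≤n

b2n-mono : ∀ {x y} → (x ≡ true → y ≡ true) → b2n x ≤ b2n y
b2n-mono {true}  f rewrite f refl = ≤-refl
b2n-mono {false} f = z≤n

b2n-< : ∀ {x y} → x ≡ false → y ≡ true → b2n x < b2n y
b2n-< refl refl = ≤-refl

b2n-pos : ∀ {x} → 1 ≤ b2n x → x ≡ true
b2n-pos {true} _ = refl

true≢false : ∀ {x} → x ≡ true → x ≡ false → ⊥
true≢false refl ()

≢true : ∀ {x} → ¬ (x ≡ true) → x ≡ false
≢true {true}  f = ⊥-elim (f refl)
≢true {false} f = refl

∧-intro : ∀ {x y} → x ≡ true → y ≡ true → x ∧ y ≡ true
∧-intro refl refl = refl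

not-intro : ∀ {x} → x ≡ false → not x ≡ true
not-intro refl = refl

not-elim : ∀ {x} → not x ≡ true → x ≡ false
not-elim {false} _ = refl

true-or-false : ∀ x → x ≡ true ⊎ x ≡ false
true-or-false true  = inj₁ refl
true-or-false false = inj₂ refl

∨-cases : ∀ {x y} → x ∨ y ≡ true → x ≡ true ⊎ y ≡ true
∨-cases {true}  _ = inj₁ refl
∨-cases {false} q = inj₂ q

any : ℕ → (ℕ → Bool) → Bool
any zero    P = false
any (suc n) P = any n P ∨ P n

any-intro : ∀ {n v} P → v < n → P v ≡ true → any n P ≡ true
any-intro {suc n} {v} P p q with m<1+n⇒m<n∨m≡n p
... | inj₁ r rewrite any-intro P r q = refl
... | inj₂ refl with any n P
...   | true  = refl
...   | false = q

any-elim : ∀ n P → any n P ≡ true → ∃[ v ] (v < n × P v ≡ true)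
any-elim (suc n) P q with any n P in z
... | true with any-elim n P z
...   | v , a , b = v , m<n⇒m<1+n a , b
any-elim (suc n) P q | false = n , ≤-refl , q

VSet : Set
VSet = ℕ → Bool

infix 4 _⊆[_]_

_⊆[_]_ : VSet → ℕ → VSet → Set
A ⊆[ n ] C = ∀ v → v < n → A v ≡ true → C v ≡ true

infixr 6 _∩_
infixr 5 _∪_

_∩_ _∪_ : VSet → VSet → VSet
(A ∩ C) v = A v ∧ C v
(A ∪ C) v = A v ∨ C v

-- Only the number of chosen members matters. The same choice removes the surplus of a cut over ℓ
-- and pads a solution to exactly k vertices.
first : ℕ → VSet → VSet
first m C v = C v ∧ (sum v (b2n ∘ C) <ᵇ m)

first-size : ∀ n m C → sum n (b2n ∘ first m C) ≡ sum n (b2n ∘ C) ⊓ m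
first-size zero    m C = refl
first-size (suc n) m C with C n
... | false rewrite +-identityʳ (sum n (b2n ∘ C)) = trans (+-identityʳ _) (first-size n m C)
... | true with sum n (b2n ∘ C) <ᵇ m in q
...   | true  = begin
  sum n (b2n ∘ first m C) + 1 ≡⟨ cong (_+ 1) (trans (first-size n m C) (m≤n⇒m⊓n≡m (<⇒≤ (<ᵇ-true q)))) ⟩
  sum n (b2n ∘ C) + 1         ≡⟨ sym (m≤n⇒m⊓n≡m (subst (_≤ m) (+-comm 1 _) (<ᵇ-true q))) ⟩
  (sum n (b2n ∘ C) + 1) ⊓ m   ∎
  where open ≡-Reasoning
...   | false = begin
  sum n (b2n ∘ first m C) + 0 ≡⟨ +-identityʳ _ ⟩
  sum n (b2n ∘ first m C)     ≡⟨ first-size n m C ⟩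
  sum n (b2n ∘ C) ⊓ m         ≡⟨ m≥n⇒m⊓n≡n (<ᵇ-false {sum n (b2n ∘ C)} q) ⟩
  m                           ≡⟨ sym (m≥n⇒m⊓n≡n (≤-trans (<ᵇ-false {sum n (b2n ∘ C)} q) (m≤m+n _ 1))) ⟩
  (sum n (b2n ∘ C) + 1) ⊓ m   ∎
  where open ≡-Reasoning

-- Boundaries, potentials and cuts

module Graph (n : ℕ) (E : ℕ → ℕ → Bool) (ℓ : ℕ) where

  # : VSet → ℕ
  # A = sum n (b2n ∘ A)

  #-mono : ∀ {A C} → A ⊆[ n ] C → # A ≤ # C
  #-mono p = sum-mono n (λ v q → b2n-mono (p v q))

  #-zero : ∀ A → (∀ v → v < n → A v ≡ false) → # A ≡ 0
  #-zero A p = trans (sum-cong n (λ v q → cong b2n (p v q))) (sum-zero n)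

  #-zero⁻¹ : ∀ A → # A ≡ 0 → ∀ v → v < n → A v ≡ false
  #-zero⁻¹ A p v q = ≢true (λ z → <⇒≱ (subst (λ x → 1 ≤ b2n x) (sym z) ≤-refl) (subst (b2n (A v) ≤_) p (term≤sum (b2n ∘ A) q)))

  #-pos : ∀ A → 1 ≤ # A → ∃[ v ] (v < n × A v ≡ true)
  #-pos A p with sum-pos n (b2n ∘ A) p
  ... | v , q , r = v , q , b2n-pos r

  #-member : ∀ A {v} → v < n → A v ≡ true → 1 ≤ # A
  #-member A {v} q r = subst (λ b → b2n b ≤ # A) r (term≤sum (b2n ∘ A) q)

  #≤n : ∀ A → # A ≤ n
  #≤n A = subst (# A ≤_) (sum-one n) (sum-mono n (λ v _ → b2n≤1 (A v)))

  -- The in-neighbours of A in the subdigraph induced by R.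
  boundary : VSet → VSet → VSet
  boundary R A v = R v ∧ (not (A v) ∧ any n (λ w → A w ∧ E v w))

  boundary-intro : ∀ R A {v w} → R v ≡ true → A v ≡ false → w < n → A w ≡ true → E v w ≡ true → boundary R A v ≡ true
  boundary-intro R A {v} {w} r a p q e rewrite r | a = any-intro _ p (∧-intro q e)

  boundary-R : ∀ R A {v} → boundary R A v ≡ true → R v ≡ true
  boundary-R R A = ∧-left

  boundary-∉ : ∀ R A {v} → boundary R A v ≡ true → A v ≡ false
  boundary-∉ R A {v} p = not-elim (∧-left (∧-right {R v} p))

  boundary-arc : ∀ R A {v} → boundary R A v ≡ true → ∃[ w ] (w < n × A w ≡ true × E v w ≡ true)
  boundary-arc R A {v} p with any-elim n _ (∧-right {not (A v)} (∧-right {R v} p))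
  ... | w , a , b = w , a , ∧-left b , ∧-right {A w} b

  rest : VSet → VSet → VSet
  rest R A v = R v ∧ (not (A v) ∧ not (boundary R A v))

  rest-intro : ∀ R A {v} → R v ≡ true → A v ≡ false → boundary R A v ≡ false → rest R A v ≡ true
  rest-intro R A {v} p q r = ∧-intro p (∧-intro (not-intro q) (not-intro r))

  rest-R : ∀ R A {v} → rest R A v ≡ true → R v ≡ true
  rest-R R A = ∧-left

  rest-∉ : ∀ R A {v} → rest R A v ≡ true → A v ≡ false
  rest-∉ R A {v} p = not-elim (∧-left (∧-right {R v} p))

  rest-∉∂ : ∀ R A {v} → rest R A v ≡ true → boundary R A v ≡ false
  rest-∉∂ R A {v} p = not-elim (∧-right {not (A v)} (∧-right {R v} p))

  rest-no-arc : ∀ R A {v w} → rest R A v ≡ true → w < n → A w ≡ true → E v w ≡ false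
  rest-no-arc R A {v} {w} p q r =
    ≢true (λ e → true≢false (boundary-intro R A (rest-R R A p) (rest-∉ R A p) q r e) (rest-∉∂ R A p))

  -- The inequality holds at each vertex. A vertex in both sets on the left is outside of A ∪ C and
  -- has an arc into A ∩ C, so it lies in both boundaries on the right. A vertex in one of them lies
  -- in the boundary of A or in that of C.
  ∂-submodular : ∀ R A C → # (boundary R (A ∪ C)) + # (boundary R (A ∩ C)) ≤ # (boundary R A) + # (boundary R C)
  ∂-submodular R A C = subst₂ _≤_ (sum-+ n _ _) (sum-+ n _ _) (sum-mono n pointwise)
    where
    ∂∪⊆ : ∀ {v} → boundary R (A ∪ C) v ≡ true → boundary R A v ≡ true ⊎ boundary R C v ≡ true
    ∂∪⊆ {v} u with boundary-arc R (A ∪ C) {v} u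
    ... | w , q , aw , e with ∨-cases {A w} aw
    ...   | inj₁ x = inj₁ (boundary-intro R A (boundary-R R (A ∪ C) {v} u) (∨-falseˡ (boundary-∉ R (A ∪ C) {v} u)) q x e)
    ...   | inj₂ x = inj₂ (boundary-intro R C (boundary-R R (A ∪ C) {v} u) (∨-falseʳ {A v} (boundary-∉ R (A ∪ C) {v} u)) q x e)
    ∂∩⊆ : ∀ {v} → boundary R (A ∩ C) v ≡ true → boundary R A v ≡ true ⊎ boundary R C v ≡ true
    ∂∩⊆ {v} i with boundary-arc R (A ∩ C) {v} i | true-or-false (A v) | true-or-false (C v)
    ... | w , q , aw , e | inj₂ a | _      = inj₁ (boundary-intro R A (boundary-R R (A ∩ C) {v} i) a q (∧-left aw) e)
    ... | w , q , aw , e | inj₁ _ | inj₂ c = inj₂ (boundary-intro R C (boundary-R R (A ∩ C) {v} i) c q (∧-right {A w} aw) e)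
    ... | w , q , aw , e | inj₁ a | inj₁ c = ⊥-elim (true≢false (∧-intro a c) (boundary-∉ R (A ∩ C) {v} i))
    one : ∀ {v} → boundary R A v ≡ true ⊎ boundary R C v ≡ true → 1 ≤ b2n (boundary R A v) + b2n (boundary R C v)
    one {v} (inj₁ x) = ≤-trans (≤-reflexive (sym (cong b2n x))) (m≤m+n _ _)
    one {v} (inj₂ x) = ≤-trans (≤-reflexive (sym (cong b2n x))) (m≤n+m _ (b2n (boundary R A v)))
    pointwise : ∀ v → v < n → b2n (boundary R (A ∪ C) v) + b2n (boundary R (A ∩ C) v) ≤ b2n (boundary R A v) + b2n (boundary R C v)
    pointwise v p with true-or-false (boundary R (A ∪ C) v) | true-or-false (boundary R (A ∩ C) v)
    ... | inj₂ u | inj₂ i = subst₂ (λ x y → b2n x + b2n y ≤ b2n (boundary R A v) + b2n (boundary R C v)) (sym u) (sym i) z≤n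
    ... | inj₂ u | inj₁ i = subst₂ (λ x y → b2n x + b2n y ≤ b2n (boundary R A v) + b2n (boundary R C v)) (sym u) (sym i) (one {v} (∂∩⊆ i))
    ... | inj₁ u | inj₂ i = subst₂ (λ x y → b2n x + b2n y ≤ b2n (boundary R A v) + b2n (boundary R C v)) (sym u) (sym i) (one {v} (∂∪⊆ u))
    ... | inj₁ u | inj₁ i with boundary-arc R (A ∩ C) {v} i
    ...   | w , q , aw , e =
      subst₂ (λ x y → b2n x + b2n y ≤ b2n (boundary R A v) + b2n (boundary R C v)) (sym u) (sym i) (≤-reflexive (sym (cong₂ (λ x y → b2n x + b2n y)
        (boundary-intro R A (boundary-R R (A ∪ C) {v} u) (∨-falseˡ (boundary-∉ R (A ∪ C) {v} u)) q (∧-left aw) e)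
        (boundary-intro R C (boundary-R R (A ∪ C) {v} u) (∨-falseʳ {A v} (boundary-∉ R (A ∪ C) {v} u)) q (∧-right {A w} aw) e))))

  -- Deleting X leaves an induced subdigraph of R whose strong components
  -- refine the levels of a potential that does not decrease along arcs.
  record Solvable (R : VSet) (κ : ℕ) : Set where
    field
      X     : VSet
      ρ     : ℕ → ℕ
      few   : # (R ∩ X) ≤ κ
      mono  : ∀ u v → u < n → v < n → R u ≡ true → X u ≡ false → R v ≡ true → X v ≡ false → E u v ≡ true → ρ u ≤ ρ v
      level : ∀ i → # (λ v → R v ∧ (not (X v) ∧ (ρ v ≡ᵇ i))) ≤ ℓ

  Solvable-mono : ∀ {R R′ κ κ′} → R′ ⊆[ n ] R → κ ≤ κ′ → Solvable R κ → Solvable R′ κ′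
  Solvable-mono {R} {R′} incl le s = record
    { X = X ; ρ = ρ
    ; few = ≤-trans (#-mono (λ v p q → ∧-intro (incl v p (∧-left q)) (∧-right {R′ v} q))) (≤-trans few le)
    ; mono = λ u v p q ru xu rv xv → mono u v p q (incl u p ru) xu (incl v q rv) xv
    ; level = λ i → ≤-trans (#-mono (λ v p q → ∧-intro (incl v p (∧-left q)) (∧-right {R′ v} q))) (level i) }
    where open Solvable s

  -- All but ℓ vertices of C are deleted, and all vertices outside of C ∪ Q.
  Solvable-cut : ∀ {R Q κ} (C : VSet) → C ⊆[ n ] R → Q ⊆[ n ] R → (∀ v → v < n → C v ≡ true → Q v ≡ false) →
                 (∀ u v → u < n → v < n → Q u ≡ true → C v ≡ true → E u v ≡ false) →
                 Solvable Q κ → Solvable R (κ + (# (λ v → R v ∧ (not (C v) ∧ not (Q v))) + (# C ∸ ℓ)))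
  Solvable-cut {R} {Q} {κ} C C⊆R Q⊆R disj noArc s = record
    { X = X′ ; ρ = ρ′ ; few = few′ ; mono = mono′ ; level = level′ }
    where
    open Solvable s
    D = first (# C ∸ ℓ) C
    X′ : VSet
    X′ v = if C v then D v else (if Q v then X v else true)
    -- C becomes a new lowest level. This is compatible with the arcs because none leads from Q to
    -- C.
    ρ′ : ℕ → ℕ
    ρ′ v = if C v then 0 else suc (ρ v)
    Y : VSet
    Y v = R v ∧ (not (C v) ∧ not (Q v))
    few′ : # (R ∩ X′) ≤ κ + (# Y + (# C ∸ ℓ))
    few′ = begin
      # (R ∩ X′)                          ≤⟨ sum-mono n pointwise ⟩
      sum n (λ v → b2n ((Q ∩ X) v) + (b2n (Y v) + b2n (D v))) ≡⟨ trans (sum-+ n _ _) (cong (# (Q ∩ X) +_) (sum-+ n _ _)) ⟩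
      # (Q ∩ X) + (# Y + # D)             ≤⟨ +-mono-≤ few (+-monoʳ-≤ (# Y) (subst (_≤ # C ∸ ℓ) (sym (first-size n (# C ∸ ℓ) C)) (m⊓n≤n (# C) (# C ∸ ℓ)))) ⟩
      κ + (# Y + (# C ∸ ℓ))               ∎
      where
      open ≤-Reasoning
      pointwise : ∀ v → v < n → b2n ((R ∩ X′) v) ≤ b2n ((Q ∩ X) v) + (b2n (Y v) + b2n (D v))
      pointwise v p with R v | C v | Q v
      ... | false | _     | _     = z≤n
      ... | true  | true  | true  = m≤n+m _ (b2n (X v))
      ... | true  | true  | false = ≤-refl
      ... | true  | false | true  = m≤m+n (b2n (X v)) 0
      ... | true  | false | false = s≤s z≤n
    mono′ : ∀ u v → u < n → v < n → R u ≡ true → X′ u ≡ false → R v ≡ true → X′ v ≡ false → E u v ≡ true → ρ′ u ≤ ρ′ v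
    mono′ u v p q ru xu rv xv e with C u in cu | C v in cv
    ... | true  | _ = z≤n
    ... | false | true with Q u in qu
    ...   | true  = ⊥-elim (true≢false e (noArc u v p q qu cv))
    ...   | false = ⊥-elim (true≢false refl xu)
    mono′ u v p q ru xu rv xv e | false | false with Q u in qu | Q v in qv
    ...   | true  | true  = s≤s (mono u v p q qu xu qv xv e)
    ...   | true  | false = ⊥-elim (true≢false refl xv)
    ...   | false | _     = ⊥-elim (true≢false refl xu)
    level′ : ∀ i → # (λ v → R v ∧ (not (X′ v) ∧ (ρ′ v ≡ᵇ i))) ≤ ℓ
    level′ zero = begin
      # (λ v → R v ∧ (not (X′ v) ∧ (ρ′ v ≡ᵇ 0)))     ≡⟨ sym (m+n∸n≡m _ (# D)) ⟩
      # (λ v → R v ∧ (not (X′ v) ∧ (ρ′ v ≡ᵇ 0))) + # D ∸ # D ≡⟨ cong (_∸ # D) (sym (sum-+ n _ _)) ⟩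
      sum n (λ v → b2n (R v ∧ (not (X′ v) ∧ (ρ′ v ≡ᵇ 0))) + b2n (D v)) ∸ # D ≤⟨ ∸-monoˡ-≤ (# D) (sum-mono n pointwise) ⟩
      # C ∸ # D                                       ≡⟨ cong (# C ∸_) (trans (first-size n (# C ∸ ℓ) C) (m≥n⇒m⊓n≡n (m∸n≤m (# C) ℓ))) ⟩
      # C ∸ (# C ∸ ℓ)                                 ≤⟨ m∸[m∸n]≤n (# C) ℓ ⟩
      ℓ                                               ∎
      where
      open ≤-Reasoning
      m∸[m∸n]≤n : ∀ m k → m ∸ (m ∸ k) ≤ k
      m∸[m∸n]≤n m k = subst (_≤ k) (sym (m∸n∸k m k)) (m⊓n≤n m k)
        where
        m∸n∸k : ∀ m k → m ∸ (m ∸ k) ≡ m ⊓ k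
        m∸n∸k m k with ≤-total m k
        ... | inj₁ p rewrite m≤n⇒m∸n≡0 p = sym (m≤n⇒m⊓n≡m p)
        ... | inj₂ p = trans (m∸[m∸n]≡n p) (sym (m≥n⇒m⊓n≡n p))
      pointwise : ∀ v → v < n → b2n (R v ∧ (not (X′ v) ∧ (ρ′ v ≡ᵇ 0))) + b2n (D v) ≤ b2n (C v)
      pointwise v p with R v | C v | Q v | X v
      ... | true  | true  | _ | _ with sum v (b2n ∘ C) <ᵇ # C ∸ ℓ
      ...   | true  = ≤-refl
      ...   | false = ≤-refl
      pointwise v p | false | true  | _ | _ = b2n≤1 _
      pointwise v p | false | false | _ | _ = z≤n
      pointwise v p | true  | false | true  | true  = z≤n
      pointwise v p | true  | false | true  | false = z≤n
      pointwise v p | true  | false | false | _ = z≤n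
    level′ (suc i) = ≤-trans (#-mono incl) (level i)
      where
      incl : ∀ v → v < n → R v ∧ (not (X′ v) ∧ (ρ′ v ≡ᵇ suc i)) ≡ true → Q v ∧ (not (X v) ∧ (ρ v ≡ᵇ i)) ≡ true
      incl v p z with R v | C v | Q v
      ... | true | false | true = z
      ... | true | true  | _ = ⊥-elim (true≢false (∧-right {not (sum v (b2n ∘ C) <ᵇ # C ∸ ℓ)} z) refl)

  module _ (loopless : ∀ v → v < n → E v v ≡ false) (1≤ℓ : 1 ≤ ℓ) where

    minimal : ∀ m (S : VSet) (ρ : ℕ → ℕ) → (∃[ v ] (v < m × S v ≡ true × (∀ u → u < m → S u ≡ true → ρ v ≤ ρ u))) ⊎ (∀ v → v < m → S v ≡ false)
    minimal zero    S ρ = inj₂ (λ v ())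
    minimal (suc m) S ρ with minimal m S ρ | S m in s
    ... | inj₂ none | false = inj₂ (λ v p → go v (m<1+n⇒m<n∨m≡n p))
      where go : ∀ v → v < m ⊎ v ≡ m → S v ≡ false
            go v (inj₁ q)    = none v q
            go v (inj₂ refl) = s
    ... | inj₂ none | true = inj₁ (m , ≤-refl , s , λ u p q → go u (m<1+n⇒m<n∨m≡n p) q)
      where go : ∀ u → u < m ⊎ u ≡ m → S u ≡ true → ρ m ≤ ρ u
            go u (inj₁ r)    q = ⊥-elim (true≢false q (none u r))
            go u (inj₂ refl) q = ≤-refl
    ... | inj₁ (v , p , sv , min) | false = inj₁ (v , m<n⇒m<1+n p , sv , λ u r q → go u (m<1+n⇒m<n∨m≡n r) q)
      where go : ∀ u → u < m ⊎ u ≡ m → S u ≡ true → ρ v ≤ ρ u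
            go u (inj₁ r)    q = min u r q
            go u (inj₂ refl) q = ⊥-elim (true≢false q s)
    ... | inj₁ (v , p , sv , min) | true with ≤-total (ρ v) (ρ m)
    ...   | inj₁ le = inj₁ (v , m<n⇒m<1+n p , sv , λ u r q → go u (m<1+n⇒m<n∨m≡n r) q)
      where go : ∀ u → u < m ⊎ u ≡ m → S u ≡ true → ρ v ≤ ρ u
            go u (inj₁ r)    q = min u r q
            go u (inj₂ refl) q = le
    ...   | inj₂ le = inj₁ (m , ≤-refl , s , λ u r q → go u (m<1+n⇒m<n∨m≡n r) q)
      where go : ∀ u → u < m ⊎ u ≡ m → S u ≡ true → ρ m ≤ ρ u
            go u (inj₁ r)    q = ≤-trans le (min u r q)
            go u (inj₂ refl) q = ≤-refl

    record FirstCut (R : VSet) (κ : ℕ) : Set where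
      field
        C       : VSet
        C⊆R     : C ⊆[ n ] R
        start   : ℕ
        start<n : start < n
        start∈C : C start ≡ true
        C≤ℓ     : # C ≤ ℓ
        ∂≤κ     : # (boundary R C) ≤ κ
        later   : Solvable (rest R C) (κ ∸ # (boundary R C))

    private
      -- C is the lowest level of the potential. A surviving in-neighbour of it has no larger
      -- potential and hence belongs to C as well, so the boundary of C consists of vertices of X.
      -- They are missing from the rest, which lowers the budget by their number.
      cut-at-level : ∀ {R κ} (s : Solvable R κ) → let open Solvable s in
                     ∀ v → v < n → R v ≡ true → X v ≡ false → (∀ u → u < n → (R u ∧ not (X u)) ≡ true → ρ v ≤ ρ u) → FirstCut R κ
      cut-at-level {R} {κ} s v v<n rv xv min = record
        { C = C ; C⊆R = λ u p q → ∧-left q ; start = v ; start<n = v<n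
        ; start∈C = ∧-intro rv (∧-intro (not-intro xv) (≡ᵇ-refl (ρ v)))
        ; C≤ℓ = level (ρ v) ; ∂≤κ = ≤-trans (#-mono ∂⊆) few
        ; later = record
          { X = X ; ρ = ρ
          ; few = ≤-trans (m+n≤o⇒m≤o∸n _ (≤-trans few-sum few)) ≤-refl
          ; mono = λ a b p q ra xa rb xb → mono a b p q (rest-R R C {a} ra) xa (rest-R R C {b} rb) xb
          ; level = λ i → ≤-trans (#-mono (λ u p q → ∧-intro (rest-R R C {u} (∧-left q)) (∧-right {rest R C u} q))) (level i) } }
        where
        open Solvable s
        C : VSet
        C u = R u ∧ (not (X u) ∧ (ρ u ≡ᵇ ρ v))
        ∂⊆ : boundary R C ⊆[ n ] (R ∩ X)
        ∂⊆ u p q with boundary-arc R C {u} q | true-or-false (X u)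
        ... | w , w<n , cw , e | inj₁ xu = ∧-intro (boundary-R R C {u} q) xu
        ... | w , w<n , cw , e | inj₂ xu = ⊥-elim (true≢false (∧-intro (boundary-R R C {u} q) (∧-intro (not-intro xu) (subst (λ x → (x ≡ᵇ ρ v) ≡ true) same (≡ᵇ-refl (ρ v))))) (boundary-∉ R C {u} q))
          where
          rw = ∧-left cw
          xw = not-elim (∧-left (∧-right {R w} cw))
          ρw : ρ w ≡ ρ v
          ρw = ≡ᵇ-true (∧-right {not (X w)} (∧-right {R w} cw))
          same : ρ v ≡ ρ u
          same = ≤-antisym (min u p (∧-intro (boundary-R R C {u} q) (not-intro xu)))
                           (subst (ρ u ≤_) ρw (mono u w p w<n (boundary-R R C {u} q) xu rw xw e))
        few-sum : # (rest R C ∩ X) + # (boundary R C) ≤ # (R ∩ X)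
        few-sum = subst (_≤ # (R ∩ X)) (sum-+ n _ _) (sum-mono n pointwise)
          where
          pointwise : ∀ u → u < n → b2n ((rest R C ∩ X) u) + b2n (boundary R C u) ≤ b2n ((R ∩ X) u)
          pointwise u p with true-or-false (boundary R C u)
          ... | inj₂ b = subst (λ x → b2n ((rest R C ∩ X) u) + b2n x ≤ b2n ((R ∩ X) u)) (sym b)
                (subst (_≤ b2n ((R ∩ X) u)) (sym (+-identityʳ _))
                  (b2n-mono (λ q → ∧-intro (rest-R R C {u} (∧-left q)) (∧-right {rest R C u} q))))
          ... | inj₁ b = subst₂ (λ x y → b2n x + b2n (boundary R C u) ≤ b2n y) (sym outside) (sym (∂⊆ u p b)) (b2n≤1 (boundary R C u))
            where outside : (rest R C ∩ X) u ≡ false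
                  outside = ≢true (λ q → true≢false b (rest-∉∂ R C {u} (∧-left q)))

    first-cut : ∀ {R κ} → Solvable R κ → 1 ≤ # R → FirstCut R κ
    first-cut {R} {κ} s ne with minimal n (λ v → R v ∧ not (Solvable.X s v)) (Solvable.ρ s)
    ... | inj₁ (v , p , q , min) = cut-at-level s v p (∧-left q) (not-elim (∧-right {R v} q)) min
    -- X contains all of R. Sparing one vertex gives a nonempty C at no cost; its level has size 1,
    -- which is at most ℓ.
    ... | inj₂ none with #-pos R ne
    ...   | v , v<n , rv = cut-at-level s′ v v<n rv (cong not (≡ᵇ-refl v) ) (λ u p q → ≤-refl)
      where
      open Solvable s
      alone : ∀ {u} → not (u ≡ᵇ v) ≡ false → u ≡ v
      alone {u} q with u ≡ᵇ v in z
      ... | true = ≡ᵇ-true z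
      R⊆X : R ⊆[ n ] (R ∩ X)
      R⊆X u p q with X u in x
      ... | true  = ∧-intro q refl
      ... | false = ⊥-elim (true≢false (∧-intro q (not-intro x)) (none u p))
      s′ : Solvable R κ
      s′ = record
        { X = λ u → not (u ≡ᵇ v) ; ρ = λ _ → 0
        ; few = ≤-trans (#-mono (λ u p q → R⊆X u p (∧-left q))) few
        ; mono = λ _ _ _ _ _ _ _ _ _ → z≤n
        ; level = λ i → ≤-trans (≤-trans (#-mono (λ u p q → subst (λ x → (x ≡ᵇ v) ≡ true)
                    (sym (alone {u} (not-elim (∧-left (∧-right {R u} q))))) (≡ᵇ-refl v))) (≤-reflexive (sum-δ v<n))) 1≤ℓ }

-- Search for a cut of given size

-- The successor of the last element of P below n, or 0.
find : ℕ → (ℕ → Bool) → ℕ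
find zero    P = 0
find (suc i) P = if P i then suc i else find i P

find-zero : ∀ n P → find n P ≡ 0 → ∀ v → v < n → P v ≡ false
find-zero (suc n) P z v p with P n in q
find-zero (suc n) P z v p | false with m<1+n⇒m<n∨m≡n p
... | inj₁ r    = find-zero n P z v r
... | inj₂ refl = q

find-suc : ∀ n P {v} → find n P ≡ suc v → v < n × P v ≡ true
find-suc (suc n) P z with P n in q
find-suc (suc n) P refl | true = ≤-refl , q
... | false with find-suc n P z
...   | a , b = m<n⇒m<1+n a , b

iterate : ∀ {A : Set} → (A → A) → ℕ → A → A
iterate f zero    x = x
iterate f (suc i) x = f (iterate f i x)

iterate-shift : ∀ {A : Set} (f : A → A) i x → iterate f i (f x) ≡ f (iterate f i x)
iterate-shift f zero    x = refl
iterate-shift f (suc i) x = cong f (iterate-shift f i x)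

iterate-fixed : ∀ {A : Set} (f : A → A) i {x} → f x ≡ x → iterate f i x ≡ x
iterate-fixed f zero    q = refl
iterate-fixed f (suc i) q = trans (cong f (iterate-fixed f i q)) q

-- The bits of h are consumed by the elements of U in increasing order.
remaining : VSet → ℕ → ℕ → ℕ
remaining U h zero    = h
remaining U h (suc v) = if U v then remaining U h v / 2 else remaining U h v

bit-%2 : ∀ b h → (b2n b + h * 2) % 2 ≡ b2n b
bit-%2 b h = trans ([m+kn]%n≡m%n (b2n b) h 2) (m<n⇒m%n≡m (s≤s (b2n≤1 b)))

bit-/2 : ∀ b h → (b2n b + h * 2) / 2 ≡ h
bit-/2 b h = trans (+-distrib-/-∣ʳ (b2n b) (divides h refl)) (cong₂ _+_ (m<n⇒m/n≡0 (s≤s (b2n≤1 b))) (m*n/n≡m h 2))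

bit-bound : ∀ b {h j} → h < 2 ^ j → b2n b + h * 2 < 2 ^ suc j
bit-bound b {h} {j} p = begin-strict
  b2n b + h * 2 <⟨ +-monoˡ-< (h * 2) (s≤s (b2n≤1 b)) ⟩
  suc h * 2     ≤⟨ *-monoˡ-≤ 2 p ⟩
  2 ^ j * 2     ≡⟨ *-comm (2 ^ j) 2 ⟩
  2 ^ suc j     ∎
  where open ≤-Reasoning

-- The continuation h′ makes the induction work: the bit of the last element of U is put in front of
-- h′, and the result is the continuation for the smaller vertices.
encode : ∀ n (U W : VSet) h′ j → h′ < 2 ^ j →
         ∃[ h ] (h < 2 ^ (sum n (b2n ∘ U) + j) × remaining U h n ≡ h′ × (∀ v → v < n → U v ≡ true → remaining U h v % 2 ≡ b2n (W v)))
encode zero    U W h′ j p = h′ , p , refl , λ _ ()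
encode (suc n) U W h′ j p with U n in u
... | false with encode n U W h′ j p
...   | h , a , b , c = h , subst (λ x → h < 2 ^ (x + j)) {x = sum n (b2n ∘ U)} (sym (+-identityʳ (sum n (b2n ∘ U)))) a
                          , b , λ v q r → go v (m<1+n⇒m<n∨m≡n q) r
  where
  go : ∀ v → v < n ⊎ v ≡ n → U v ≡ true → remaining U h v % 2 ≡ b2n (W v)
  go v (inj₁ q)    r = c v q r
  go v (inj₂ refl) r = ⊥-elim (true≢false r u)
encode (suc n) U W h′ j p | true with encode n U W (b2n (W n) + h′ * 2) (suc j) (bit-bound (W n) {h′} {j} p)
...   | h , a , b , c = h , subst (λ x → h < 2 ^ x) {x = sum n (b2n ∘ U) + suc j} (trans (+-suc (sum n (b2n ∘ U)) j) (cong (_+ j) (+-comm 1 (sum n (b2n ∘ U))))) a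
                          , trans (cong (_/ 2) b) (bit-/2 (W n) h′) , λ v q r → go v (m<1+n⇒m<n∨m≡n q) r
  where
  go : ∀ v → v < n ⊎ v ≡ n → U v ≡ true → remaining U h v % 2 ≡ b2n (W v)
  go v (inj₁ q)    r = c v q r
  go v (inj₂ refl) r = trans (cong (_% 2) b) (bit-%2 (W n) h′)

-- Degree cuts and their repair by binary choices

module Search (n : ℕ) (E : ℕ → ℕ → Bool) (ℓ : ℕ) where

  open Graph n E ℓ public

  -- The set counted by `codeg` contains v itself if v lies in R and has no loop. Its other members
  -- are in-neighbours of v when the digraph is semicomplete. Small in-degrees characterise the left
  -- side of a cut, large codegrees the right side.
  indeg codeg : VSet → ℕ → ℕ
  indeg R v = # (λ u → R u ∧ E u v)
  codeg R v = # (λ u → R u ∧ not (E v u))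

  -- Vertex states: 0 right of the cut, 1 to be moved to the left, 2 left of
  -- the cut, 3 absent, 4 deleted.
  Status : Set
  Status = ℕ → ℕ

  pressure : Status → ℕ → ℕ
  pressure st v = # (λ u → (st u <ᵇ 2) ∧ E u v)

  -- The vertices whose side of a cut with b deletions and c vertices on the
  -- left is not determined by their degrees.
  window : VSet → ℕ → ℕ → VSet
  window R c b v = R v ∧ ((c <ᵇ codeg R v) ∧ (indeg R v <ᵇ c + b))

  -- A codegree of at most c excludes a vertex from the right, an in-degree of at least c + b from
  -- the left. A vertex of the window that the bits send to the left gets state 1 first and still
  -- counts as right. The initial pressures are then those of the degree cut, which are tabulated,
  -- and each move updates them in O(n) steps.
  label : VSet → ℕ → ℕ → ℕ → Status
  label R c b h v =
    if R v then (if c <ᵇ codeg R v then b2n (window R c b v) * (remaining (window R c b) h v % 2) else 2) else 3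

  pending violated : Status → ℕ
  pending st  = find n (λ v → st v ≡ᵇ 1)
  violated st = find n (λ v → (st v ≡ᵇ 2) ∧ (0 <ᵇ pressure st v))

  culprit : Status → ℕ
  culprit st = find n (λ u → (st u <ᵇ 2) ∧ E u (violated st ∸ 1))

  -- As in `find`, a vertex is represented by its successor. Bits are read only when no vertex is
  -- pending: for a violating arc, bit 0 selects the tail and bit 1 the head.
  chosen : Status → ℕ → ℕ
  chosen st h = if pending st ≡ᵇ 0
                then (if violated st ≡ᵇ 0 then 0 else (if h % 2 ≡ᵇ 0 then culprit st else violated st))
                else pending st

  advice : Status → ℕ → ℕ
  advice st h = if pending st ≡ᵇ 0 then (if violated st ≡ᵇ 0 then h else h / 2) else h

  move : Status → ℕ → Status
  move st h = if chosen st h ≡ᵇ 0 then st else st [ chosen st h ∸ 1 ↦ (if pending st ≡ᵇ 0 then 4 else 2) ]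

  round : Status × ℕ → Status × ℕ
  round (st , h) = move st h , advice st h

  -- h decides the vertices of the window, h′ the violating arcs.
  cutF : VSet → ℕ → ℕ → ℕ → ℕ → Status
  cutF R c b h h′ = proj₁ (iterate round (6 * b) (label R c b h , h′))

  left right gone : Status → VSet
  left st v  = st v ≡ᵇ 2
  right st v = st v <ᵇ 2
  gone st v  = st v ≡ᵇ 4

  faults : Status → ℕ
  faults st = # (λ v → left st v ∧ (0 <ᵇ pressure st v))

  record WF (R : VSet) (st : Status) : Set where
    constructor wf-status
    field
      status : ∀ v → v < n → (R v ≡ true × (right st v ≡ true ⊎ left st v ≡ true ⊎ gone st v ≡ true)) ⊎ (R v ≡ false × st v ≡ 3)

  open WF public

  WF-label : ∀ R c b h → WF R (label R c b h)
  WF-label R c b h = wf-status go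
    where
    go : ∀ v → v < n → (R v ≡ true × (right (label R c b h) v ≡ true ⊎ left (label R c b h) v ≡ true ⊎ gone (label R c b h) v ≡ true)) ⊎ (R v ≡ false × label R c b h v ≡ 3)
    go v p with R v
    ... | false = inj₂ (refl , refl)
    ... | true with c <ᵇ codeg R v
    ...   | false = inj₁ (refl , inj₂ (inj₁ refl))
    ...   | true  = inj₁ (refl , inj₁ (<ᵇ-intro {b2n (indeg R v <ᵇ c + b) * x} (s≤s (*-mono-≤ (b2n≤1 (indeg R v <ᵇ c + b)) (s≤s⁻¹ (m%n<n (remaining (window R c b) h v) 2))))))
      where x = remaining (window R c b) h v % 2

  WF-upd : ∀ {R st t x} → WF R st → t < n → R t ≡ true → x ≡ 2 ⊎ x ≡ 4 → WF R (st [ t ↦ x ])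
  WF-upd {R} {st} {t} {x} w t<n rt e = wf-status go
    where
    go : ∀ v → v < n → (R v ≡ true × (right (st [ t ↦ x ]) v ≡ true ⊎ left (st [ t ↦ x ]) v ≡ true ⊎ gone (st [ t ↦ x ]) v ≡ true)) ⊎ (R v ≡ false × (st [ t ↦ x ]) v ≡ 3)
    go v p with v ≡ᵇ t in q
    ... | false = status w v p
    ... | true  = inj₁ (trans (cong R (≡ᵇ-true {v} q)) rt , kind e)
      where
      kind : ∀ {x} → x ≡ 2 ⊎ x ≡ 4 → (x <ᵇ 2) ≡ true ⊎ ((x ≡ᵇ 2) ≡ true ⊎ (x ≡ᵇ 4) ≡ true)
      kind (inj₁ refl) = inj₂ (inj₁ refl)
      kind (inj₂ refl) = inj₂ (inj₂ refl)

  present : ∀ {R st v} → WF R st → v < n → st v ≢ 3 → R v ≡ true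
  present {v = v} w p ne with status w v p
  ... | inj₁ (r , _) = r
  ... | inj₂ (_ , z) = ⊥-elim (ne z)

  <2⇒≢3 : ∀ {x} → (x <ᵇ 2) ≡ true → x ≢ 3
  <2⇒≢3 p refl = true≢false p refl

  WF-move : ∀ {R st} h → WF R st → WF R (move st h)
  WF-move {R} {st} h w with pending st in p
  ... | suc t with find-suc n _ p
  ...   | t<n , q = WF-upd w t<n (present w t<n (λ z → true≢false q (cong (_≡ᵇ 1) z))) (inj₁ refl)
  WF-move {R} {st} h w | zero with violated st in z
  ...   | zero = w
  ...   | suc q with h % 2 ≡ᵇ 0
  ...     | false with find-suc n _ z
  ...       | q<n , r = WF-upd w q<n (present w q<n (λ y → true≢false (∧-left r) (cong (_≡ᵇ 2) y))) (inj₂ refl)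
  WF-move {R} {st} h w | zero | suc q | true with culprit st in y
  ...       | zero  = subst (λ x → WF R (if x ≡ᵇ 0 then st else (st [ x ∸ 1 ↦ 4 ]))) (sym (trans (cong (λ i → find n (λ u → (st u <ᵇ 2) ∧ E u (i ∸ 1))) (sym z)) y)) w
  ...       | suc u = subst (λ x → WF R (if x ≡ᵇ 0 then st else (st [ x ∸ 1 ↦ 4 ]))) (sym (trans (cong (λ i → find n (λ u → (st u <ᵇ 2) ∧ E u (i ∸ 1))) (sym z)) y))
                        (WF-upd w (proj₁ fs) (present w (proj₁ fs) (<2⇒≢3 (∧-left (proj₂ fs)))) (inj₂ refl))
    where fs = find-suc n _ y

  WF-rounds : ∀ {R} i s → WF R (proj₁ s) → WF R (proj₁ (iterate round i s))
  WF-rounds zero    s w = w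
  WF-rounds (suc i) s w = WF-move (proj₂ (iterate round i s)) (WF-rounds i s w)

  WF-cutF : ∀ R c b h h′ → WF R (cutF R c b h h′)
  WF-cutF R c b h h′ = WF-rounds (6 * b) _ (WF-label R c b h)

  no-fault-no-arc : ∀ st → faults st ≡ 0 → ∀ u v → u < n → v < n → right st u ≡ true → left st v ≡ true → E u v ≡ false
  no-fault-no-arc st z u v p q ru lv = ≢true (λ e →
    true≢false (∧-intro lv (<ᵇ-intro (#-member (λ u → (st u <ᵇ 2) ∧ E u v) p (∧-intro ru e))))
               (#-zero⁻¹ (λ v → left st v ∧ (0 <ᵇ pressure st v)) z v q))

  left-¬right : ∀ st v → left st v ≡ true → right st v ≡ false
  left-¬right st v p rewrite ≡ᵇ-true {st v} p = refl

  left-R : ∀ {R st} → WF R st → left st ⊆[ n ] R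
  left-R {st = st} w v p q = present w p (λ z → true≢false q (cong (_≡ᵇ 2) z))

  right-R : ∀ {R st} → WF R st → right st ⊆[ n ] R
  right-R {st = st} w v p q = present w p (<2⇒≢3 q)

  -- The origin of the status is irrelevant: a status without faults has no arc from right to left.
  -- This is why wrong advice can do no harm.
  cut-sound : ∀ {R st κ} → WF R st → faults st ≡ 0 → Solvable (right st) κ →
              Solvable R (κ + (# (gone st) + (# (left st) ∸ ℓ)))
  cut-sound {R} {st} {κ} w z s =
    Solvable-mono (λ _ _ q → q) (+-monoʳ-≤ κ (+-monoˡ-≤ (# (left st) ∸ ℓ) (#-mono others)))
      (Solvable-cut (left st) (left-R w) (right-R w) (λ v _ → left-¬right st v) (no-fault-no-arc st z) s)
    where
    others : (λ v → R v ∧ (not (left st v) ∧ not (right st v))) ⊆[ n ] gone st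
    others v p q with status w v p
    ... | inj₂ (r , _) = ⊥-elim (true≢false (∧-left q) r)
    ... | inj₁ (_ , inj₁ x) = ⊥-elim (true≢false x (not-elim (∧-right {not (left st v)} (∧-right {R v} q))))
    ... | inj₁ (_ , inj₂ (inj₁ x)) = ⊥-elim (true≢false x (not-elim (∧-left (∧-right {R v} q))))
    ... | inj₁ (_ , inj₂ (inj₂ x)) = x

  ∂-left : ∀ {R st} → WF R st → faults st ≡ 0 → boundary R (left st) ⊆[ n ] gone st
  ∂-left {R} {st} w z v p q with boundary-arc R (left st) {v} q | status w v p
  ... | _ | inj₂ (r , _) = ⊥-elim (true≢false (boundary-R R (left st) {v} q) r)
  ... | _ | inj₁ (_ , inj₂ (inj₂ x)) = x
  ... | _ | inj₁ (_ , inj₂ (inj₁ x)) = ⊥-elim (true≢false x (boundary-∉ R (left st) {v} q))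
  ... | t , t<n , lt′ , e | inj₁ (_ , inj₁ x) = ⊥-elim (true≢false e (no-fault-no-arc st z v t p t<n x lt′))

  -- Size of the window in a semicomplete digraph

  module Semi (loopless : ∀ v → v < n → E v v ≡ false)
              (semi : ∀ u v → u < n → v < n → u ≢ v → E u v ≡ true ⊎ E v u ≡ true) where

    classify : ∀ R C v → R v ≡ false ⊎ (C v ≡ true ⊎ (boundary R C v ≡ true ⊎ rest R C v ≡ true))
    classify R C v with true-or-false (R v) | true-or-false (C v) | true-or-false (boundary R C v)
    ... | inj₂ r | _ | _ = inj₁ r
    ... | inj₁ r | inj₁ c | _ = inj₂ (inj₁ c)
    ... | inj₁ r | inj₂ c | inj₁ b = inj₂ (inj₂ (inj₁ b))
    ... | inj₁ r | inj₂ c | inj₂ b = inj₂ (inj₂ (inj₂ (rest-intro R C r c b)))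

    back-arc : ∀ {u v} → u < n → v < n → u ≢ v → E u v ≡ false → E v u ≡ true
    back-arc {u} {v} p q ne e with semi u v p q ne
    ... | inj₁ x = ⊥-elim (true≢false x e)
    ... | inj₂ x = x

    -- The pointwise form of |A| + |B| ≤ |C| + |D| for disjoint subsets A and B of C ∪ D.
    two-≤ : ∀ {a b c d} → (a ≡ true → c ≡ true ⊎ d ≡ true) → (b ≡ true → c ≡ true ⊎ d ≡ true) → (a ≡ true → b ≡ false) →
            b2n a + b2n b ≤ b2n c + b2n d
    two-≤ {false} {false} f g h = z≤n
    two-≤ {true}  {b} {c} {d} f g h rewrite h refl with f refl
    ... | inj₁ refl = s≤s z≤n
    ... | inj₂ refl = m≤n+m 1 (b2n c)
    two-≤ {false} {true} {c} {d} f g h with g refl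
    ... | inj₁ refl = s≤s z≤n
    ... | inj₂ refl = m≤n+m 1 (b2n c)

    pair-≤ : ∀ {a b c} → (a ≡ true → c ≡ true) → (b ≡ true → c ≡ true) → (a ≡ true → b ≡ false) → b2n a + b2n b ≤ b2n c
    pair-≤ {a} {b} {c} f g h = subst (b2n a + b2n b ≤_) (+-identityʳ (b2n c)) (two-≤ {a} {b} {c} {false} (inj₁ ∘ f) (inj₁ ∘ g) h)

    -- For a cut consisting of C, its boundary and the rest Q, a vertex of C
    -- has few in-neighbours, and a vertex of Q has many non-out-neighbours.
    indeg-C : ∀ R C → C ⊆[ n ] R → ∀ v → v < n → C v ≡ true → indeg R v + 1 ≤ # C + # (boundary R C)
    indeg-C R C C⊆R v p cv = subst₂ _≤_ (trans (sum-+ n _ _) (cong (indeg R v +_) (sum-δ p))) (sum-+ n _ _) (sum-mono n pointwise)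
      where
      pointwise : ∀ u → u < n → b2n (R u ∧ E u v) + b2n (u ≡ᵇ v) ≤ b2n (C u) + b2n (boundary R C u)
      pointwise u q = two-≤ {R u ∧ E u v} {u ≡ᵇ v} a b c
        where
        a : R u ∧ E u v ≡ true → C u ≡ true ⊎ boundary R C u ≡ true
        a z with true-or-false (C u)
        ... | inj₁ x = inj₁ x
        ... | inj₂ x = inj₂ (boundary-intro R C (∧-left z) x p cv (∧-right {R u} z))
        b : (u ≡ᵇ v) ≡ true → C u ≡ true ⊎ boundary R C u ≡ true
        b z = inj₁ (subst (λ x → C x ≡ true) (sym (≡ᵇ-true {u} z)) cv)
        c : R u ∧ E u v ≡ true → (u ≡ᵇ v) ≡ false
        c z = ≡ᵇ-false {u} {v} (λ { refl → true≢false (∧-right {R u} z) (loopless u q) })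

    indeg-lower : ∀ R C → C ⊆[ n ] R → ∀ v → v < n → C v ≡ false → (∀ u → u < n → C u ≡ true → E v u ≡ false) → # C ≤ indeg R v
    indeg-lower R C C⊆R v p cv no-arc = #-mono (λ u q z → ∧-intro (C⊆R u q z) (back-arc p q (λ { refl → true≢false z cv }) (no-arc u q z)))

    codeg-Q : ∀ R C → C ⊆[ n ] R → ∀ v → v < n → rest R C v ≡ true → # C + 1 ≤ codeg R v
    codeg-Q R C C⊆R v p qv = subst (_≤ codeg R v) (trans (sum-+ n _ _) (cong (# C +_) (sum-δ p))) (sum-mono n pointwise)
      where
      pointwise : ∀ u → u < n → b2n (C u) + b2n (u ≡ᵇ v) ≤ b2n (R u ∧ not (E v u))
      pointwise u q = pair-≤ {C u} {u ≡ᵇ v}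
        (λ z → ∧-intro (C⊆R u q z) (not-intro (rest-no-arc R C {v} qv q z)))
        (λ z → subst (λ x → R x ∧ not (E v x) ≡ true) (sym (≡ᵇ-true {u} z)) (∧-intro (rest-R R C {v} qv) (not-intro (loopless v p))))
        (λ z → ≡ᵇ-false {u} {v} (λ { refl → true≢false z (rest-∉ R C {u} qv) }))

    -- These sets contain the parts of the window in C and in the rest. Of the two degree
    -- conditions, each keeps the one that can fail there if the boundary has at most b vertices.
    W-C W-Q : VSet → ℕ → VSet → VSet
    W-C R b C v = C v ∧ (# C <ᵇ codeg R v)
    W-Q R b C v = rest R C v ∧ (indeg R v <ᵇ # C + b)

    -- Counting the arcs inside a set of maximum out-degree less than b.
    sparse-size : ∀ (F : ℕ → ℕ → Bool) → (∀ u v → u < n → v < n → u ≢ v → F u v ≡ true ⊎ F v u ≡ true) →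
                  ∀ W b → (∀ v → v < n → W v ≡ true → # (λ u → W u ∧ F v u) + 1 ≤ b) → 1 ≤ b → # W + 1 ≤ 2 * b
    sparse-size F sc W b out 1≤b with # W in e
    ... | zero  = ≤-trans 1≤b (m≤m+n b _)
    ... | suc s = *-cancelˡ-≤ (suc s) main
      where
      f : ℕ → ℕ → ℕ
      f v u = b2n (W v ∧ (W u ∧ F v u))
      Z = sum n (λ v → sum n (f v))
      S = suc s
      upper : Z + S ≤ S * b
      upper = subst₂ _≤_ (trans (sum-+ n _ _) (cong (Z +_) e)) (trans (sum-* n b (b2n ∘ W)) (trans (*-comm b _) (cong (_* b) e))) (sum-mono n pointwise)
        where
        pointwise : ∀ v → v < n → sum n (f v) + b2n (W v) ≤ b * b2n (W v)
        pointwise v p with W v in w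
        ... | true  = ≤-trans (out v p w) (≤-reflexive (sym (*-identityʳ b)))
        ... | false = ≤-trans (≤-reflexive (trans (+-identityʳ _) (sum-zero n))) z≤n
      product : sum n (λ v → sum n (λ u → b2n (W v) * b2n (W u))) ≡ S * S
      product = begin
        sum n (λ v → sum n (λ u → b2n (W v) * b2n (W u))) ≡⟨ sum-cong n (λ v _ → trans (sum-* n (b2n (W v)) (b2n ∘ W)) (cong (b2n (W v) *_) e)) ⟩
        sum n (λ v → b2n (W v) * S)                       ≡⟨ sum-cong n (λ v _ → *-comm (b2n (W v)) S) ⟩
        sum n (λ v → S * b2n (W v))                       ≡⟨ trans (sum-* n S (b2n ∘ W)) (cong (S *_) e) ⟩
        S * S                                             ∎
        where open ≡-Reasoning
      lower : S * S ≤ Z + Z + S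
      lower = subst₂ _≤_ product total (sum-mono n (λ v p → sum-mono n (λ u q → pointwise v u p q)))
        where
        pointwise : ∀ v u → v < n → u < n → b2n (W v) * b2n (W u) ≤ f v u + f u v + b2n (W v) * b2n (u ≡ᵇ v)
        pointwise v u p q with W v in wv | W u in wu
        ... | false | _     = z≤n
        ... | true  | false = z≤n
        ... | true  | true with u ≟ v
        ...   | yes refl rewrite ≡ᵇ-refl u = m≤n+m 1 (b2n (F u u) + b2n (F u u))
        ...   | no ne with sc u v q p ne
        ...     | inj₁ x rewrite x = ≤-trans (m≤n+m 1 (b2n (F v u))) (m≤m+n _ _)
        ...     | inj₂ x rewrite x = s≤s z≤n
        total : sum n (λ v → sum n (λ u → f v u + f u v + b2n (W v) * b2n (u ≡ᵇ v))) ≡ Z + Z + S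
        total = begin
          sum n (λ v → sum n (λ u → f v u + f u v + b2n (W v) * b2n (u ≡ᵇ v)))
            ≡⟨ sum-cong n (λ v p → trans (sum-+ n _ _) (cong₂ _+_ (sum-+ n _ _) (trans (sum-* n (b2n (W v)) (λ u → b2n (u ≡ᵇ v))) (trans (cong (b2n (W v) *_) (sum-δ p)) (*-identityʳ _))))) ⟩
          sum n (λ v → sum n (f v) + sum n (λ u → f u v) + b2n (W v))
            ≡⟨ trans (sum-+ n _ _) (cong₂ _+_ (sum-+ n _ _) e) ⟩
          Z + sum n (λ v → sum n (λ u → f u v)) + S
            ≡⟨ cong (λ x → Z + x + S) (sym (sum-swap n n f)) ⟩
          Z + Z + S ∎
          where open ≡-Reasoning
      main : S * (S + 1) ≤ S * (2 * b)
      main = begin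
        S * (S + 1)           ≡⟨ trans (*-distribˡ-+ S S 1) (cong (S * S +_) (*-identityʳ S)) ⟩
        S * S + S             ≤⟨ +-monoˡ-≤ S lower ⟩
        Z + Z + S + S         ≡⟨ trans (+-assoc (Z + Z) S S) (+-interchange Z Z S S) ⟩
        (Z + S) + (Z + S)     ≤⟨ +-mono-≤ upper upper ⟩
        S * b + S * b         ≡⟨ sym (*-distribˡ-+ S b b) ⟩
        S * (b + b)           ≡⟨ cong (λ x → S * (b + x)) (sym (+-identityʳ b)) ⟩
        S * (2 * b)           ∎
        where open ≤-Reasoning

    -- Let v be in `W-C`. The more than |C| vertices without an arc from v lie in C and its
    -- boundary, because there are no arcs from the rest to v and hence v dominates the rest. The
    -- out-neighbours of v in `W-C` are further vertices of C, so there are fewer than b of them.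
    W-C-size : ∀ R C b → C ⊆[ n ] R → # (boundary R C) ≤ b → 1 ≤ b → # (W-C R b C) + 1 ≤ 2 * b
    W-C-size R C b C⊆R ∂≤b 1≤b = sparse-size E semi (W-C R b C) b out 1≤b
      where
      out : ∀ v → v < n → W-C R b C v ≡ true → # (λ u → W-C R b C u ∧ E v u) + 1 ≤ b
      out v p wv = +-cancelˡ-≤ (# C) _ _ (begin
        # C + (o + 1)             ≡⟨ trans (cong (# C +_) (+-comm o 1)) (+-suc (# C) o) ⟩
        suc (# C) + o             ≤⟨ +-monoˡ-≤ o (<ᵇ-true (∧-right {C v} wv)) ⟩
        codeg R v + o             ≤⟨ subst₂ _≤_ (sum-+ n _ _) (sum-+ n _ _) (sum-mono n pointwise) ⟩
        # C + # (boundary R C)    ≤⟨ +-monoʳ-≤ (# C) ∂≤b ⟩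
        # C + b                   ∎)
        where
        open ≤-Reasoning
        o = # (λ u → W-C R b C u ∧ E v u)
        cv = ∧-left wv
        pointwise : ∀ u → u < n → b2n (R u ∧ not (E v u)) + b2n (W-C R b C u ∧ E v u) ≤ b2n (C u) + b2n (boundary R C u)
        pointwise u q = two-≤ {R u ∧ not (E v u)} {W-C R b C u ∧ E v u} x y z
          where
          x : R u ∧ not (E v u) ≡ true → C u ≡ true ⊎ boundary R C u ≡ true
          x e with classify R C u
          ... | inj₁ r = ⊥-elim (true≢false (∧-left e) r)
          ... | inj₂ (inj₁ c) = inj₁ c
          ... | inj₂ (inj₂ (inj₁ b)) = inj₂ b
          ... | inj₂ (inj₂ (inj₂ t)) = ⊥-elim (true≢false (back-arc p q (λ { refl → true≢false cv (rest-∉ R C {u} t) }) (not-elim (∧-right {R u} e))) (rest-no-arc R C {u} t p cv))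
          y : W-C R b C u ∧ E v u ≡ true → C u ≡ true ⊎ boundary R C u ≡ true
          y e = inj₁ (∧-left (∧-left {W-C R b C u} e))
          z : R u ∧ not (E v u) ≡ true → W-C R b C u ∧ E v u ≡ false
          z e = ≢true (λ t → true≢false (∧-right {W-C R b C u} t) (not-elim (∧-right {R u} e)))

    -- A vertex of the rest has all of C among its in-neighbours, so an in-degree below |C| + b
    -- leaves fewer than b in-neighbours in `W-Q`. The count of arcs is applied to the reversed
    -- digraph.
    W-Q-size : ∀ R C b → C ⊆[ n ] R → 1 ≤ b → # (W-Q R b C) + 1 ≤ 2 * b
    W-Q-size R C b C⊆R 1≤b = sparse-size (λ u v → E v u) (λ u v p q ne → semi v u q p (λ z → ne (sym z))) (W-Q R b C) b out 1≤b
      where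
      out : ∀ v → v < n → W-Q R b C v ≡ true → # (λ u → W-Q R b C u ∧ E u v) + 1 ≤ b
      out v p wv = +-cancelˡ-≤ (# C) _ _ (begin
        # C + (o + 1)   ≡⟨ trans (cong (# C +_) (+-comm o 1)) (+-suc (# C) o) ⟩
        suc (# C + o)   ≤⟨ s≤s (subst (_≤ indeg R v) (sum-+ n _ _) (sum-mono n pointwise)) ⟩
        suc (indeg R v) ≤⟨ <ᵇ-true (∧-right {rest R C v} wv) ⟩
        # C + b         ∎)
        where
        open ≤-Reasoning
        o = # (λ u → W-Q R b C u ∧ E u v)
        qv = ∧-left {rest R C v} wv
        pointwise : ∀ u → u < n → b2n (C u) + b2n (W-Q R b C u ∧ E u v) ≤ b2n (R u ∧ E u v)
        pointwise u q = pair-≤ {C u} {W-Q R b C u ∧ E u v}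
          (λ z → ∧-intro (C⊆R u q z) (back-arc p q (λ { refl → true≢false z (rest-∉ R C {u} qv) }) (rest-no-arc R C {v} qv q z)))
          (λ z → ∧-intro (rest-R R C {u} (∧-left {rest R C u} (∧-left {W-Q R b C u} z))) (∧-right {W-Q R b C u} z))
          (λ z → ≢true (λ t → true≢false z (rest-∉ R C {u} (∧-left {rest R C u} (∧-left {W-Q R b C u} t)))))

    -- The parts in C and in the rest have at most 2 b - 1 vertices each, the boundary at most b.
    window-size : ∀ R C b → C ⊆[ n ] R → # (boundary R C) ≤ b → 1 ≤ b → # (window R (# C) b) + 2 ≤ 5 * b
    window-size R C b C⊆R ∂≤b 1≤b = begin
      # (window R (# C) b) + 2                  ≤⟨ +-monoˡ-≤ 2 (≤-trans (sum-mono n pointwise) (≤-reflexive (trans (sum-+ n _ _) (cong (_+ # (boundary R C)) (sum-+ n _ _))))) ⟩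
      (w₁ + w₂ + # (boundary R C)) + 2          ≤⟨ +-monoˡ-≤ 2 (+-monoʳ-≤ (w₁ + w₂) ∂≤b) ⟩
      (w₁ + w₂ + b) + 2                         ≡⟨ solve 3 (λ x y b → (x :+ y :+ b) :+ con 2 := (x :+ con 1) :+ (y :+ con 1) :+ b) refl w₁ w₂ b ⟩
      (w₁ + 1) + (w₂ + 1) + b                   ≤⟨ +-monoˡ-≤ b (+-mono-≤ (W-C-size R C b C⊆R ∂≤b 1≤b) (W-Q-size R C b C⊆R 1≤b)) ⟩
      2 * b + 2 * b + b                         ≡⟨ solve 1 (λ b → con 2 :* b :+ con 2 :* b :+ b := con 5 :* b) refl b ⟩
      5 * b                                     ∎
      where
      open ≤-Reasoning
      open +-*-Solver
      w₁ = # (W-C R b C)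
      w₂ = # (W-Q R b C)
      pointwise : ∀ v → v < n → b2n (window R (# C) b v) ≤ b2n (W-C R b C v) + b2n (W-Q R b C v) + b2n (boundary R C v)
      pointwise v p with window R (# C) b v in u
      ... | false = z≤n
      ... | true with classify R C v
      ...   | inj₁ r = ⊥-elim (true≢false (∧-left u) r)
      ...   | inj₂ (inj₁ c) = ≤-trans (≤-reflexive (sym (cong b2n (∧-intro c (∧-left (∧-right {R v} u)))))) (≤-trans (m≤m+n (b2n (W-C R b C v)) _) (m≤m+n _ _))
      ...   | inj₂ (inj₂ (inj₁ d)) = ≤-trans (≤-reflexive (sym (cong b2n d))) (m≤n+m _ _)
      ...   | inj₂ (inj₂ (inj₂ t)) = ≤-trans (≤-reflexive (sym (cong b2n (∧-intro {rest R C v} t (∧-right {# C <ᵇ codeg R v} (∧-right {R v} u)))))) (≤-trans (m≤n+m (b2n (W-Q R b C v)) (b2n (W-C R b C v))) (m≤m+n (b2n (W-C R b C v) + b2n (W-Q R b C v)) (b2n (boundary R C v))))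

    -- The invariant of a search steered towards C. Vertices of the boundary may have been placed on
    -- the left by their degrees, but they are never pending; vertices of C and of the rest are
    -- never deleted.
    record Consistent (R C : VSet) (st : Status) : Set where
      field
        on-C : ∀ v → v < n → C v ≡ true → st v ≡ 2 ⊎ st v ≡ 1
        on-∂ : ∀ v → v < n → boundary R C v ≡ true → st v ≡ 0 ⊎ (st v ≡ 2 ⊎ st v ≡ 4)
        on-Q : ∀ v → v < n → rest R C v ≡ true → st v ≡ 0
        absent  : ∀ v → v < n → R v ≡ false → st v ≡ 3

    open Consistent public

    todo : VSet → VSet → Status → VSet
    todo R C st v = boundary R C v ∧ not (st v ≡ᵇ 4)

    pend : Status → VSet
    pend st v = st v ≡ᵇ 1

    module _ (R C : VSet) (C⊆R : C ⊆[ n ] R) where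

      promote : ∀ {st t} → Consistent R C st → t < n → C t ≡ true → Consistent R C (st [ t ↦ 2 ])
      promote {st} {t} k t<n ct = record { on-C = a ; on-∂ = b ; on-Q = c ; absent = d }
        where
        a : ∀ v → v < n → C v ≡ true → (st [ t ↦ 2 ]) v ≡ 2 ⊎ (st [ t ↦ 2 ]) v ≡ 1
        a v p q with v ≡ᵇ t
        ... | true  = inj₁ refl
        ... | false = on-C k v p q
        b : ∀ v → v < n → boundary R C v ≡ true → (st [ t ↦ 2 ]) v ≡ 0 ⊎ ((st [ t ↦ 2 ]) v ≡ 2 ⊎ (st [ t ↦ 2 ]) v ≡ 4)
        b v p q with v ≡ᵇ t
        ... | true  = inj₂ (inj₁ refl)
        ... | false = on-∂ k v p q
        c : ∀ v → v < n → rest R C v ≡ true → (st [ t ↦ 2 ]) v ≡ 0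
        c v p q with v ≡ᵇ t in z
        ... | true  = ⊥-elim (true≢false ct (subst (λ x → C x ≡ false) (≡ᵇ-true {v} z) (rest-∉ R C {v} q)))
        ... | false = on-Q k v p q
        d : ∀ v → v < n → R v ≡ false → (st [ t ↦ 2 ]) v ≡ 3
        d v p q with v ≡ᵇ t in z
        ... | true  = ⊥-elim (true≢false (C⊆R t t<n ct) (subst (λ x → R x ≡ false) (≡ᵇ-true {v} z) q))
        ... | false = absent k v p q

      delete : ∀ {st t} → Consistent R C st → t < n → boundary R C t ≡ true → Consistent R C (st [ t ↦ 4 ])
      delete {st} {t} k t<n bt = record { on-C = a ; on-∂ = b ; on-Q = c ; absent = d }
        where
        a : ∀ v → v < n → C v ≡ true → (st [ t ↦ 4 ]) v ≡ 2 ⊎ (st [ t ↦ 4 ]) v ≡ 1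
        a v p q with v ≡ᵇ t in z
        ... | true  = ⊥-elim (true≢false q (subst (λ x → C x ≡ false) (sym (≡ᵇ-true {v} z)) (boundary-∉ R C {t} bt)))
        ... | false = on-C k v p q
        b : ∀ v → v < n → boundary R C v ≡ true → (st [ t ↦ 4 ]) v ≡ 0 ⊎ ((st [ t ↦ 4 ]) v ≡ 2 ⊎ (st [ t ↦ 4 ]) v ≡ 4)
        b v p q with v ≡ᵇ t
        ... | true  = inj₂ (inj₂ refl)
        ... | false = on-∂ k v p q
        c : ∀ v → v < n → rest R C v ≡ true → (st [ t ↦ 4 ]) v ≡ 0
        c v p q with v ≡ᵇ t in z
        ... | true  = ⊥-elim (true≢false bt (subst (λ x → boundary R C x ≡ false) (≡ᵇ-true {v} z) (rest-∉∂ R C {v} q)))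
        ... | false = on-Q k v p q
        d : ∀ v → v < n → R v ≡ false → (st [ t ↦ 4 ]) v ≡ 3
        d v p q with v ≡ᵇ t in z
        ... | true  = ⊥-elim (true≢false (boundary-R R C {t} bt) (subst (λ x → R x ≡ false) (≡ᵇ-true {v} z) q))
        ... | false = absent k v p q

      promote-pend : ∀ {st t} → t < n → st t ≡ 1 → # (pend (st [ t ↦ 2 ])) < # (pend st)
      promote-pend {st} {t} p q = sum-mono-< n (λ v _ → b2n-mono (incl v)) p (b2n-< (cong (_≡ᵇ 1) (upd-same st t 2)) (cong (_≡ᵇ 1) q))
        where
        incl : ∀ v → pend (st [ t ↦ 2 ]) v ≡ true → pend st v ≡ true
        incl v z with v ≡ᵇ t
        ... | false = z

      promote-todo : ∀ {st t} → C t ≡ true → # (todo R C (st [ t ↦ 2 ])) ≤ # (todo R C st)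
      promote-todo {st} {t} ct = #-mono incl
        where
        incl : ∀ v → v < n → todo R C (st [ t ↦ 2 ]) v ≡ true → todo R C st v ≡ true
        incl v p z with v ≡ᵇ t in e
        ... | false = z
        ... | true  = ⊥-elim (true≢false (∧-left {boundary R C v} z) (≢true (λ b → true≢false ct (subst (λ x → C x ≡ false) (≡ᵇ-true {v} e) (boundary-∉ R C {v} b)))))

      delete-todo : ∀ {st t} → t < n → boundary R C t ≡ true → (st t ≡ᵇ 4) ≡ false → # (todo R C (st [ t ↦ 4 ])) < # (todo R C st)
      delete-todo {st} {t} p b q = sum-mono-< n (λ v _ → b2n-mono (incl v)) p
        (b2n-< (≢true (λ z → true≢false (cong (_≡ᵇ 4) (upd-same st t 4)) (not-elim (∧-right {boundary R C t} z)))) (∧-intro b (not-intro q)))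
        where
        incl : ∀ v → todo R C (st [ t ↦ 4 ]) v ≡ true → todo R C st v ≡ true
        incl v z with v ≡ᵇ t
        ... | false = z
        ... | true  = ⊥-elim (true≢false (∧-right {boundary R C v} z) refl)

      delete-pend : ∀ {st t} → # (pend (st [ t ↦ 4 ])) ≤ # (pend st)
      delete-pend {st} {t} = #-mono incl
        where
        incl : ∀ v → v < n → pend (st [ t ↦ 4 ]) v ≡ true → pend st v ≡ true
        incl v _ z with v ≡ᵇ t
        ... | false = z

      settled : ∀ {st} → pending st ≡ 0 → violated st ≡ 0 → ∀ h → round (st , h) ≡ (st , h)
      settled p q h rewrite p | q = refl

      round-promote : ∀ {st t} → pending st ≡ suc t → ∀ h → round (st , h) ≡ (st [ t ↦ 2 ] , h)
      round-promote p h rewrite p = refl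

      round-delete : ∀ {st q u} → pending st ≡ 0 → violated st ≡ suc q → culprit st ≡ suc u → ∀ b h →
                     round (st , b2n b + h * 2) ≡ (st [ (if b then q else u) ↦ 4 ] , h)
      round-delete {st} {q} {u} p v c b h = cong₂ _,_ (moved b) (trans (advice-eq b) (bit-/2 b h))
        where
        advice-eq : ∀ b → advice st (b2n b + h * 2) ≡ (b2n b + h * 2) / 2
        advice-eq b rewrite p | v = refl
        chosen-eq : ∀ b → chosen st (b2n b + h * 2) ≡ suc (if b then q else u)
        chosen-eq true  = trans (cong₂ (λ x y → if x ≡ᵇ 0 then (if y ≡ᵇ 0 then 0 else (if (1 + h * 2) % 2 ≡ᵇ 0 then culprit st else y)) else x) p v) (cong (λ x → if x ≡ᵇ 0 then culprit st else suc q) (bit-%2 true h))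
        chosen-eq false = trans (cong₂ (λ x y → if x ≡ᵇ 0 then (if y ≡ᵇ 0 then 0 else (if (h * 2) % 2 ≡ᵇ 0 then culprit st else y)) else x) p v) (trans (cong (λ x → if x ≡ᵇ 0 then culprit st else suc q) (bit-%2 false h)) c)
        moved : ∀ b → move st (b2n b + h * 2) ≡ st [ (if b then q else u) ↦ 4 ]
        moved b = cong₂ (λ x y → if x ≡ᵇ 0 then st else st [ x ∸ 1 ↦ (if y ≡ᵇ 0 then 4 else 2) ]) (chosen-eq b) p

      pending-C : ∀ {st t} → Consistent R C st → t < n → st t ≡ 1 → C t ≡ true
      pending-C {st} {t} k p q with classify R C t
      ... | inj₂ (inj₁ c) = c
      ... | inj₁ r with trans (sym q) (absent k t p r)
      ...   | ()
      pending-C {st} {t} k p q | inj₂ (inj₂ (inj₂ r)) with trans (sym q) (on-Q k t p r)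
      ...   | ()
      pending-C {st} {t} k p q | inj₂ (inj₂ (inj₁ b)) with on-∂ k t p b
      ...   | inj₁ z with trans (sym q) z
      ...     | ()
      pending-C {st} {t} k p q | inj₂ (inj₂ (inj₁ b)) | inj₂ (inj₁ z) with trans (sym q) z
      ...     | ()
      pending-C {st} {t} k p q | inj₂ (inj₂ (inj₁ b)) | inj₂ (inj₂ z) with trans (sym q) z
      ...     | ()

      -- One end of a violating arc lies in the boundary of C.
      blame : ∀ {st q u} → Consistent R C st → pending st ≡ 0 → q < n → u < n → st q ≡ 2 → right st u ≡ true → E u q ≡ true →
              (C q ≡ true × boundary R C u ≡ true × (st u ≡ᵇ 4) ≡ false) ⊎ boundary R C q ≡ true
      blame {st} {q} {u} k z q<n u<n sq su e with classify R C q
      ... | inj₁ r with trans (sym sq) (absent k q q<n r)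
      ...   | ()
      blame {st} {q} {u} k z q<n u<n sq su e | inj₂ (inj₂ (inj₁ b)) = inj₂ b
      blame {st} {q} {u} k z q<n u<n sq su e | inj₂ (inj₂ (inj₂ r)) with trans (sym sq) (on-Q k q q<n r)
      ...   | ()
      blame {st} {q} {u} k z q<n u<n sq su e | inj₂ (inj₁ c) with classify R C u
      ...   | inj₁ r = ⊥-elim (<2⇒≢3 su (absent k u u<n r))
      ...   | inj₂ (inj₂ (inj₂ r)) = ⊥-elim (true≢false e (rest-no-arc R C {u} r q<n c))
      ...   | inj₂ (inj₂ (inj₁ b)) = inj₁ (c , b , ≢true (λ y → true≢false su (cong (_<ᵇ 2) (≡ᵇ-true {st u} y))))
      ...   | inj₂ (inj₁ cu) with on-C k u u<n cu
      ...     | inj₁ y = ⊥-elim (true≢false su (cong (_<ᵇ 2) y))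
      ...     | inj₂ y = ⊥-elim (true≢false (cong (_≡ᵇ 1) y) (find-zero n _ z u u<n))

      record Done (s : Status × ℕ) : Set where
        field
          consistent : Consistent R C (proj₁ s)
          none-pending : pending (proj₁ s) ≡ 0
          none-violated : violated (proj₁ s) ≡ 0

      shift-round : ∀ ρ {s s′} → round s ≡ s′ → Done (iterate round ρ s′) → Done (iterate round (suc ρ) s)
      shift-round ρ {s} refl d = subst Done (iterate-shift round ρ s) d

      -- A round moves a pending vertex or deletes a vertex of the boundary, so the sum of both
      -- numbers decreases until the status is settled. Only deletions read a bit, hence the
      -- separate bound j for the length of the string.
      complete : ∀ ρ st j → Consistent R C st → # (pend st) + # (todo R C st) ≤ ρ → # (todo R C st) ≤ j →
                 ∃[ h ] (h < 2 ^ j × Done (iterate round ρ (st , h)))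
      complete ρ st j k μ≤ρ t≤j with pending st in p
      complete zero st j k μ≤ρ t≤j | suc t =
        ⊥-elim (<⇒≱ (#-member (pend st) (proj₁ (find-suc n _ p)) (proj₂ (find-suc n _ p))) (≤-trans (m≤m+n _ _) μ≤ρ))
      complete (suc ρ) st j k μ≤ρ t≤j | suc t
        with complete ρ (st [ t ↦ 2 ]) j (promote k t<n ct) (s≤s⁻¹ (≤-trans (+-mono-≤ (promote-pend t<n st≡1) (promote-todo {st} ct)) μ≤ρ)) (≤-trans (promote-todo {st} ct) t≤j)
        where
        t<n = proj₁ (find-suc n _ p)
        st≡1 = ≡ᵇ-true {st t} (proj₂ (find-suc n _ p))
        ct = pending-C k t<n st≡1
      ... | h , a , d = h , a , shift-round ρ (round-promote p h) d
      complete ρ st j k μ≤ρ t≤j | zero with violated st in v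
      ... | zero = 0 , m^n>0 2 j , subst Done (sym (iterate-fixed round ρ (settled p v 0))) (record { consistent = k ; none-pending = p ; none-violated = v })
      ... | suc q with find-suc n _ v
      ...   | q<n , bad with sum-pos n _ (<ᵇ-true {0} (∧-right {st q ≡ᵇ 2} bad))
      ...     | u₀ , u₀<n , su₀ with culprit st in c
      ...       | zero = ⊥-elim (true≢false (subst (λ i → (st u₀ <ᵇ 2) ∧ E u₀ (i ∸ 1) ≡ true) (sym v) (b2n-pos su₀)) (find-zero n _ c u₀ u₀<n))
      ...       | suc u = go ρ j μ≤ρ t≤j (blame k p q<n u<n sq su e)
        where
        u<n = proj₁ (find-suc n _ c)
        su = ∧-left (proj₂ (find-suc n _ c))
        sq = ≡ᵇ-true {st q} (∧-left bad)
        e = subst (λ i → E u (i ∸ 1) ≡ true) v (∧-right {st u <ᵇ 2} (proj₂ (find-suc n _ c)))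
        remove : ∀ ρ j b → let t = if b then q else u in t < n → boundary R C t ≡ true → (st t ≡ᵇ 4) ≡ false →
                 # (pend st) + # (todo R C st) ≤ ρ → # (todo R C st) ≤ j → ∃[ h ] (h < 2 ^ j × Done (iterate round ρ (st , h)))
        remove zero j b t<n bt ne μ≤ρ t≤j = ⊥-elim (<⇒≱ (#-member (todo R C st) t<n (∧-intro bt (not-intro ne))) (≤-trans (m≤n+m _ (# (pend st))) μ≤ρ))
        remove (suc ρ) zero b t<n bt ne μ≤ρ t≤j = ⊥-elim (<⇒≱ (#-member (todo R C st) t<n (∧-intro bt (not-intro ne))) t≤j)
        remove (suc ρ) (suc j) b t<n bt ne μ≤ρ t≤j
          with complete ρ (st [ (if b then q else u) ↦ 4 ]) j (delete k t<n bt)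
                 (s≤s⁻¹ (≤-trans (subst (_≤ # (pend st) + # (todo R C st)) (+-suc _ _) (+-mono-≤ (delete-pend {st}) (delete-todo t<n bt ne))) μ≤ρ))
                 (s≤s⁻¹ (≤-trans (delete-todo t<n bt ne) t≤j))
        ... | h , a , d = b2n b + h * 2 , bit-bound b {h} {j} a , shift-round ρ (round-delete p v c b h) d
        go : ∀ ρ j → # (pend st) + # (todo R C st) ≤ ρ → # (todo R C st) ≤ j →
             (C q ≡ true × boundary R C u ≡ true × (st u ≡ᵇ 4) ≡ false) ⊎ boundary R C q ≡ true → ∃[ h ] (h < 2 ^ j × Done (iterate round ρ (st , h)))
        go ρ j μ≤ρ t≤j (inj₁ (_ , bu , ne)) = remove ρ j false u<n bu ne μ≤ρ t≤j
        go ρ j μ≤ρ t≤j (inj₂ bq) = remove ρ j true q<n bq (cong (_≡ᵇ 4) sq) μ≤ρ t≤j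

      -- The result may differ from C by boundary vertices that stayed on the left. `total≤`
      -- compensates for this: a left side larger than C comes with correspondingly fewer deletions.
      record Hit (b : ℕ) (st : Status) : Set where
        field
          clean   : faults st ≡ 0
          C⊆left  : C ⊆[ n ] left st
          left⊆   : ∀ v → v < n → left st v ≡ true → C v ≡ true ⊎ boundary R C v ≡ true
          right⊆  : right st ⊆[ n ] rest R C
          gone≤   : # (gone st) ≤ # (boundary R C)
          total≤  : # (left st) + # (gone st) ≤ # C + # (boundary R C)

      done-hit : ∀ b s → WF R (proj₁ s) → Done s → Hit b (proj₁ s)
      done-hit b (st , h) w d = record
        { clean = #-zero _ (find-zero n _ none-violated)
        ; C⊆left = c⊆l ; left⊆ = l⊆ ; right⊆ = r⊆ ; gone≤ = #-mono g⊆
        ; total≤ = subst₂ _≤_ (sum-+ n _ _) (sum-+ n _ _) (sum-mono n (λ v p → two-≤ {left st v} {gone st v} (l⊆ v p) (λ z → inj₂ (g⊆ v p z)) (λ z → cong (_≡ᵇ 4) (≡ᵇ-true {st v} z)))) }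
        where
        open Done d
        k = consistent
        c⊆l : C ⊆[ n ] left st
        c⊆l v p c with on-C k v p c
        ... | inj₁ z = cong (_≡ᵇ 2) z
        ... | inj₂ z = ⊥-elim (true≢false (cong (_≡ᵇ 1) z) (find-zero n _ none-pending v p))
        l⊆ : ∀ v → v < n → left st v ≡ true → C v ≡ true ⊎ boundary R C v ≡ true
        l⊆ v p z with classify R C v
        ... | inj₁ r = ⊥-elim (true≢false z (cong (_≡ᵇ 2) (absent k v p r)))
        ... | inj₂ (inj₁ c) = inj₁ c
        ... | inj₂ (inj₂ (inj₁ b)) = inj₂ b
        ... | inj₂ (inj₂ (inj₂ r)) = ⊥-elim (true≢false z (cong (_≡ᵇ 2) (on-Q k v p r)))
        g⊆ : gone st ⊆[ n ] boundary R C
        g⊆ v p z with classify R C v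
        ... | inj₁ r = ⊥-elim (true≢false z (cong (_≡ᵇ 4) (absent k v p r)))
        ... | inj₂ (inj₁ c) = ⊥-elim (true≢false (c⊆l v p c) (cong (_≡ᵇ 2) (≡ᵇ-true {st v} z)))
        ... | inj₂ (inj₂ (inj₁ b)) = b
        ... | inj₂ (inj₂ (inj₂ r)) = ⊥-elim (true≢false z (cong (_≡ᵇ 4) (on-Q k v p r)))
        r⊆ : right st ⊆[ n ] rest R C
        r⊆ v p z with classify R C v
        ... | inj₁ r = ⊥-elim (true≢false z (cong (_<ᵇ 2) (absent k v p r)))
        ... | inj₂ (inj₁ c) = ⊥-elim (true≢false z (left-¬right st v (c⊆l v p c)))
        ... | inj₂ (inj₂ (inj₂ r)) = r
        -- A boundary vertex on the right would put pressure on a vertex of C, which is on the left.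
        ... | inj₂ (inj₂ (inj₁ b)) with boundary-arc R C {v} b
        ...   | t , t<n , ct , e = ⊥-elim (true≢false
                  (∧-intro (c⊆l t t<n ct) (<ᵇ-intro (#-member (λ u → (st u <ᵇ 2) ∧ E u t) p (∧-intro z e))))
                  (find-zero n _ none-violated t t<n))

      -- The degree bounds agree with C: a vertex of C has in-degree below |C| + b, so it is in the
      -- window or already on the left, and a vertex of the rest has codegree above |C|, so it does
      -- not start on the left.
      label-consistent : ∀ b h → # (boundary R C) ≤ b →
        (∀ v → v < n → window R (# C) b v ≡ true → remaining (window R (# C) b) h v % 2 ≡ b2n (C v)) →
        Consistent R C (label R (# C) b h)
      label-consistent b h ∂≤b bits = record { on-C = on-c ; on-∂ = on-b ; on-Q = on-q ; absent = of }
        where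
        st = label R (# C) b h
        bit-val : ∀ v → v < n → b2n (window R (# C) b v) * (remaining (window R (# C) b) h v % 2) ≡ b2n (window R (# C) b v) * b2n (C v)
        bit-val v p with true-or-false (window R (# C) b v)
        ... | inj₁ u = cong (b2n (window R (# C) b v) *_) (bits v p u)
        ... | inj₂ u = trans (cong (λ x → b2n x * (remaining (window R (# C) b) h v % 2)) u) (sym (cong (λ x → b2n x * b2n (C v)) u))
        value : ∀ v → v < n → R v ≡ true → st v ≡ (if # C <ᵇ codeg R v then b2n (window R (# C) b v) * b2n (C v) else 2)
        value v p r = trans (cong (λ x → if x then (if # C <ᵇ codeg R v then b2n (window R (# C) b v) * (remaining (window R (# C) b) h v % 2) else 2) else 3) r)
                            (cong (λ x → if # C <ᵇ codeg R v then x else 2) (bit-val v p))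
        on-c : ∀ v → v < n → C v ≡ true → st v ≡ 2 ⊎ st v ≡ 1
        on-c v p c with true-or-false (# C <ᵇ codeg R v)
        ... | inj₂ z = inj₁ (trans (value v p (C⊆R v p c)) (cong (λ x → if x then b2n (window R (# C) b v) * b2n (C v) else 2) z))
        ... | inj₁ z = inj₂ (trans (value v p (C⊆R v p c)) (trans (cong (λ x → if x then b2n (window R (# C) b v) * b2n (C v) else 2) z)
                          (cong₂ (λ x y → b2n x * b2n y) (∧-intro (C⊆R v p c) (∧-intro z (<ᵇ-intro small))) c)))
          where
          small : indeg R v < # C + b
          small = ≤-trans (≤-trans (≤-reflexive (+-comm 1 _)) (indeg-C R C C⊆R v p c)) (+-monoʳ-≤ (# C) ∂≤b)
        on-b : ∀ v → v < n → boundary R C v ≡ true → st v ≡ 0 ⊎ (st v ≡ 2 ⊎ st v ≡ 4)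
        on-b v p d with true-or-false (# C <ᵇ codeg R v)
        ... | inj₂ z = inj₂ (inj₁ (trans (value v p (boundary-R R C {v} d)) (cong (λ x → if x then b2n (window R (# C) b v) * b2n (C v) else 2) z)))
        ... | inj₁ z = inj₁ (trans (value v p (boundary-R R C {v} d)) (trans (cong₂ (λ x y → if x then b2n (window R (# C) b v) * b2n y else 2) z (boundary-∉ R C {v} d)) (*-zeroʳ (b2n (window R (# C) b v)))))
        on-q : ∀ v → v < n → rest R C v ≡ true → st v ≡ 0
        on-q v p r = trans (value v p (rest-R R C {v} r)) (trans (cong₂ (λ x y → if x then b2n (window R (# C) b v) * b2n y else 2)
                       (<ᵇ-intro (≤-trans (≤-reflexive (+-comm 1 _)) (codeg-Q R C C⊆R v p r))) (rest-∉ R C {v} r)) (*-zeroʳ (b2n (window R (# C) b v))))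
        of : ∀ v → v < n → R v ≡ false → st v ≡ 3
        of v p r rewrite r = refl

      window-label : ∀ b h → # (pend (label R (# C) b h)) ≤ # (window R (# C) b)
      window-label b h = #-mono incl
        where
        incl : pend (label R (# C) b h) ⊆[ n ] window R (# C) b
        incl v p z with R v
        ... | true with # C <ᵇ codeg R v
        ...   | true with indeg R v <ᵇ # C + b
        ...     | true = refl

      cut-complete : ∀ b → # (boundary R C) ≤ b → 1 ≤ b →
                     ∃[ h ] ∃[ h′ ] (h < 2 ^ (5 * b ∸ 2) × h′ < 2 ^ b × Hit b (cutF R (# C) b h h′))
      cut-complete b ∂≤b 1≤b with encode n (window R (# C) b) C 0 0 ≤-refl
      ... | h , h< , _ , bits
        -- At most 5 b - 2 moves of pending vertices and b deletions.
        with complete (6 * b) (label R (# C) b h) b (label-consistent b h ∂≤b bits)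
               (≤-trans (+-mono-≤ (≤-trans (window-label b h) (≤-trans (m≤m+n _ 2) (window-size R C b C⊆R ∂≤b 1≤b))) todo≤b)
                        (≤-reflexive (+-comm (5 * b) b)))
               todo≤b
        where
        todo≤b : # (todo R C (label R (# C) b h)) ≤ b
        todo≤b = ≤-trans (#-mono (λ v _ → ∧-left {boundary R C v})) ∂≤b
      ... | h′ , h′< , d =
        h , h′ , <-≤-trans h< (^-monoʳ-≤ 2 {# (window R (# C) b) + 0} {5 * b ∸ 2} (≤-trans (≤-reflexive (+-identityʳ _)) (m+n≤o⇒m≤o∸n _ (window-size R C b C⊆R ∂≤b 1≤b)))) , h′<
          , done-hit b _ (WF-cutF R (# C) b h h′) d

-- The algorithm

≡ᵇ0 : ∀ {x} → (x ≡ᵇ 0) ≡ true → x ≡ 0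
≡ᵇ0 {zero} _ = refl

digit : ∀ x M g → x < M → ⟦ mod ⟧ (x + g * M) M ≡ x × ⟦ div ⟧ (x + g * M) M ≡ g
digit x (suc M) g p = trans ([m+kn]%n≡m%n x g (suc M)) (m<n⇒m%n≡m p)
                    , trans (+-distrib-/-∣ʳ x (divides g refl)) (cong₂ _+_ (m<n⇒m/n≡0 p) (m*n/n≡m g (suc M)))

digit-bound : ∀ {x M g N} → x < M → g < N → x + g * M < M * N
digit-bound {x} {M} {g} {N} p q = begin-strict
  x + g * M <⟨ +-monoˡ-< (g * M) p ⟩
  suc g * M ≤⟨ *-monoˡ-≤ M q ⟩
  N * M     ≡⟨ *-comm N M ⟩
  M * N     ∎
  where open ≤-Reasoning

-- The digits stand in front of an arbitrary continuation g, which holds the advice for the later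
-- cuts.
mixed-radix : ∀ M₁ M₂ M₃ M₄ M₅ M₆ {x₁ x₂ x₃ x₄ x₅ x₆ g N} →
  x₁ < M₁ → x₂ < M₂ → x₃ < M₃ → x₄ < M₄ → x₅ < M₅ → x₆ < M₆ → g < N →
  ∃[ g₀ ] (let g₁ = ⟦ div ⟧ g₀ M₁ ; g₂ = ⟦ div ⟧ g₁ M₂ ; g₃ = ⟦ div ⟧ g₂ M₃ ; g₄ = ⟦ div ⟧ g₃ M₄ ; g₅ = ⟦ div ⟧ g₄ M₅ in
    g₀ < M₁ * (M₂ * (M₃ * (M₄ * (M₅ * (M₆ * N))))) × ⟦ div ⟧ g₅ M₆ ≡ g ×
    ⟦ mod ⟧ g₀ M₁ ≡ x₁ × ⟦ mod ⟧ g₁ M₂ ≡ x₂ × ⟦ mod ⟧ g₂ M₃ ≡ x₃ × ⟦ mod ⟧ g₃ M₄ ≡ x₄ × ⟦ mod ⟧ g₄ M₅ ≡ x₅ × ⟦ mod ⟧ g₅ M₆ ≡ x₆)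
mixed-radix M₁ M₂ M₃ M₄ M₅ M₆ {x₁} {x₂} {x₃} {x₄} {x₅} {x₆} {g} p₁ p₂ p₃ p₄ p₅ p₆ q =
  g₀ , digit-bound p₁ (digit-bound p₂ (digit-bound p₃ (digit-bound p₄ (digit-bound p₅ (digit-bound p₆ q)))))
     , trans (cong (λ x → ⟦ div ⟧ x M₆) e₅) (proj₂ (digit x₆ M₆ g p₆))
     , proj₁ (digit x₁ M₁ g₁ p₁)
     , trans (cong (λ x → ⟦ mod ⟧ x M₂) e₁) (proj₁ (digit x₂ M₂ g₂ p₂))
     , trans (cong (λ x → ⟦ mod ⟧ x M₃) e₂) (proj₁ (digit x₃ M₃ g₃ p₃))
     , trans (cong (λ x → ⟦ mod ⟧ x M₄) e₃) (proj₁ (digit x₄ M₄ g₄ p₄))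
     , trans (cong (λ x → ⟦ mod ⟧ x M₅) e₄) (proj₁ (digit x₅ M₅ g₅ p₅))
     , trans (cong (λ x → ⟦ mod ⟧ x M₆) e₅) (proj₁ (digit x₆ M₆ g p₆))
  where
  g₅ = x₆ + g * M₆
  g₄ = x₅ + g₅ * M₅
  g₃ = x₄ + g₄ * M₄
  g₂ = x₃ + g₃ * M₃
  g₁ = x₂ + g₂ * M₂
  g₀ = x₁ + g₁ * M₁
  e₁ : ⟦ div ⟧ g₀ M₁ ≡ g₁
  e₁ = proj₂ (digit x₁ M₁ g₁ p₁)
  e₂ : ⟦ div ⟧ (⟦ div ⟧ g₀ M₁) M₂ ≡ g₂
  e₂ = trans (cong (λ x → ⟦ div ⟧ x M₂) e₁) (proj₂ (digit x₂ M₂ g₂ p₂))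
  e₃ : ⟦ div ⟧ (⟦ div ⟧ (⟦ div ⟧ g₀ M₁) M₂) M₃ ≡ g₃
  e₃ = trans (cong (λ x → ⟦ div ⟧ x M₃) e₂) (proj₂ (digit x₃ M₃ g₃ p₃))
  e₄ : ⟦ div ⟧ (⟦ div ⟧ (⟦ div ⟧ (⟦ div ⟧ g₀ M₁) M₂) M₃) M₄ ≡ g₄
  e₄ = trans (cong (λ x → ⟦ div ⟧ x M₄) e₃) (proj₂ (digit x₄ M₄ g₄ p₄))
  e₅ : ⟦ div ⟧ (⟦ div ⟧ (⟦ div ⟧ (⟦ div ⟧ (⟦ div ⟧ g₀ M₁) M₂) M₃) M₄) M₅ ≡ g₅
  e₅ = trans (cong (λ x → ⟦ div ⟧ x M₅) e₄) (proj₂ (digit x₅ M₅ g₅ p₅))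

private
  join : ∀ x {y z} → y ≤ 2 ^ z → 2 ^ x * y ≤ 2 ^ (x + z)
  join x {y} {z} p = ≤-trans (*-monoʳ-≤ (2 ^ x) p) (≤-reflexive (sym (^-distribˡ-+-* 2 x z)))

  join′ : ∀ {a} x {y z} → a ≤ 2 ^ x → y ≤ 2 ^ z → a * y ≤ 2 ^ (x + z)
  join′ x {y} {z} p q = ≤-trans (*-mono-≤ p q) (≤-reflexive (sym (^-distribˡ-+-* 2 x z)))

-- The radices belong, in this order, to the boundary size m, the offset, the two strings that steer
-- the sweep and the two strings that steer the final cut; N bounds the continuation.
advice-bound : ℕ → ℕ → ℕ
advice-bound b N = (b + 2) * ((4 * b + 1) * (2 ^ (5 * b ∸ 2) * (2 ^ b * (2 ^ (5 * b ∸ 2) * (2 ^ b * N)))))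

mixed-size : ∀ {a c N} u v x y z → a ≤ 2 ^ u → c ≤ 2 ^ v → N ≤ 2 ^ z →
             a * (c * (2 ^ x * (2 ^ y * (2 ^ x * (2 ^ y * N))))) ≤ 2 ^ (u + (v + (x + (y + (x + (y + z))))))
mixed-size u v x y z p q r = join′ u p (join′ v q (join x (join y (join x (join y r)))))

-- Stripping, paying and ticking, with their soundness

module Algorithm (n : ℕ) (E : ℕ → ℕ → Bool) (ℓ : ℕ) where

  open Search n E ℓ public

  -- In a semicomplete digraph, the left side of a cut without deletions is `below R c` where c
  -- exceeds its size by one: its vertices have codegree at most that size, all others a larger one.
  below above : VSet → ℕ → VSet
  below R c v = R v ∧ (codeg R v <ᵇ c)
  above R c v = R v ∧ not (codeg R v <ᵇ c)

  free : VSet → ℕ → ℕ → Bool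
  free R c s = (faults (cutF R c 0 0 0) ≡ᵇ 0) ∧ (# (left (cutF R c 0 0 0)) <ᵇ suc (s + ℓ))

  -- The chain of cuts without deletions, each as far as possible from the
  -- previous one: the last cut and the number of vertices on its left.
  scan : VSet → ℕ → ℕ × ℕ
  scan R zero    = 0 , 0
  scan R (suc c) = if free R c (proj₂ (scan R c)) then (suc c , # (left (cutF R c 0 0 0))) else scan R c

  stripF : VSet → VSet
  stripF R = above R (proj₁ (scan R (suc n)))

  label-0 : ∀ R c v → R v ≡ true → cutF R c 0 0 0 v ≡ (if c <ᵇ codeg R v then 0 else 2)
  label-0 R c v r rewrite r with c <ᵇ codeg R v
  ... | false = refl
  ... | true  = trans (cong (λ x → b2n (indeg R v <ᵇ c + 0) * (x % 2)) (none v)) (*-zeroʳ (b2n (indeg R v <ᵇ c + 0)))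
    where
    none : ∀ v → remaining (window R c 0) 0 v ≡ 0
    none zero = refl
    none (suc v) with window R c 0 v
    ... | true  = cong (_/ 2) (none v)
    ... | false = none v

  not-< : ∀ c k → (k <ᵇ suc c) ≡ not (c <ᵇ k)
  not-< c k with true-or-false (c <ᵇ k)
  ... | inj₁ z = trans (<ᵇ-elimF {k} (<ᵇ-true {c} {k} z)) (sym (cong not z))
  ... | inj₂ z = trans (<ᵇ-intro {k} (s≤s (<ᵇ-false {c} {k} z))) (sym (cong not z))

  left-0 : ∀ R c v → v < n → left (cutF R c 0 0 0) v ≡ below R (suc c) v
  left-0 R c v p with true-or-false (R v)
  ... | inj₂ r rewrite r = refl
  ... | inj₁ r = trans (cong (_≡ᵇ 2) (label-0 R c v r)) (trans (go (c <ᵇ codeg R v)) (sym (trans (cong (_∧ (codeg R v <ᵇ suc c)) r) (not-< c (codeg R v)))))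
    where
    go : ∀ b → ((if b then 0 else 2) ≡ᵇ 2) ≡ not b
    go true  = refl
    go false = refl

  right-0 : ∀ R c v → v < n → right (cutF R c 0 0 0) v ≡ above R (suc c) v
  right-0 R c v p with true-or-false (R v)
  ... | inj₂ r rewrite r = refl
  ... | inj₁ r = trans (cong (_<ᵇ 2) (label-0 R c v r)) (trans (go (c <ᵇ codeg R v)) (sym (trans (cong (_∧ not (codeg R v <ᵇ suc c)) r) (cong not (not-< c (codeg R v))))))
    where
    go : ∀ b → ((if b then 0 else 2) <ᵇ 2) ≡ not (not b)
    go true  = refl
    go false = refl

  Closed : VSet → ℕ → Set
  Closed R c = ∀ u v → u < n → v < n → above R c u ≡ true → below R c v ≡ true → E u v ≡ false

  clean⇒closed : ∀ R c → faults (cutF R c 0 0 0) ≡ 0 → Closed R (suc c)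
  clean⇒closed R c z u v p q a b =
    no-fault-no-arc (cutF R c 0 0 0) z u v p q (trans (right-0 R c u p) a) (trans (left-0 R c v q) b)

  closed⇒clean : ∀ R c → Closed R (suc c) → faults (cutF R c 0 0 0) ≡ 0
  closed⇒clean R c cl = #-zero _ (λ v p → ≢true (λ z → fault v p (trans (sym (left-0 R c v p)) (∧-left z)) (∧-right {left (cutF R c 0 0 0) v} z)))
    where
    fault : ∀ v → v < n → below R (suc c) v ≡ true → (0 <ᵇ pressure (cutF R c 0 0 0) v) ≡ true → ⊥
    fault v p b z with #-pos (λ u → right (cutF R c 0 0 0) u ∧ E u v) (<ᵇ-true {0} z)
    ... | u , q , r = true≢false (∧-right {right (cutF R c 0 0 0) u} r) (cl u v q p (trans (sym (right-0 R c u q)) (∧-left r)) b)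

  -- Here m is the number of thresholds examined so far, and l and s describe the last accepted cut.
  -- The field `sound` is for soundness; `maximal` is for completeness and says that every later
  -- faultless cut is out of reach of a block of ℓ vertices.
  record Scanned (R : VSet) (m l s : ℕ) : Set where
    field
      size    : s ≡ # (below R l)
      closed  : Closed R l
      l≤m     : l ≤ m
      maximal : ∀ c → c < m → l ≤ c → faults (cutF R c 0 0 0) ≡ 0 → s + ℓ < # (below R (suc c))
      sound   : ∀ {κ} → Solvable (above R l) κ → Solvable R κ

  scanned : ∀ R m → Scanned R m (proj₁ (scan R m)) (proj₂ (scan R m))
  scanned R zero = record
    { size = sym (#-zero (below R 0) (λ v _ → ≢true (λ z → case0 (codeg R v) (∧-right {R v} z))))
    ; closed = λ u v _ _ _ b → ⊥-elim (case0 (codeg R v) (∧-right {R v} b))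
    ; l≤m = z≤n ; maximal = λ _ ()
    ; sound = Solvable-mono (λ v p r → ∧-intro r (cong not (≢true {codeg R v <ᵇ 0} (case0 (codeg R v))))) ≤-refl }
    where
    case0 : ∀ x → (x <ᵇ 0) ≡ true → ⊥
    case0 x ()
  scanned R (suc c) with true-or-false (free R c (proj₂ (scan R c)))
  ... | inj₂ f rewrite f = record
    { size = size ; closed = closed ; l≤m = m≤n⇒m≤1+n l≤m ; sound = sound
    ; maximal = λ d p q z → go d (m<1+n⇒m<n∨m≡n p) q z }
    where
    open Scanned (scanned R c)
    go : ∀ d → d < c ⊎ d ≡ c → proj₁ (scan R c) ≤ d → faults (cutF R d 0 0 0) ≡ 0 → proj₂ (scan R c) + ℓ < # (below R (suc d))
    go d (inj₁ p) q z = maximal d p q z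
    go d (inj₂ refl) q z = ≰⇒> (λ le → true≢false (∧-intro (cong (_≡ᵇ 0) z)
      (<ᵇ-intro (s≤s (subst (_≤ proj₂ (scan R d) + ℓ) (sum-cong n (λ v p → cong b2n (sym (left-0 R d v p)))) le)))) f)
  ... | inj₁ f rewrite f = record
    { size = sum-cong n (λ v p → cong b2n (left-0 R c v p)) ; closed = closed′ ; l≤m = ≤-refl
    ; maximal = λ d p q _ → ⊥-elim (<⇒≱ p q) ; sound = λ {κ} s → sound (extend s) }
    where
    open Scanned (scanned R c)
    l = proj₁ (scan R c)
    closed′ = clean⇒closed R c (≡ᵇ0 (∧-left f))
    block : VSet
    block v = above R l v ∧ (codeg R v <ᵇ suc c)
    block-size : # block ≤ ℓ
    block-size = +-cancelˡ-≤ (proj₂ (scan R c)) _ _ (≤-trans (≤-reflexive (trans (cong (_+ # block) size) (sym (sum-+ n _ _))))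
      (≤-trans (sum-mono n pointwise) (s≤s⁻¹ (<ᵇ-true (∧-right {faults (cutF R c 0 0 0) ≡ᵇ 0} f)))))
      where
      pointwise : ∀ v → v < n → b2n (below R l v) + b2n (block v) ≤ b2n (left (cutF R c 0 0 0) v)
      pointwise v p rewrite left-0 R c v p with R v | true-or-false (codeg R v <ᵇ l)
      ... | false | _ = z≤n
      ... | true  | inj₂ z rewrite z = ≤-refl
      ... | true  | inj₁ z rewrite z | <ᵇ-intro {codeg R v} {suc c} (≤-trans (<ᵇ-true {codeg R v} z) (m≤n⇒m≤1+n l≤m)) = ≤-refl
    extend : ∀ {κ} → Solvable (above R (suc c)) κ → Solvable (above R l) κ
    extend {κ} s = Solvable-mono (λ _ _ z → z) (≤-reflexive (trans (cong (κ +_) (cong₂ _+_ nothing (m≤n⇒m∸n≡0 block-size))) (+-identityʳ κ)))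
      (Solvable-cut block (λ v p z → ∧-left z) incl
        (λ v p z → ≢true (λ y → true≢false (∧-right {above R l v} z) (not-elim (∧-right {R v} y))))
        (λ u v p q a b → closed′ u v p q a (∧-intro (∧-left {R v} (∧-left b)) (∧-right {above R l v} b))) s)
      where
      incl : above R (suc c) ⊆[ n ] above R l
      incl v p z = ∧-intro (∧-left z) (not-intro (<ᵇ-elimF (≤-trans (m≤n⇒m≤1+n l≤m) (<ᵇ-false {codeg R v} (not-elim (∧-right {R v} z))))))
      nothing : # (λ v → above R l v ∧ (not (block v) ∧ not (above R (suc c) v))) ≡ 0
      nothing = #-zero _ (λ v p → go v)
        where
        go : ∀ v → above R l v ∧ (not (block v) ∧ not (above R (suc c) v)) ≡ false
        go v with R v | codeg R v <ᵇ l | codeg R v <ᵇ suc c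
        ... | false | _     | _     = refl
        ... | true  | true  | _     = refl
        ... | true  | false | true  = refl
        ... | true  | false | false = refl

  strip-sound : ∀ {R κ} → Solvable (stripF R) κ → Solvable R κ
  strip-sound {R} = Scanned.sound (scanned R (suc n))

  strip-⊆ : ∀ R → stripF R ⊆[ n ] R
  strip-⊆ R v p z = ∧-left z

  -- The size may exceed c because boundary vertices of the set aimed at may stay on the left, but
  -- by no more than b. The lower bound makes the reported c a lower bound for the size of an actual
  -- cut.
  sweep-ok : VSet → (b m h h′ c : ℕ) → Bool
  sweep-ok R b m h h′ c =
    (faults st ≡ᵇ 0) ∧ ((# (gone st) <ᵇ suc m) ∧ ((c <ᵇ suc (# (left st))) ∧ (# (left st) <ᵇ suc (c + b))))
    where st = cutF R c b h h′

  best : VSet → (b m h h′ c : ℕ) → ℕ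
  best R b m h h′ zero    = 0
  best R b m h h′ (suc c) = if sweep-ok R b m h h′ c then c else best R b m h h′ c

  -- The size of the cut that is tried: h, h′ and m determine a size up to an
  -- error of 2 b, which off corrects; m = suc b stands for a size near ℓ.
  centre : VSet → (b m off h h′ : ℕ) → ℕ
  centre R b m off h h′ = (if m ≡ᵇ suc b then ℓ else best R b m h h′ (suc ℓ ∸ 2 * b)) + off ∸ 2 * b

  -- Vertices on the left beyond ℓ have to be deleted too, so they are charged as well.
  accept : Status → ℕ → Bool
  accept st b = (faults st ≡ᵇ 0) ∧ (# (gone st) + (# (left st) ∸ ℓ) <ᵇ suc b)

  -- Keeping R after a rejection is sound: the budget grows by b and nothing is deleted.
  payF : VSet → (b m off h h′ i i′ : ℕ) → VSet
  payF R b m off h h′ i i′ v = if accept st b then right st v else R v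
    where st = cutF R (centre R b m off h h′) b i i′

  pay-sound : ∀ R b m off h h′ i i′ {κ} → Solvable (payF R b m off h h′ i i′) κ → Solvable R (κ + b)
  pay-sound R b m off h h′ i i′ {κ} s with true-or-false (accept (cutF R (centre R b m off h h′) b i i′) b)
  ... | inj₂ z = Solvable-mono (λ v p r → trans (cong (λ x → if x then right st v else R v) z) r) (m≤m+n κ b) s
    where st = cutF R (centre R b m off h h′) b i i′
  ... | inj₁ z = Solvable-mono (λ _ _ r → r) (+-monoʳ-≤ κ (s≤s⁻¹ (<ᵇ-true (∧-right {faults st ≡ᵇ 0} z))))
                   (cut-sound (WF-cutF R (centre R b m off h h′) b i i′) (≡ᵇ0 (∧-left z))
                     (Solvable-mono (λ v p r → trans (cong (λ x → if x then right st v else R v) z) r) ≤-refl s))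
    where st = cutF R (centre R b m off h h′) b i i′

  rem₁ rem₂ rem₃ rem₄ rem₅ rem₆ : ℕ → ℕ → ℕ
  rem₁ b g = ⟦ div ⟧ g (b + 2)
  rem₂ b g = ⟦ div ⟧ (rem₁ b g) (4 * b + 1)
  rem₃ b g = ⟦ div ⟧ (rem₂ b g) (2 ^ (5 * b ∸ 2))
  rem₄ b g = ⟦ div ⟧ (rem₃ b g) (2 ^ b)
  rem₅ b g = ⟦ div ⟧ (rem₄ b g) (2 ^ (5 * b ∸ 2))
  rem₆ b g = ⟦ div ⟧ (rem₅ b g) (2 ^ b)

  payD : VSet → ℕ → ℕ → VSet
  payD R b g = payF R b (⟦ mod ⟧ g (b + 2)) (⟦ mod ⟧ (rem₁ b g) (4 * b + 1))
    (⟦ mod ⟧ (rem₂ b g) (2 ^ (5 * b ∸ 2))) (⟦ mod ⟧ (rem₃ b g) (2 ^ b))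
    (⟦ mod ⟧ (rem₄ b g) (2 ^ (5 * b ∸ 2))) (⟦ mod ⟧ (rem₅ b g) (2 ^ b))

  payD-sound : ∀ R b g {κ} → Solvable (payD R b g) κ → Solvable R (κ + b)
  payD-sound R b g = pay-sound R b (⟦ mod ⟧ g (b + 2)) (⟦ mod ⟧ (rem₁ b g) (4 * b + 1))
    (⟦ mod ⟧ (rem₂ b g) (2 ^ (5 * b ∸ 2))) (⟦ mod ⟧ (rem₃ b g) (2 ^ b))
    (⟦ mod ⟧ (rem₄ b g) (2 ^ (5 * b ∸ 2))) (⟦ mod ⟧ (rem₅ b g) (2 ^ b))

  -- The remaining vertices, the number of steps since the last cut, and the
  -- advice.  A cut may delete as many vertices as steps have passed, so k steps
  -- delete at most k vertices.
  Config : Set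
  Config = VSet × (ℕ × ℕ)

  -- The argument tells whether the bit is 0. A zero saves one more unit of credit; a one spends the
  -- saved units together with that of the present step on a cut.
  tick-on : Bool → Config → Config
  tick-on true  (R , b , g) = R , suc b , g / 2
  tick-on false (R , b , g) = payD (stripF R) (suc b) (g / 2) , 0 , rem₆ (suc b) (g / 2)

  tick : Config → Config
  tick s = tick-on (proj₂ (proj₂ s) % 2 ≡ᵇ 0) s

  credit : Config → ℕ
  credit s = proj₁ (proj₂ s)

  -- After j ticks, all but the saved credit may have been used for deletions.
  Sound : VSet → ℕ → Config → Set
  Sound R₀ j s = credit s ≤ j × (∀ {κ} → Solvable (proj₁ s) κ → Solvable R₀ (κ + (j ∸ credit s)))

  tick-on-sound : ∀ x s {R₀ j} → Sound R₀ j s → Sound R₀ (suc j) (tick-on x s)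
  tick-on-sound true  s (b≤j , ih) = s≤s b≤j , ih
  tick-on-sound false (R , b , g) {R₀} {j} (b≤j , ih) = z≤n , λ {κ} s →
    subst (Solvable R₀) (trans (+-assoc κ (suc b) (j ∸ b)) (cong (κ +_) (cong suc (m+[n∸m]≡n b≤j))))
      (ih (strip-sound (payD-sound (stripF R) (suc b) (g / 2) s)))

  tick-sound : ∀ j R g → Sound R j (iterate tick j (R , 0 , g))
  tick-sound zero    R g = z≤n , λ {κ} → subst (Solvable R) (sym (+-identityʳ κ))
  tick-sound (suc j) R g = tick-on-sound (proj₂ (proj₂ (iterate tick j (R , 0 , g))) % 2 ≡ᵇ 0) (iterate tick j (R , 0 , g)) (tick-sound j R g)

  record Success (k : ℕ) (R : VSet) (g : ℕ) : Set where
    constructor success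
    field
      exhausted : # (stripF (proj₁ (iterate tick k (R , 0 , g)))) ≡ 0

  empty-solvable : ∀ R κ → # R ≡ 0 → Solvable R κ
  empty-solvable R κ z = record
    { X = λ _ → false ; ρ = λ _ → 0 ; few = ≤-trans (#-mono {R ∩ (λ _ → false)} {R} (λ v p q → ∧-left q)) (≤-trans (≤-reflexive z) z≤n)
    ; mono = λ _ _ _ _ _ _ _ _ _ → z≤n ; level = λ i → ≤-trans (#-mono {λ v → R v ∧ (0 ≡ᵇ i)} {R} (λ v p q → ∧-left q)) (≤-trans (≤-reflexive z) z≤n) }

  success-sound : ∀ k R g → Success k R g → Solvable R k
  success-sound k R g (success z) with tick-sound k R g
  ... | _ , s = Solvable-mono (λ _ _ r → r) (m∸n≤m k (credit (iterate tick k (R , 0 , g)))) (s {0} (strip-sound (empty-solvable _ 0 z)))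

  -- Existence of successful advice

  module Complete (loopless : ∀ v → v < n → E v v ≡ false)
                  (semi : ∀ u v → u < n → v < n → u ≢ v → E u v ≡ true ⊎ E v u ≡ true) where

    open Semi loopless semi

    codeg≤indeg : ∀ R v → v < n → codeg R v ≤ indeg R v + 1
    codeg≤indeg R v p = subst (codeg R v ≤_) (trans (sum-+ n _ _) (cong (indeg R v +_) (sum-δ p))) (sum-mono n pointwise)
      where
      pointwise : ∀ u → u < n → b2n (R u ∧ not (E v u)) ≤ b2n (R u ∧ E u v) + b2n (u ≡ᵇ v)
      pointwise u q with true-or-false (R u ∧ not (E v u)) | u ≟ v
      ... | inj₂ z | _ rewrite z = z≤n
      ... | inj₁ z | yes refl rewrite ≡ᵇ-refl u = ≤-trans (b2n≤1 _) (m≤n+m 1 _)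
      ... | inj₁ z | no ne = ≤-trans (b2n-mono {R u ∧ not (E v u)} {R u ∧ E u v} (λ _ → ∧-intro (∧-left {R u} z) (back-arc p q (λ x → ne (sym x)) (not-elim (∧-right {R u} z))))) (m≤m+n _ (b2n (u ≡ᵇ v)))

    -- If C had no boundary, then C together with everything stripped would be the left side of a
    -- cut of R without deletions. Such a cut is a degree cut, and as C has at most ℓ vertices, the
    -- scan would have accepted it.
    strip-no-free : ∀ R C → C ⊆[ n ] stripF R → # C ≤ ℓ → ∀ {v} → v < n → C v ≡ true → 1 ≤ # (boundary (stripF R) C)
    strip-no-free R C C⊆ C≤ℓ {v} v<n cv with # (boundary (stripF R) C) in ∂0
    ... | suc _ = s≤s z≤n
    ... | zero = ⊥-elim (decide (<-cmp′ l (# B)))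
      where
      open Scanned (scanned R (suc n))
      l = proj₁ (scan R (suc n))
      s = proj₂ (scan R (suc n))
      B : VSet
      B = C ∪ below R l
      C⊆R : ∀ u → u < n → C u ≡ true → R u ≡ true
      C⊆R u p c = ∧-left (C⊆ u p c)
      B⊆R : B ⊆[ n ] R
      B⊆R u p b with ∨-cases {C u} b
      ... | inj₁ c = C⊆R u p c
      ... | inj₂ z = ∧-left z
      outside : ∀ u → R u ≡ true → B u ≡ false → above R l u ≡ true
      outside u r b = ∧-intro r (not-intro (≢true (λ z → true≢false (∧-intro r z) (∨-falseʳ {C u} b))))
      no-in : # (boundary R B) ≡ 0
      no-in = #-zero _ (λ u p → ≢true (contra u p))
        where
        contra : ∀ u → u < n → boundary R B u ≡ true → ⊥
        contra u p z with boundary-arc R B {u} z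
        ... | w , w<n , bw , e with ∨-cases {C w} bw
        ...   | inj₂ y = true≢false e (closed u w p w<n (outside u (boundary-R R B {u} z) (boundary-∉ R B {u} z)) y)
        ...   | inj₁ c = true≢false (boundary-intro (stripF R) C (outside u (boundary-R R B {u} z) (boundary-∉ R B {u} z)) (∨-falseˡ (boundary-∉ R B {u} z)) w<n c e)
                                    (#-zero⁻¹ (boundary (stripF R) C) ∂0 u p)
      B-low : ∀ u → u < n → B u ≡ true → codeg R u ≤ # B
      B-low u p b = ≤-trans (codeg≤indeg R u p) (subst (indeg R u + 1 ≤_) (trans (cong (# B +_) no-in) (+-identityʳ _)) (indeg-C R B B⊆R u p b))
      B-high : ∀ u → u < n → R u ≡ true → B u ≡ false → # B < codeg R u
      B-high u p r b = ≤-trans (≤-reflexive (+-comm 1 _)) (codeg-Q R B B⊆R u p (rest-intro R B r b (#-zero⁻¹ (boundary R B) no-in u p)))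
      below≡B : ∀ u → u < n → below R (suc (# B)) u ≡ B u
      below≡B u p with true-or-false (B u)
      ... | inj₁ b = trans (∧-intro (B⊆R u p b) (<ᵇ-intro (s≤s (B-low u p b)))) (sym b)
      ... | inj₂ b = trans (≢true (λ z → <⇒≱ (B-high u p (∧-left z) b) (s≤s⁻¹ (<ᵇ-true {codeg R u} (∧-right {R u} z))))) (sym b)
      closedB : Closed R (suc (# B))
      closedB u w p q a b = ≢true (λ e → true≢false
        (boundary-intro R B (∧-left a) (≢true (λ bu → true≢false (∧-right {R u} (trans (below≡B u p) bu)) (not-elim (∧-right {R u} a)))) q (trans (sym (below≡B w q)) b) e)
        (#-zero⁻¹ (boundary R B) no-in u p))
      decide : l ≤ # B ⊎ # B < l → ⊥
      -- A vertex of C has survived the stripping, so its codegree is at least l, but all codegrees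
      -- in B are at most |B|.
      decide (inj₂ gt) = true≢false (<ᵇ-intro (≤-<-trans (B-low v v<n (cong (_∨ below R l v) cv)) gt)) (not-elim (∧-right {R v} (C⊆ v v<n cv)))
      decide (inj₁ le) = <⇒≱ (maximal (# B) (s≤s (#≤n B)) le (closed⇒clean R (# B) closedB)) (begin
        # (below R (suc (# B)))  ≡⟨ sum-cong n (λ u p → cong b2n (below≡B u p)) ⟩
        # B                      ≤⟨ sum-mono n (λ u _ → b2n-∨ (C u) (below R l u)) ⟩
        sum n (λ u → b2n (below R l u) + b2n (C u)) ≡⟨ sum-+ n _ _ ⟩
        # (below R l) + # C      ≤⟨ +-mono-≤ (≤-reflexive (sym size)) C≤ℓ ⟩
        s + ℓ                    ∎)
        where
        open ≤-Reasoning
        b2n-∨ : ∀ x y → b2n (x ∨ y) ≤ b2n y + b2n x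
        b2n-∨ true  y = m≤n+m 1 (b2n y)
        b2n-∨ false y = m≤m+n _ 0
      <-cmp′ : ∀ x y → x ≤ y ⊎ y < x
      <-cmp′ x y with x ≤? y
      ... | yes p = inj₁ p
      ... | no  p = inj₂ (≰⇒> p)

    rest-∪-⊆ : ∀ R A D → rest R (A ∪ D) ⊆[ n ] rest R A
    rest-∪-⊆ R A D v p z = rest-intro R A (rest-R R (A ∪ D) {v} z) (∨-falseˡ (rest-∉ R (A ∪ D) {v} z)) (≢true contra)
      where
      contra : boundary R A v ≡ true → ⊥
      contra b with boundary-arc R A {v} b
      ... | w , w<n , aw , e = true≢false e (rest-no-arc R (A ∪ D) {v} z w<n (cong (_∨ D w) aw))

    -- D is an actual cut behind the size c that the sweep reports. The last field leaves room for
    -- enlarging D: with a boundary of at most b vertices added, it still has at most c + 2 b ≤ ℓ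
    -- vertices.
    record Found (R : VSet) (b m c : ℕ) : Set where
      field
        D    : VSet
        D⊆R  : D ⊆[ n ] R
        ∂≤m  : # (boundary R D) ≤ m
        c≤D  : c ≤ # D
        D≤   : # D ≤ c + b
        c≤ℓ  : c + 2 * b ≤ ℓ

    best-found : ∀ R b m h h′ c → 2 * b ≤ ℓ → c ≤ suc ℓ ∸ 2 * b → Found R b m (best R b m h h′ c)
    -- The default value 0 is backed by the empty set.
    best-found R b m h h′ zero 2b≤ℓ _ = record
      { D = λ _ → false ; D⊆R = λ _ _ () ; ∂≤m = ≤-trans (≤-reflexive (#-zero _ (λ v p → ≢true (contra v)))) z≤n
      ; c≤D = z≤n ; D≤ = ≤-trans (≤-reflexive (sum-zero n)) z≤n ; c≤ℓ = 2b≤ℓ }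
      where
      contra : ∀ v → boundary R (λ _ → false) v ≡ true → ⊥
      contra v z with boundary-arc R (λ _ → false) {v} z
      ... | _ , _ , () , _
    best-found R b m h h′ (suc c) 2b≤ℓ q with true-or-false (sweep-ok R b m h h′ c)
    ... | inj₂ z rewrite z = best-found R b m h h′ c 2b≤ℓ (≤-trans (n≤1+n c) q)
    ... | inj₁ z rewrite z = record
      { D = left st ; D⊆R = left-R w
      ; ∂≤m = ≤-trans (#-mono (∂-left w (≡ᵇ0 (∧-left z)))) (s≤s⁻¹ (<ᵇ-true (∧-left z₁)))
      ; c≤D = s≤s⁻¹ (<ᵇ-true {c} (∧-left z₂)) ; D≤ = s≤s⁻¹ (<ᵇ-true (∧-right {c <ᵇ suc (# (left st))} z₂))
      ; c≤ℓ = s≤s⁻¹ (m≤o∸n⇒m+n≤o (suc c) (m≤n⇒m≤1+n 2b≤ℓ) q) }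
      where
      st = cutF R c b h h′
      w = WF-cutF R c b h h′
      z₁ = ∧-right {faults st ≡ᵇ 0} z
      z₂ = ∧-right {# (gone st) <ᵇ suc m} z₁

    best-≥ : ∀ R b m h h′ {a} → ∀ c → a < c → sweep-ok R b m h h′ a ≡ true → a ≤ best R b m h h′ c
    best-≥ R b m h h′ {a} (suc c) p ok with true-or-false (sweep-ok R b m h h′ c) | m<1+n⇒m<n∨m≡n p
    ... | inj₁ z | _ rewrite z = s≤s⁻¹ p
    ... | inj₂ z | inj₁ q rewrite z = best-≥ R b m h h′ c q ok
    ... | inj₂ z | inj₂ refl = ⊥-elim (true≢false ok z)

    record Paid (R : VSet) (b κ : ℕ) : Set where
      field
        m off h h′ i i′ : ℕ
        m<   : m < b + 2
        off< : off < 4 * b + 1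
        h<   : h < 2 ^ (5 * b ∸ 2)
        h′<  : h′ < 2 ^ b
        i<   : i < 2 ^ (5 * b ∸ 2)
        i′<  : i′ < 2 ^ b
        solvable : Solvable (payF R b m off h h′ i i′) κ

    -- The cut that is paid for may be any with at most b deletions whose rest is contained in the
    -- rest of C, because a solution is inherited by subsets.
    pay-complete : ∀ {R κ} C b → C ⊆[ n ] R → # C ≤ ℓ → # (boundary R C) ≤ b → 1 ≤ b → Solvable (rest R C) κ → Paid R b κ
    pay-complete {R} {κ} C b C⊆R C≤ℓ ∂≤b 1≤b sol = by-size (ℓ <? # C + 2 * b)
      where
      base : (m h h′ : ℕ) → ℕ
      base m h h′ = if m ≡ᵇ suc b then ℓ else best R b m h h′ (suc ℓ ∸ 2 * b)

      -- Once m, h, h′ and off reproduce the size of A, a second pair of strings leads to the cut A.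
      aim : ∀ m h h′ off (A : VSet) → m < b + 2 → h < 2 ^ (5 * b ∸ 2) → h′ < 2 ^ b → off ≤ 4 * b →
            base m h h′ + off ≡ # A + 2 * b → A ⊆[ n ] R → # A ≤ ℓ → # (boundary R A) ≤ b → rest R A ⊆[ n ] rest R C → Paid R b κ
      aim m h h′ off A m< h< h′< off≤ aimed A⊆R A≤ℓ ∂A≤b incl = strike (cut-complete R A A⊆R b ∂A≤b 1≤b)
        where
        strike : ∃[ i ] ∃[ i′ ] (i < 2 ^ (5 * b ∸ 2) × i′ < 2 ^ b × Hit R A A⊆R b (cutF R (# A) b i i′)) → Paid R b κ
        strike (i , i′ , i< , i′< , hit) = record
          { m = m ; off = off ; h = h ; h′ = h′ ; i = i ; i′ = i′
          ; m< = m< ; off< = ≤-trans (s≤s off≤) (≤-reflexive (+-comm 1 _)) ; h< = h< ; h′< = h′< ; i< = i< ; i′< = i′<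
          ; solvable = Solvable-mono (λ v p z → incl v p (right⊆ v p (trans (sym (cong (λ x → if x then right st v else R v) accepted)) (subst (λ c → paid c v ≡ true) centred z)))) ≤-refl sol }
          where
          open Hit hit
          st = cutF R (# A) b i i′
          paid : ℕ → VSet
          paid c v = if accept (cutF R c b i i′) b then right (cutF R c b i i′) v else R v
          centred : centre R b m off h h′ ≡ # A
          centred = trans (cong (_∸ 2 * b) aimed) (m+n∸n≡m (# A) (2 * b))
          accepted : accept st b ≡ true
          accepted = ∧-intro (cong (_≡ᵇ 0) clean) (<ᵇ-intro (s≤s small))
            where
            -- If the left side is larger than ℓ, the bound on left and deleted vertices together
            -- applies, and |A| + |∂A| ≤ ℓ + b.
            small : # (gone st) + (# (left st) ∸ ℓ) ≤ b
            small with ≤-total (# (left st)) ℓ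
            ... | inj₁ p rewrite m≤n⇒m∸n≡0 p = ≤-trans (≤-reflexive (+-identityʳ _)) (≤-trans gone≤ ∂A≤b)
            ... | inj₂ p = +-cancelˡ-≤ ℓ _ _ (begin
              ℓ + (# (gone st) + (# (left st) ∸ ℓ)) ≡⟨ trans (sym (+-assoc ℓ _ _)) (trans (cong (_+ (# (left st) ∸ ℓ)) (+-comm ℓ _)) (+-assoc (# (gone st)) ℓ _)) ⟩
              # (gone st) + (ℓ + (# (left st) ∸ ℓ)) ≡⟨ cong (# (gone st) +_) (m+[n∸m]≡n p) ⟩
              # (gone st) + # (left st)             ≡⟨ +-comm (# (gone st)) _ ⟩
              # (left st) + # (gone st)             ≤⟨ total≤ ⟩
              # A + # (boundary R A)                ≤⟨ +-mono-≤ A≤ℓ ∂A≤b ⟩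
              ℓ + b                                 ∎)
              where open ≤-Reasoning

      base-best : ∀ m h h′ → m ≤ b → base m h h′ ≡ best R b m h h′ (suc ℓ ∸ 2 * b)
      base-best m h h′ p rewrite ≡ᵇ-false {m} {suc b} (<⇒≢ (s≤s p)) = refl

      -- Instead of a subset A of minimal boundary, any A is taken; it is replaced
      -- by C ∩ D when the boundary of C ∩ D turns out to be smaller.
      search : # C + 2 * b ≤ ℓ → ∀ f m A → m ≤ f → m ≤ b → A ⊆[ n ] C → # C ≤ # A + b → # (boundary R A) ≤ m → Paid R b κ
      search fits f m A m≤f m≤b A⊆C C≤A ∂A≤m = refine (cut-complete R A A⊆R b (≤-trans ∂A≤m m≤b) 1≤b)
        where
        A⊆R : A ⊆[ n ] R
        A⊆R v p z = C⊆R v p (A⊆C v p z)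
        refine : ∃[ h ] ∃[ h′ ] (h < 2 ^ (5 * b ∸ 2) × h′ < 2 ^ b × Hit R A A⊆R b (cutF R (# A) b h h′)) → Paid R b κ
        refine (h , h′ , h< , h′< , hit) = near-or-far (c₀ <? # C + b)
          where
          open Hit hit
          st = cutF R (# A) b h h′
          c₀ = best R b m h h′ (suc ℓ ∸ 2 * b)
          2b≤ℓ : 2 * b ≤ ℓ
          2b≤ℓ = ≤-trans (m≤n+m (2 * b) (# C)) fits
          ok : sweep-ok R b m h h′ (# A) ≡ true
          ok = ∧-intro (cong (_≡ᵇ 0) clean) (∧-intro (<ᵇ-intro (s≤s (≤-trans gone≤ ∂A≤m)))
                 (∧-intro (<ᵇ-intro (s≤s (#-mono C⊆left))) (<ᵇ-intro (s≤s (≤-trans (m≤m+n _ (# (gone st))) (≤-trans total≤ (+-monoʳ-≤ (# A) (≤-trans ∂A≤m m≤b))))))))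
          -- A itself passes the test of the sweep at its own size, so the largest size that passes
          -- is no smaller.
          A≤c₀ : # A ≤ c₀
          A≤c₀ = best-≥ R b m h h′ (suc ℓ ∸ 2 * b) (m+n≤o⇒m≤o∸n (suc (# A)) (s≤s (≤-trans (+-monoˡ-≤ (2 * b) (#-mono A⊆C)) fits))) ok
          open Found (best-found R b m h h′ (suc ℓ ∸ 2 * b) 2b≤ℓ ≤-refl)
          m<b+2 : m < b + 2
          m<b+2 = ≤-trans (s≤s m≤b) (≤-trans (≤-reflexive (+-comm 1 b)) (+-monoʳ-≤ b (s≤s z≤n)))
          offset : ∀ x → c₀ ≤ x + 2 * b → x ≤ c₀ + 2 * b → let off = x + 2 * b ∸ c₀ in off ≤ 4 * b × base m h h′ + off ≡ x + 2 * b
          -- The number off encodes x - c₀ + 2 b; errors between -2 b and 2 b thus become offsets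
          -- from 0 to 4 b.
          offset x p q = m≤n+o⇒m∸n≤o _ c₀ (≤-trans (+-monoˡ-≤ (2 * b) q) (≤-reflexive (trans (+-assoc c₀ (2 * b) (2 * b)) (cong (c₀ +_) (sym (*-distribʳ-+ b 2 2))))))
                       , trans (cong (_+ (x + 2 * b ∸ c₀)) (base-best m h h′ m≤b)) (m+[n∸m]≡n p)
          near-or-far : Dec (c₀ < # C + b) → Paid R b κ
          near-or-far (yes near) = aim m h h′ _ C m<b+2 h< h′< (proj₁ o) (proj₂ o) C⊆R C≤ℓ ∂≤b (λ _ _ z → z)
            where o = offset (# C) (≤-trans (<⇒≤ near) (+-monoʳ-≤ (# C) (m≤m+n b _))) (≤-trans C≤A (+-mono-≤ A≤c₀ (m≤m+n b _)))
          near-or-far (no ¬near) = by-boundary f m≤f (# (boundary R (C ∩ D)) <? m)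
            where
            far : # C + b ≤ c₀
            far = ≮⇒≥ ¬near
            -- A vertex to the right of D has all of D as in-neighbours. Since |D| ≥ |C| + b, these
            -- are too many for a vertex of C.
            C⊆D∂ : ∀ v → v < n → C v ≡ true → D v ≡ true ⊎ boundary R D v ≡ true
            C⊆D∂ v p c with classify R D v
            ... | inj₁ r = ⊥-elim (true≢false (C⊆R v p c) r)
            ... | inj₂ (inj₁ d) = inj₁ d
            ... | inj₂ (inj₂ (inj₁ d)) = inj₂ d
            ... | inj₂ (inj₂ (inj₂ r)) = ⊥-elim (<-irrefl refl (begin-strict
              # D              ≤⟨ indeg-lower R D D⊆R v p (rest-∉ R D {v} r) (λ u q → rest-no-arc R D {v} r q) ⟩
              indeg R v        <⟨ ≤-reflexive (+-comm 1 _) ⟩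
              indeg R v + 1    ≤⟨ indeg-C R C C⊆R v p c ⟩
              # C + # (boundary R C) ≤⟨ +-monoʳ-≤ (# C) ∂≤b ⟩
              # C + b          ≤⟨ far ⟩
              c₀               ≤⟨ c≤D ⟩
              # D              ∎))
              where open ≤-Reasoning
            I = C ∩ D
            C≤I : # C ≤ # I + # (boundary R D)
            C≤I = subst (# C ≤_) (sum-+ n _ _) (sum-mono n pointwise)
              where
              pointwise : ∀ v → v < n → b2n (C v) ≤ b2n (I v) + b2n (boundary R D v)
              pointwise v p with true-or-false (C v)
              ... | inj₂ z = subst (λ x → b2n x ≤ b2n (I v) + b2n (boundary R D v)) (sym z) z≤n
              ... | inj₁ z with C⊆D∂ v p z
              ...   | inj₁ d = ≤-trans (b2n-mono (λ _ → ∧-intro z d)) (m≤m+n _ _)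
              ...   | inj₂ d = ≤-trans (b2n-mono (λ _ → d)) (m≤n+m _ _)
            union-size : # (C ∪ D) ≤ # D + # (boundary R D)
            union-size = subst (# (C ∪ D) ≤_) (sum-+ n _ _) (sum-mono n pointwise)
              where
              pointwise : ∀ v → v < n → b2n ((C ∪ D) v) ≤ b2n (D v) + b2n (boundary R D v)
              pointwise v p with true-or-false (D v) | true-or-false (C v)
              ... | inj₁ d | _ = ≤-trans (b2n-mono (λ _ → d)) (m≤m+n _ _)
              ... | inj₂ d | inj₂ c = subst (λ x → b2n x ≤ b2n (D v) + b2n (boundary R D v)) (sym (cong₂ _∨_ c d)) z≤n
              ... | inj₂ d | inj₁ c with C⊆D∂ v p c
              ...   | inj₁ d′ = ⊥-elim (true≢false d′ d)
              ...   | inj₂ d′ = ≤-trans (b2n-mono (λ _ → d′)) (m≤n+m _ (b2n (D v)))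
            c+2b≡ : ∀ x → x + b + b ≡ x + 2 * b
            c+2b≡ x = trans (+-assoc x b b) (cong (λ y → x + (b + y)) (sym (+-identityʳ b)))
            U≤ : # (C ∪ D) ≤ c₀ + 2 * b
            U≤ = ≤-trans union-size (≤-trans (+-mono-≤ D≤ (≤-trans ∂≤m m≤b)) (≤-reflexive (c+2b≡ c₀)))
            by-boundary : ∀ f → m ≤ f → Dec (# (boundary R I) < m) → Paid R b κ
            by-boundary f m≤f (no ¬sm) = aim m h h′ _ (C ∪ D) m<b+2 h< h′< (proj₁ o) (proj₂ o) union⊆R (≤-trans U≤ c≤ℓ) ∂U≤b (rest-∪-⊆ R C D)
              where
              o = offset (# (C ∪ D)) (≤-trans c≤D (≤-trans (#-mono (λ v p z → subst (λ x → x ∨ D v ≡ true) refl (∨-right z))) (m≤m+n _ _))) U≤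
                where
                ∨-right : ∀ {x y} → y ≡ true → x ∨ y ≡ true
                ∨-right {true}  _ = refl
                ∨-right {false} z = z
              union⊆R : (C ∪ D) ⊆[ n ] R
              union⊆R v p z with ∨-cases {C v} z
              ... | inj₁ c = C⊆R v p c
              ... | inj₂ d = D⊆R v p d
              -- The boundary of C ∩ D has at least m vertices and that of D at most m, so m cancels
              -- in the submodular inequality.
              ∂U≤b : # (boundary R (C ∪ D)) ≤ b
              ∂U≤b = +-cancelʳ-≤ m _ _ (≤-trans (+-monoʳ-≤ (# (boundary R (C ∪ D))) (≮⇒≥ ¬sm)) (≤-trans (∂-submodular R C D) (+-mono-≤ ∂≤b ∂≤m)))
            by-boundary zero   z≤n (yes sm) = ⊥-elim (<⇒≱ sm z≤n)
            -- C ∩ D takes the place of A: it misses at most |∂D| ≤ b vertices of C, and its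
            -- boundary is strictly smaller, so the fuel f suffices.
            by-boundary (suc f) q  (yes sm) = search fits f (# (boundary R I)) I (s≤s⁻¹ (≤-trans sm q)) (≤-trans (<⇒≤ sm) m≤b) (λ v p z → ∧-left z) (≤-trans C≤I (+-monoʳ-≤ (# I) (≤-trans ∂≤m m≤b))) ≤-refl

      by-size : Dec (ℓ < # C + 2 * b) → Paid R b κ
      -- The marker m = b + 1 makes ℓ the reference size, from which |C| differs by less than 2 b.
      by-size (yes large) = aim (suc b) 0 0 (# C + 2 * b ∸ ℓ) C (≤-reflexive (+-comm 2 b)) (m^n>0 2 (5 * b ∸ 2)) (m^n>0 2 b)
        (≤-trans (m≤n+o⇒m∸n≤o _ ℓ (+-monoˡ-≤ (2 * b) C≤ℓ)) (*-monoˡ-≤ b {2} {4} (s≤s (s≤s z≤n))))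
        (trans (cong (λ x → (if x then ℓ else best R b (suc b) 0 0 (suc ℓ ∸ 2 * b)) + (# C + 2 * b ∸ ℓ)) (≡ᵇ-refl b)) (m+[n∸m]≡n (<⇒≤ large)))
        C⊆R C≤ℓ ∂≤b (λ _ _ z → z)
      by-size (no ¬large) = search (≮⇒≥ ¬large) b b C ≤-refl ≤-refl (λ _ _ z → z) (m≤m+n _ b) ∂≤b

    tick-even : ∀ R b g {g′} → g % 2 ≡ 0 → g / 2 ≡ g′ → tick (R , b , g) ≡ (R , suc b , g′)
    tick-even R b g p refl = cong (λ x → tick-on (x ≡ᵇ 0) (R , b , g)) p

    tick-odd : ∀ R b g {g′} → g % 2 ≡ 1 → g / 2 ≡ g′ → tick (R , b , g) ≡ (payD (stripF R) (suc b) g′ , 0 , rem₆ (suc b) g′)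
    tick-odd R b g p refl = cong (λ x → tick-on (x ≡ᵇ 0) (R , b , g)) p

    -- Zero bits only raise the credit. A cut with b deletions is therefore announced by b - 1 zeros
    -- and a one.
    wait : ∀ d i R b g → iterate tick (d + i) (R , b , g * 2 ^ d) ≡ iterate tick i (R , d + b , g)
    wait zero    i R b g = cong (λ x → iterate tick i (R , b , x)) (*-identityʳ g)
    wait (suc d) i R b g = begin
      tick (iterate tick (d + i) s)                  ≡⟨ sym (iterate-shift tick (d + i) s) ⟩
      iterate tick (d + i) (tick s)                  ≡⟨ cong (iterate tick (d + i)) idle ⟩
      iterate tick (d + i) (R , suc b , g * 2 ^ d)   ≡⟨ wait d i R (suc b) g ⟩
      iterate tick i (R , d + suc b , g)             ≡⟨ cong (λ x → iterate tick i (R , x , g)) (+-suc d b) ⟩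
      iterate tick i (R , suc d + b , g)             ∎
      where
      open ≡-Reasoning
      s = R , b , g * 2 ^ suc d
      even : g * 2 ^ suc d ≡ g * 2 ^ d * 2
      even = trans (cong (g *_) (*-comm 2 (2 ^ d))) (sym (*-assoc g (2 ^ d) 2))
      idle : tick s ≡ (R , suc b , g * 2 ^ d)
      idle = trans (cong (λ x → tick (R , b , x)) even) (tick-even R b (g * 2 ^ d * 2) (bit-%2 false (g * 2 ^ d)) (bit-/2 false (g * 2 ^ d)))

    -- The order of quantifiers matters: R′ is fixed before the continuation g′, because g′ is
    -- obtained from the induction hypothesis for R′.
    advise : ∀ {R b κ} → Paid R b κ → ∃[ R′ ] (Solvable R′ κ × (∀ g′ N → g′ < N →
             ∃[ g ] (rem₆ b g ≡ g′ × payD R b g ≡ R′ × g < advice-bound b N)))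
    advise {R} {b} paid = payF R b m off h h′ i i′ , solvable , build
      where
      open Paid paid
      apply : ∀ {m₁ m₂ o₁ o₂ h₁ h₂ k₁ k₂ i₁ i₂ j₁ j₂} → m₁ ≡ m₂ → o₁ ≡ o₂ → h₁ ≡ h₂ → k₁ ≡ k₂ → i₁ ≡ i₂ → j₁ ≡ j₂ →
              payF R b m₁ o₁ h₁ k₁ i₁ j₁ ≡ payF R b m₂ o₂ h₂ k₂ i₂ j₂
      apply refl refl refl refl refl refl = refl
      build : ∀ g′ N → g′ < N → ∃[ g ] (rem₆ b g ≡ g′ × payD R b g ≡ payF R b m off h h′ i i′ × g < advice-bound b N)
      build g′ N p =
        let g , g< , e , e₁ , e₂ , e₃ , e₄ , e₅ , e₆ =
              mixed-radix (b + 2) (4 * b + 1) (2 ^ (5 * b ∸ 2)) (2 ^ b) (2 ^ (5 * b ∸ 2)) (2 ^ b) m< off< h< h′< i< i′< p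
        in g , e , apply e₁ e₂ e₃ e₄ e₅ e₆ , g<

    advice-size : ∀ b j {g} → g < advice-bound (suc b) (2 ^ (15 * j)) → (1 + g * 2) * 2 ^ b < 2 ^ (15 * (b + suc j))
    advice-size b j {g} p = subst (λ e → (1 + g * 2) * 2 ^ b < 2 ^ e) exponent
      (<-≤-trans (scaled e₂ (<-≤-trans p (mixed-size (b + 2) (b + 3) (5 * suc b ∸ 2) (suc b) (15 * j) (small₁ b) (small₂ b) ≤-refl)))
                 -- The digits and waiting bits add up to 15 (b + 1) - 1 + 15 j; one spare bit gives
                 -- a multiple of 15.
                 (^-monoʳ-≤ 2 (n≤1+n (suc e₂ + b))))
      where
      open ≤-Reasoning
      open +-*-Solver
      e₁ e₂ : ℕ
      e₁ = 5 * suc b ∸ 2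
      e₂ = (b + 2) + ((b + 3) + (e₁ + (suc b + (e₁ + (suc b + 15 * j)))))
      scaled : ∀ e → g < 2 ^ e → (1 + g * 2) * 2 ^ b < 2 ^ (suc e + b)
      scaled e q = <-≤-trans (*-monoˡ-< (2 ^ b) {{m^n≢0 2 b}} (bit-bound true {g} {e} q)) (≤-reflexive (sym (^-distribˡ-+-* 2 (suc e) b)))
      five : e₁ ≡ 5 * b + 3
      five = trans (cong (_∸ 2) (solve 1 (λ b → con 5 :* (con 1 :+ b) := con 5 :* b :+ con 3 :+ con 2) refl b)) (m+n∸n≡m (5 * b + 3) 2)
      small₁ : ∀ b → suc b + 2 ≤ 2 ^ (b + 2)
      small₁ zero    = s≤s (s≤s (s≤s z≤n))
      small₁ (suc b) = ≤-trans (+-mono-≤ {1} (m^n>0 2 (b + 2)) (small₁ b)) (≤-reflexive (cong (2 ^ (b + 2) +_) (sym (+-identityʳ _))))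
      small₂ : ∀ b → 4 * suc b + 1 ≤ 2 ^ (b + 3)
      small₂ zero    = s≤s (s≤s (s≤s (s≤s (s≤s z≤n))))
      small₂ (suc b) = begin
        4 * suc (suc b) + 1     ≡⟨ solve 1 (λ b → con 4 :* (con 2 :+ b) :+ con 1 := con 4 :+ (con 4 :* (con 1 :+ b) :+ con 1)) refl b ⟩
        4 + (4 * suc b + 1)     ≤⟨ +-mono-≤ (≤-trans (s≤s (s≤s (s≤s (s≤s z≤n)))) (^-monoʳ-≤ 2 {3} (m≤n+m 3 b))) (small₂ b) ⟩
        2 ^ (b + 3) + 2 ^ (b + 3) ≡⟨ cong (2 ^ (b + 3) +_) (sym (+-identityʳ _)) ⟩
        2 ^ (suc b + 3)         ∎
      exponent : suc (suc e₂ + b) ≡ 15 * (b + suc j)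
      exponent = trans (cong (λ e → suc (suc ((b + 2) + ((b + 3) + (e + (suc b + (e + (suc b + 15 * j))))) + b))) five)
        (solve 2 (λ b j → con 2 :+ ((b :+ con 2) :+ ((b :+ con 3) :+ ((con 5 :* b :+ con 3) :+ ((con 1 :+ b) :+ ((con 5 :* b :+ con 3) :+ ((con 1 :+ b) :+ con 15 :* j))))) :+ b)
                        := con 15 :* (b :+ (con 1 :+ j))) refl b j)

    idle-run : ∀ j R b → proj₁ (iterate tick j (R , b , 0)) ≡ R
    idle-run j R b = trans (cong (λ i → proj₁ (iterate tick i (R , b , 0))) (sym (+-identityʳ j))) (cong proj₁ (wait j 0 R b 0))

    module _ (1≤ℓ : 1 ≤ ℓ) where

      -- After stripping, the first cut has a nonempty boundary. Each cut thus uses up at least one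
      -- tick, and the recursion, bounded by the fuel f, continues with fewer ticks. When nothing is
      -- left, the remaining ticks pass with zero advice.
      success-complete : ∀ f j R κ → j ≤ f → κ ≤ j → Solvable R κ → ∃[ g ] (g < 2 ^ (15 * j) × Success j R g)
      success-complete f j R κ j≤f κ≤j s = by-size (# (stripF R)) refl
        where
        by-size : ∀ x → # (stripF R) ≡ x → ∃[ g ] (g < 2 ^ (15 * j) × Success j R g)
        by-size zero    z = 0 , m^n>0 2 (15 * j) , success (trans (cong (λ R′ → # (stripF R′)) (idle-run j R 0)) z)
        by-size (suc x) z = decompose (# (boundary (stripF R) C)) refl (strip-no-free R C C⊆R C≤ℓ start<n start∈C)
          where
          open FirstCut (first-cut loopless 1≤ℓ (Solvable-mono (strip-⊆ R) ≤-refl s) (≤-trans (s≤s z≤n) (≤-reflexive (sym z))))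
          pay : ∀ f i b → suc b + i ≤ f → κ ≤ suc b + i → # (boundary (stripF R) C) ≡ suc b →
                ∃[ g ] (g < 2 ^ (15 * (suc b + i)) × Success (suc b + i) R g)
          pay (suc f) i b j≤f κ≤j e =
            spend (advise (pay-complete C (suc b) C⊆R C≤ℓ (≤-reflexive e) (s≤s z≤n) (subst (λ x → Solvable (rest (stripF R) C) (κ ∸ x)) e later)))
            where
            trace : ∀ i b g R′ g′ → tick (R , b , g) ≡ (R′ , 0 , g′) → iterate tick (suc b + i) (R , 0 , g * 2 ^ b) ≡ iterate tick i (R′ , 0 , g′)
            trace i b g R′ g′ spend = begin
              iterate tick (suc b + i) (R , 0 , g * 2 ^ b) ≡⟨ cong (λ x → iterate tick x (R , 0 , g * 2 ^ b)) (sym (+-suc b i)) ⟩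
              iterate tick (b + suc i) (R , 0 , g * 2 ^ b) ≡⟨ wait b (suc i) R 0 g ⟩
              tick (iterate tick i (R , b + 0 , g))        ≡⟨ cong (λ x → tick (iterate tick i (R , x , g))) (+-identityʳ b) ⟩
              tick (iterate tick i (R , b , g))            ≡⟨ sym (iterate-shift tick i (R , b , g)) ⟩
              iterate tick i (tick (R , b , g))            ≡⟨ cong (iterate tick i) spend ⟩
              iterate tick i (R′ , 0 , g′)                 ∎
              where open ≡-Reasoning
            prepend : ∀ {R′ g′ g} → rem₆ (suc b) g ≡ g′ → payD (stripF R) (suc b) g ≡ R′ → g < advice-bound (suc b) (2 ^ (15 * i)) → Success i R′ g′ →
                      ∃[ g ] (g < 2 ^ (15 * (suc b + i)) × Success (suc b + i) R g)
            prepend {R′} {g′} {g} rem paid g< (success ok) =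
              (1 + g * 2) * 2 ^ b
              , subst (λ x → (1 + g * 2) * 2 ^ b < 2 ^ (15 * x)) (+-suc b i) (advice-size b i g<)
              , success (trans (cong (λ s → # (stripF (proj₁ s))) (trace i b (1 + g * 2) R′ g′ (trans (tick-odd R b (1 + g * 2) (bit-%2 true g) (bit-/2 true g)) (cong₂ (λ x y → x , 0 , y) paid rem)))) ok)
            spend : ∃[ R′ ] (Solvable R′ (κ ∸ suc b) × (∀ g′ N → g′ < N →
                      ∃[ g ] (rem₆ (suc b) g ≡ g′ × payD (stripF R) (suc b) g ≡ R′ × g < advice-bound (suc b) N))) →
                    ∃[ g ] (g < 2 ^ (15 * (suc b + i)) × Success (suc b + i) R g)
            spend (R′ , s′ , build) = continue (success-complete f i R′ (κ ∸ suc b) (≤-trans (m≤n+m i b) (s≤s⁻¹ j≤f)) (m≤n+o⇒m∸n≤o κ (suc b) κ≤j) s′)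
              where
              continue : ∃[ g′ ] (g′ < 2 ^ (15 * i) × Success i R′ g′) → ∃[ g ] (g < 2 ^ (15 * (suc b + i)) × Success (suc b + i) R g)
              continue (g′ , g′< , ok) = assemble (build g′ (2 ^ (15 * i)) g′<)
                where
                assemble : ∃[ g ] (rem₆ (suc b) g ≡ g′ × payD (stripF R) (suc b) g ≡ R′ × g < advice-bound (suc b) (2 ^ (15 * i))) →
                           ∃[ g ] (g < 2 ^ (15 * (suc b + i)) × Success (suc b + i) R g)
                assemble (g , rem , paid , g<) = prepend {R′} {g′} {g} rem paid g< ok
          decompose : ∀ b → # (boundary (stripF R) C) ≡ b → 1 ≤ # (boundary (stripF R) C) → ∃[ g ] (g < 2 ^ (15 * j) × Success j R g)
          decompose zero    e p = ⊥-elim (<⇒≱ p (≤-reflexive e))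
          decompose (suc b) e _ =
            let i , b+i≡j = m≤n⇒∃[o]m+o≡n (≤-trans (subst (_≤ κ) e ∂≤κ) κ≤j)
            in subst (λ j → ∃[ g ] (g < 2 ^ (15 * j) × Success j R g)) b+i≡j
                 (pay f i b (≤-trans (≤-reflexive b+i≡j) j≤f) (≤-trans κ≤j (≤-reflexive (sym b+i≡j))) e)

-- DCOC and potentials

sum-head : ∀ n f → sum (suc n) f ≡ f 0 + sum n (f ∘ suc)
sum-head zero    f = +-comm 0 (f 0)
sum-head (suc n) f = trans (cong (_+ f (suc n)) (sum-head n f)) (+-assoc (f 0) _ _)

∣∣≡sum : ∀ {n} (p : Subset n) (f : ℕ → ℕ) → (∀ i → f (toℕ i) ≡ b2n (lookup p i)) → ∣ p ∣ ≡ sum n f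
∣∣≡sum []          f q = refl
∣∣≡sum {suc n} (true ∷ p)  f q = trans (cong₂ _+_ (sym (q Fin.zero)) (∣∣≡sum p (f ∘ suc) (λ i → q (Fin.suc i)))) (sym (sum-head n f))
∣∣≡sum {suc n} (false ∷ p) f q = trans (cong₂ _+_ (sym (q Fin.zero)) (∣∣≡sum p (f ∘ suc) (λ i → q (Fin.suc i)))) (sym (sum-head n f))

lift : ∀ {n} {A : Set} → A → (Fin n → A) → ℕ → A
lift {n} d f v with v <? n
... | yes p = f (fromℕ< p)
... | no  _ = d

lift-toℕ : ∀ {n} {A : Set} (d : A) (f : Fin n → A) i → lift d f (toℕ i) ≡ f i
lift-toℕ {n} d f i with toℕ i <? n
... | yes p = cong f (fromℕ<-toℕ i p)
... | no ¬p = ⊥-elim (¬p (toℕ<n i))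

∈⇒lookup : ∀ {n} {p : Subset n} {i} → i ∈ p → lookup p i ≡ true
∈⇒lookup = []=⇒lookup

lookup⇒∈ : ∀ {n} {p : Subset n} {i} → lookup p i ≡ true → i ∈ p
lookup⇒∈ {p = p} {i} = lookup⇒[]= i p

does-true : ∀ {P : Set} (d : Dec P) → does d ≡ true → P
does-true (yes p) _ = p

∈-tabulate⁺ : ∀ {n} {P : Fin n → Set} (d : ∀ i → Dec (P i)) {i} → P i → i ∈ tabulate (λ i → does (d i))
∈-tabulate⁺ d {i} p = lookup⇒∈ (trans (lookup∘tabulate (λ i → does (d i)) i) (dec-true (d i) p))

∈-tabulate⁻ : ∀ {n} {P : Fin n → Set} (d : ∀ i → Dec (P i)) {i} → i ∈ tabulate (λ i → does (d i)) → P i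
∈-tabulate⁻ d {i} p = does-true (d i) (trans (sym (lookup∘tabulate (λ i → does (d i)) i)) (∈⇒lookup p))

⊆-size⇒⊇ : ∀ {n} {p q : Subset n} → p ⊆ q → ∣ q ∣ ≤ ∣ p ∣ → q ⊆ p
⊆-size⇒⊇ {p = p} p⊆q q≤p {x} x∈q with x ∈? p
... | yes x∈p = x∈p
... | no  x∉p = ⊥-elim (<⇒≱ (p⊂q⇒∣p∣<∣q∣ (p⊆q , x , x∈q , x∉p)) q≤p)

matrix : ∀ {n} → Digraph n → ℕ → Bool
matrix {n} D a with a <? n * n
... | no  _ = false
... | yes p with remQuot {n} n (fromℕ< p)
...   | i , j = arc D i j

adjacencyMatrix-matrix : ∀ {n} (D : Digraph n) a → adjacencyMatrix D a ≡ b2n (matrix D a)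
adjacencyMatrix-matrix {n} D a with a <? n * n
... | no  _ = refl
... | yes p with remQuot {n} n (fromℕ< p)
...   | i , j = refl

adjacencyMatrix-outside : ∀ {n} (D : Digraph n) a → n * n ≤ a → adjacencyMatrix D a ≡ 0
adjacencyMatrix-outside {n} D a q with a <? n * n
... | no  _ = refl
... | yes p = ⊥-elim (<⇒≱ p q)

module Link {n : ℕ} .{{n≢0 : NonZero n}} (D : Digraph n) (ℓ : ℕ) where

  instance
    private
      n²≢0′ : NonZero (n * n)
      n²≢0′ = m*n≢0 n n

  -- The remainder makes this function agree with the memory accesses of the compiled program for
  -- all arguments, not only for vertices.
  arcs : ℕ → ℕ → Bool
  arcs u v = matrix D ((u * n + v) % (n * n))

  arcs-toℕ : ∀ i j → arcs (toℕ i) (toℕ j) ≡ arc D i j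
  arcs-toℕ i j with cell
    where
    cell : (toℕ i * n + toℕ j) % (n * n) ≡ toℕ (combine i j)
    cell = trans (cong (_% (n * n)) (trans (cong (_+ toℕ j) (*-comm (toℕ i) n)) (sym (toℕ-combine i j)))) (m<n⇒m%n≡m (toℕ<n (combine i j)))
  ... | q rewrite q with toℕ (combine i j) <? n * n
  ...   | no ¬p = ⊥-elim (¬p (toℕ<n (combine i j)))
  ...   | yes p = trans (cong (λ x → arc D (proj₁ (remQuot {n} n x)) (proj₂ (remQuot {n} n x))) (fromℕ<-toℕ (combine i j) p))
                        (cong (λ y → arc D (proj₁ y) (proj₂ y)) (remQuot-combine {n} {n} i j))

  open Graph n arcs ℓ

  at : ∀ {v} → v < n → Fin n
  at p = fromℕ< p

  toℕ-at : ∀ {v} (p : v < n) → toℕ (at p) ≡ v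
  toℕ-at p = toℕ-fromℕ< p

  arcs-at : ∀ {u v} (p : u < n) (q : v < n) → arcs u v ≡ arc D (at p) (at q)
  arcs-at p q = trans (cong₂ arcs (sym (toℕ-at p)) (sym (toℕ-at q))) (arcs-toℕ (at p) (at q))

  lift-at : ∀ {A : Set} (d : A) (f : Fin n → A) {v} (p : v < n) → lift d f v ≡ f (at p)
  lift-at d f p = trans (cong (lift d f) (sym (toℕ-at p))) (lift-toℕ d f (at p))

  arcs-loopless : ∀ v → v < n → arcs v v ≡ false
  arcs-loopless v p = trans (arcs-at p p) (loopless D (at p))

  arcs-semicomplete : Semicomplete D → ∀ u v → u < n → v < n → u ≢ v → arcs u v ≡ true ⊎ arcs v u ≡ true
  arcs-semicomplete sc u v p q ne with sc (at p) (at q) (λ e → ne (trans (sym (toℕ-at p)) (trans (cong toℕ e) (toℕ-at q))))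
  ... | inj₁ t = inj₁ (trans (arcs-at p q) (T⇒≡ t))
  ... | inj₂ t = inj₂ (trans (arcs-at q p) (T⇒≡ t))

  all-vertices : VSet
  all-vertices _ = true

  component≤mco : ∀ S u → ∣ component D S u ∣ ≤ mco D S
  component≤mco S u = All.lookup (xs≤max 0 (map (λ u → ∣ component D S u ∣) (allFin n))) (∈-map⁺ (λ u → ∣ component D S u ∣) (∈-allFin u))

  -- The potential of a vertex is the number of vertices of D - X from which it can be reached. It
  -- does not decrease along arcs. Two survivors of equal potential are joined by an arc, and
  -- equality forces a walk back, so every level lies in one strong component.
  DCOC⇒Solvable : Semicomplete D → ∀ k → DCOC D ℓ k → Solvable all-vertices k
  DCOC⇒Solvable sc k (X , ∣X∣≡k , mco≤ℓ) = record
    { X = X# ; ρ = rank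
    ; few = ≤-reflexive (trans (sym (∣∣≡sum X (b2n ∘ X#) (λ i → cong b2n (lift-toℕ true (lookup X) i)))) ∣X∣≡k)
    ; mono = λ u v p q _ xu _ xv e → subst₂ _≤_ (sym (lift-at 0 rankF p)) (sym (lift-at 0 rankF q))
               (rank-mono (kept p xu) (kept q xv) (≡⇒T (trans (sym (arcs-at p q)) e)))
    ; level = level }
    where
    S = ∁ X
    X# : VSet
    X# = lift true (lookup X)
    kept : ∀ {v} (p : v < n) → X# v ≡ false → at p ∈ S
    kept p x = x∉p⇒x∈∁p (λ z → true≢false (∈⇒lookup z) (trans (sym (lift-at true (lookup X) p)) x))
    ancestor? : ∀ i j → Dec (Star (InducedArc D S) j i)
    ancestor? i j = star? (inducedArc? D S) j i
    ancestors : Fin n → Subset n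
    ancestors i = tabulate (λ j → does (ancestor? i j))
    rankF : Fin n → ℕ
    rankF i = ∣ ancestors i ∣
    rank : ℕ → ℕ
    rank = lift 0 rankF
    ancestors-⊆ : ∀ {i j} → i ∈ S → j ∈ S → T (arc D i j) → ancestors i ⊆ ancestors j
    ancestors-⊆ {i} {j} p q e x = ∈-tabulate⁺ (ancestor? j) (∈-tabulate⁻ (ancestor? i) x ◅◅ ((p , q , e) ◅ ε))
    rank-mono : ∀ {i j} → i ∈ S → j ∈ S → T (arc D i j) → rankF i ≤ rankF j
    rank-mono p q e = p⊆q⇒∣p∣≤∣q∣ (ancestors-⊆ p q e)
    -- The ancestors of i are among those of j. Equal numbers make the two sets equal, and j is an
    -- ancestor of itself.
    back : ∀ {i j} → i ∈ S → j ∈ S → T (arc D i j) → rankF i ≡ rankF j → Star (InducedArc D S) j i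
    back {i} {j} p q e r = ∈-tabulate⁻ (ancestor? i)
      (⊆-size⇒⊇ (ancestors-⊆ p q e) (≤-reflexive (sym r)) (∈-tabulate⁺ (ancestor? j) ε))
    same : ∀ {i j} → i ∈ S → j ∈ S → rankF i ≡ rankF j → SameComponent D S i j
    same {i} {j} p q r with i Data.Fin.Properties.≟ j
    ... | yes refl = p , q , ε , ε
    ... | no ne with sc i j ne
    ...   | inj₁ e = p , q , (p , q , e) ◅ ε , back p q e r
    ...   | inj₂ e = p , q , back q p e (sym r) , (q , p , e) ◅ ε
    level : ∀ i → # (λ v → true ∧ (not (X# v) ∧ (rank v ≡ᵇ i))) ≤ ℓ
    level i with # (λ v → true ∧ (not (X# v) ∧ (rank v ≡ᵇ i))) in z
    ... | zero  = z≤n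
    ... | suc s with #-pos (λ v → not (X# v) ∧ (rank v ≡ᵇ i)) (≤-trans (s≤s z≤n) (≤-reflexive (sym z)))
    ...   | v , p , q = subst (_≤ ℓ) z (begin
      # (λ v → not (X# v) ∧ (rank v ≡ᵇ i))      ≤⟨ #-mono inside ⟩
      # (lift false (lookup (component D S c))) ≡⟨ sym (∣∣≡sum (component D S c) _ (λ j → cong b2n (lift-toℕ false (lookup (component D S c)) j))) ⟩
      ∣ component D S c ∣                       ≤⟨ component≤mco S c ⟩
      mco D S                                   ≤⟨ mco≤ℓ ⟩
      ℓ                                         ∎)
      where
      open ≤-Reasoning
      c = at p
      inside : (λ v → not (X# v) ∧ (rank v ≡ᵇ i)) ⊆[ n ] lift false (lookup (component D S c))
      inside w r t = trans (lift-at false (lookup (component D S c)) r)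
        (∈⇒lookup (∈-tabulate⁺ (sameComponent? D S c) (same (kept p (not-elim (∧-left q))) (kept r (not-elim (∧-left t)))
          (trans (sym (lift-at 0 rankF p)) (trans (≡ᵇ-true (∧-right {not (X# v)} q)) (trans (sym (≡ᵇ-true (∧-right {not (X# w)} t))) (lift-at 0 rankF r)))))))

  Solvable⇒DCOC : ∀ k → k < n → Solvable all-vertices k → DCOC D ℓ k
  Solvable⇒DCOC k k<n s = p , size , max≤v⁺ z≤n (AllP.map⁺ (All.tabulate {xs = allFin n} (λ {u} _ → small u)))
    where
    open Solvable s
    -- DCOC asks for exactly k vertices; X is padded by further vertices, which exist since k < n.
    Y : VSet
    Y = X ∪ first (k ∸ # X) (not ∘ X)
    p : Subset n
    p = tabulate (Y ∘ toℕ)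
    size : ∣ p ∣ ≡ k
    size = begin
      ∣ p ∣                                       ≡⟨ ∣∣≡sum p (b2n ∘ Y) (λ i → cong b2n (sym (lookup∘tabulate (Y ∘ toℕ) i))) ⟩
      # Y                                         ≡⟨ trans (sum-cong n (λ v _ → disjoint v)) (sum-+ n _ _) ⟩
      # X + # (first (k ∸ # X) (not ∘ X))         ≡⟨ cong (# X +_) (first-size n (k ∸ # X) (not ∘ X)) ⟩
      # X + (# (not ∘ X) ⊓ (k ∸ # X))             ≡⟨ cong (# X +_) (m≥n⇒m⊓n≡n enough) ⟩
      # X + (k ∸ # X)                             ≡⟨ m+[n∸m]≡n few ⟩
      k                                           ∎
      where
      open ≡-Reasoning
      disjoint : ∀ v → b2n (Y v) ≡ b2n (X v) + b2n (first (k ∸ # X) (not ∘ X) v)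
      disjoint v with X v
      ... | true  = refl
      ... | false = refl
      complement : # X + # (not ∘ X) ≡ n
      complement = trans (sym (sum-+ n _ _)) (trans (sum-cong n (λ v _ → one (X v))) (sum-one n))
        where
        one : ∀ b → b2n b + b2n (not b) ≡ 1
        one true  = refl
        one false = refl
      enough : k ∸ # X ≤ # (not ∘ X)
      enough = m≤n+o⇒m∸n≤o k (# X) (≤-trans (<⇒≤ k<n) (≤-reflexive (sym complement)))
    kept : ∀ {i} → i ∈ ∁ p → X (toℕ i) ≡ false
    kept {i} m with true-or-false (X (toℕ i))
    ... | inj₂ z = z
    ... | inj₁ z = ⊥-elim (x∈∁p⇒x∉p m (lookup⇒∈ (trans (lookup∘tabulate (Y ∘ toℕ) i) (cong (_∨ first (k ∸ # X) (not ∘ X) (toℕ i)) z))))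
    -- Walks in both directions force equal potentials, so a strong component lies in one level.
    rising : ∀ {i j} → Star (InducedArc D (∁ p)) i j → ρ (toℕ i) ≤ ρ (toℕ j)
    rising ε = ≤-refl
    rising {i} ((a , b , e) ◅ q) =
      ≤-trans (mono (toℕ i) _ (toℕ<n i) (toℕ<n _) refl (kept a) refl (kept b) (trans (arcs-toℕ i _) (T⇒≡ e))) (rising q)
    small : ∀ u → ∣ component D (∁ p) u ∣ ≤ ℓ
    small u = begin
      ∣ component D (∁ p) u ∣                    ≡⟨ ∣∣≡sum (component D (∁ p) u) _ (λ j → cong b2n (lift-toℕ false (lookup (component D (∁ p) u)) j)) ⟩
      # (lift false (lookup (component D (∁ p) u))) ≤⟨ #-mono inside ⟩
      # (λ v → true ∧ (not (X v) ∧ (ρ v ≡ᵇ ρ (toℕ u)))) ≤⟨ level (ρ (toℕ u)) ⟩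
      ℓ                                          ∎
      where
      open ≤-Reasoning
      inside : lift false (lookup (component D (∁ p) u)) ⊆[ n ] (λ v → true ∧ (not (X v) ∧ (ρ v ≡ᵇ ρ (toℕ u))))
      inside v q t with ∈-tabulate⁻ (sameComponent? D (∁ p) u) (lookup⇒∈ (trans (sym (lift-at false (lookup (component D (∁ p) u)) q)) t))
      ... | a , b , to , from = subst (λ x → not (X x) ∧ (ρ x ≡ᵇ ρ (toℕ u)) ≡ true) (toℕ-at q)
              (∧-intro (not-intro (kept b)) (subst (λ x → (x ≡ᵇ ρ (toℕ u)) ≡ true) (≤-antisym (rising to) (rising from)) (≡ᵇ-refl (ρ (toℕ u)))))

-- The program

infixl 6 _⊕_ _⊖_
infixl 7 _⊗_
infix 5 _≺_ _≐_

_⊕_ _⊖_ _⊗_ _⊘_ _⊛_ _≺_ _≐_ : Ex → Ex → Ex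
_⊕_ = bin add
_⊖_ = bin sub
_⊗_ = bin mul
_⊘_ = bin div
_⊛_ = bin mod
_≺_ = bin lt
_≐_ = bin eq

rL rK rN rTop rV rU rS₁ rS₂ rW rC rB rH₁ rH₂ rHH rRow rWin rRounds rRound rP rQ rCul rT rNew rF rSize rGone rFault : ℕ
rL = 1
rK = 2
rN = 3
rTop = 5
rV = 6
rU = 7
rS₁ = 8
rS₂ = 9
rW = 10
rC = 11
rB = 12
rH₁ = 13
rH₂ = 14
rHH = 15
rRow = 16
rWin = 17
rRounds = 18
rRound = 19
rP = 20
rQ = 21
rCul = 22
rT = 23
rNew = 24
rF = 25
rSize = 26
rGone = 27
rFault = 28

aR aI aC aT aSt aCnt aZ : ℕ
aR = 0
aI = 1
aC = 2
aT = 3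
aSt = 4
aCnt = 5
aZ = 6

degreesIn degreesBody degreesP zeroBody bucketBody prefixBody tableBody tableP : Pr
labelBody labelP searchBody culpritBody shiftBody roundP tallyBody tallyP cutP : Pr

degreesIn =
  asg rS₁ (var rS₁ ⊕ arr aR (var rU) ⊗ adj (var rU) (var rV)) ⨟
  asg rS₂ (var rS₂ ⊕ arr aR (var rU) ⊗ (num 1 ⊖ adj (var rV) (var rU)))

degreesBody =
  asg rS₁ (num 0) ⨟ asg rS₂ (num 0) ⨟ for bd-n rU rN degreesIn ⨟
  put aI (var rV) (var rS₁) ⨟ put aC (var rV) (var rS₂)

degreesP = for bd-n rV rN degreesBody

-- Row c, column w of the array aT counts the in-neighbours of w whose codegree
-- is at most c.
zeroBody = put aZ (var rV) (num 0)

bucketBody = put aZ (arr aC (var rU)) (arr aZ (arr aC (var rU)) ⊕ arr aR (var rU) ⊗ adj (var rU) (var rW))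

prefixBody =
  asg rS₁ (var rS₁ ⊕ arr aZ (var rV)) ⨟
  put aT (var rV ⊗ var rN ⊕ var rW) (var rS₁)

tableBody =
  -- Vertices are sorted into buckets by codegree, which lies between 0 and n, and the buckets are
  -- summed up. A column takes O(n) steps, the table O(n²).
  for bd-n+1 rV rTop zeroBody ⨟ for bd-n rU rN bucketBody ⨟
  asg rS₁ (num 0) ⨟ for bd-n+1 rV rTop prefixBody

tableP = asg rTop (var rN ⊕ num 1) ⨟ for bd-n rW rN tableBody

labelBody =
  -- In-degree minus table entry: the in-neighbours of codegree above c, that is, those right of the
  -- degree cut.
  put aCnt (var rV) (arr aI (var rV) ⊖ arr aT (var rRow ⊗ var rN ⊕ var rV)) ⨟
  asg rWin (arr aR (var rV) ⊗ ((var rC ≺ arr aC (var rV)) ⊗ (arr aI (var rV) ≺ var rC ⊕ var rB))) ⨟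
  put aSt (var rV) (ite (arr aR (var rV)) (ite (var rC ≺ arr aC (var rV)) (var rWin ⊗ (var rHH ⊛ num 2)) (num 2)) (num 3)) ⨟
  asg rHH (ite (var rWin) (var rHH ⊘ num 2) (var rHH))

labelP =
  -- The size c that is tried may exceed n. As codegrees do not, row n then gives the same numbers
  -- as row c would.
  asg rHH (var rH₁) ⨟ asg rRow (ite (var rN ≺ var rC) (var rN) (var rC)) ⨟
  for bd-n rV rN labelBody

searchBody =
  -- Later hits overwrite earlier ones, in accordance with `find`, which returns the last one.
  asg rP (ite (arr aSt (var rV) ≐ num 1) (var rV ⊕ num 1) (var rP)) ⨟
  asg rQ (ite ((arr aSt (var rV) ≐ num 2) ⊗ (num 0 ≺ arr aCnt (var rV))) (var rV ⊕ num 1) (var rQ))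

culpritBody =
  asg rCul (ite ((arr aSt (var rV) ≺ num 2) ⊗ adj (var rV) (var rQ ⊖ num 1)) (var rV ⊕ num 1) (var rCul))

-- `rF` is 1 exactly if the vertex leaves the right side; removing a vertex from the left changes no
-- pressure.
shiftBody = put aCnt (var rW) (arr aCnt (var rW) ⊖ var rF ⊗ adj (var rT) (var rW))

roundP =
  asg rP (num 0) ⨟ asg rQ (num 0) ⨟ for bd-n rV rN searchBody ⨟
  asg rCul (num 0) ⨟ for bd-n rV rN culpritBody ⨟
  asg rT (ite (var rP) (var rP) (ite (var rQ) (ite (var rHH ⊛ num 2) (var rQ) (var rCul)) (num 0))) ⨟
  asg rNew (ite (var rP) (num 2) (num 4)) ⨟
  asg rHH (ite (var rP) (var rHH) (ite (var rQ) (var rHH ⊘ num 2) (var rHH))) ⨟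
  cnd (var rT)
    (asg rT (var rT ⊖ num 1) ⨟
     asg rF (arr aSt (var rT) ≺ num 2) ⨟
     for bd-n rW rN shiftBody ⨟
     put aSt (var rT) (var rNew))
    nop

tallyBody =
  asg rSize (var rSize ⊕ (arr aSt (var rV) ≐ num 2)) ⨟
  asg rGone (var rGone ⊕ (arr aSt (var rV) ≐ num 4)) ⨟
  asg rFault (var rFault ⊕ (arr aSt (var rV) ≐ num 2) ⊗ (num 0 ≺ arr aCnt (var rV)))

tallyP = asg rSize (num 0) ⨟ asg rGone (num 0) ⨟ asg rFault (num 0) ⨟ for bd-n rV rN tallyBody

cutP =
  labelP ⨟
  asg rHH (var rH₂) ⨟ asg rRounds (num 6 ⊗ var rB) ⨟
  for bd-6k rRound rRounds roundP ⨟
  tallyP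

b2n-∧ : ∀ x y → b2n x * b2n y ≡ b2n (x ∧ y)
b2n-∧ true  y = +-identityʳ (b2n y)
b2n-∧ false y = refl

b2n-not : ∀ x → 1 ∸ b2n x ≡ b2n (not x)
b2n-not true  = refl
b2n-not false = refl

if-b2n : ∀ {A : Set} b {x y : A} → (if b2n b ≡ᵇ 0 then y else x) ≡ (if b then x else y)
if-b2n true  = refl
if-b2n false = refl

loop-bound : ℕ → ℕ → Bd → ℕ
loop-bound n k bd-n     = n
loop-bound n k bd-n+1   = n + 1
loop-bound n k bd-k     = k
loop-bound n k bd-6k    = 6 * k
loop-bound n k bd-2^15k = 2 ^ (15 * k)

find≤ : ∀ i P → find i P ≤ i
find≤ zero    P = z≤n
find≤ (suc i) P with P i
... | true  = ≤-refl
... | false = m≤n⇒m≤1+n (find≤ i P)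

rLast rSLast rOk rScan rM rOff rI₁ rI₂ rBest rBound rSweep rG rCredit rPow rZ rIter rCount rGuess rAll rRes rBig rOne rMod₁ rMod₂ : ℕ
rLast = 29
rSLast = 30
rOk = 31
rScan = 32
rM = 33
rOff = 34
rI₁ = 35
rI₂ = 36
rBest = 37
rBound = 38
rSweep = 39
rG = 40
rCredit = 41
rPow = 42
rZ = 43
rIter = 44
rCount = 45
rGuess = 46
rAll = 47
rRes = 48
rBig = 49
rOne = 50
rMod₁ = 51
rMod₂ = 52

prepareP scanBody keepBody stripP sweepBody acceptBody moduliP digitsP sweepP settleP payP tickBody fillBody countBody guessBody allBody mainP : Pr

prepareP = degreesP ⨟ tableP

scanBody =
  asg rC (var rScan) ⨟ cutP ⨟
  asg rOk ((var rFault ≐ num 0) ⊗ (var rSize ≺ num 1 ⊕ (var rSLast ⊕ var rL))) ⨟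
  asg rSLast (ite (var rOk) (var rSize) (var rSLast)) ⨟
  asg rLast (ite (var rOk) (num 1 ⊕ var rC) (var rLast))

keepBody = put aR (var rV) (arr aR (var rV) ⊗ (num 1 ⊖ (arr aC (var rV) ≺ var rLast)))

stripP =
  -- With b = 0 and both strings 0, `cutP` evaluates the plain degree cut: no round is executed.
  prepareP ⨟ asg rB (num 0) ⨟ asg rH₁ (num 0) ⨟ asg rH₂ (num 0) ⨟ asg rLast (num 0) ⨟ asg rSLast (num 0) ⨟
  for bd-n+1 rScan rTop scanBody ⨟ for bd-n rV rN keepBody

sweepBody =
  asg rC (var rSweep) ⨟ cutP ⨟
  asg rBest (ite ((var rFault ≐ num 0) ⊗ ((var rGone ≺ num 1 ⊕ var rM) ⊗ ((var rC ≺ num 1 ⊕ var rSize) ⊗ (var rSize ≺ num 1 ⊕ (var rC ⊕ var rB)))))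
                 (var rC) (var rBest))

acceptBody = put aR (var rV) (ite (var rOk) (arr aSt (var rV) ≺ num 2) (arr aR (var rV)))

moduliP =
  asg rB (var rCredit) ⨟ asg rMod₁ (var rB ⊕ num 2) ⨟ asg rMod₂ (num 4 ⊗ var rB ⊕ num 1) ⨟
  -- `rPow` is 2 ^ (b - 1), and 8 times its fifth power is 2 ^ (5 b - 2).
  asg rBig (num 8 ⊗ ((var rPow ⊗ var rPow) ⊗ ((var rPow ⊗ var rPow) ⊗ var rPow))) ⨟ asg rOne (num 2 ⊗ var rPow)

-- Moves the last digit of the advice, with radix in register q, to register r.
digitP : ℕ → ℕ → Pr
digitP r q = asg r (var rG ⊛ var q) ⨟ asg rG (var rG ⊘ var q)

digitsP =
  moduliP ⨟ digitP rM rMod₁ ⨟ digitP rOff rMod₂ ⨟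
  digitP rH₁ rBig ⨟ digitP rH₂ rOne ⨟ digitP rI₁ rBig ⨟ digitP rI₂ rOne

settleP =
  asg rC (ite (var rM ≐ num 1 ⊕ var rB) (var rL) (var rBest) ⊕ var rOff ⊖ num 2 ⊗ var rB) ⨟
  asg rH₁ (var rI₁) ⨟ asg rH₂ (var rI₂) ⨟ cutP ⨟
  asg rOk ((var rFault ≐ num 0) ⊗ (var rGone ⊕ (var rSize ⊖ var rL) ≺ num 1 ⊕ var rB)) ⨟
  for bd-n rV rN acceptBody

sweepP =
  -- The sweep tries the sizes from 0 to ℓ - 2 b, and none if 2 b exceeds ℓ.
  asg rBest (num 0) ⨟ asg rBound (num 1 ⊕ var rL ⊖ num 2 ⊗ var rB) ⨟
  for bd-n+1 rSweep rBound sweepBody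

-- Degrees and table are computed anew, since stripping has changed the set of vertices.
payP = prepareP ⨟ digitsP ⨟ sweepP ⨟ settleP

tickBody =
  asg rCredit (num 1 ⊕ var rCredit) ⨟ asg rZ (var rG ⊛ num 2) ⨟ asg rG (var rG ⊘ num 2) ⨟
  cnd (var rZ) (stripP ⨟ payP ⨟ asg rCredit (num 0) ⨟ asg rPow (num 1)) (asg rPow (num 2 ⊗ var rPow))

fillBody = put aR (var rV) (num 1)

countBody = asg rCount (var rCount ⊕ arr aR (var rV))

guessBody =
  asg rG (var rGuess) ⨟ asg rCredit (num 0) ⨟ asg rPow (num 1) ⨟ for bd-n rV rN fillBody ⨟
  for bd-k rIter rK tickBody ⨟ stripP ⨟
  asg rCount (num 0) ⨟ for bd-n rV rN countBody ⨟ asg rRes (ite (var rCount) (var rRes) (num 1))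

-- The factor is 2 ^ 15, so k rounds yield the number of strings.
allBody = asg rAll (num 32768 ⊗ var rAll)

mainP =
  asg rAll (num 1) ⨟ for bd-k rIter rK allBody ⨟ asg rRes (num 0) ⨟ for bd-2^15k rGuess rAll guessBody

2^-product : ∀ b → 8 * ((2 ^ b * 2 ^ b) * ((2 ^ b * 2 ^ b) * 2 ^ b)) ≡ 2 ^ (5 * suc b ∸ 2)
2^-product b = begin
  8 * ((2 ^ b * 2 ^ b) * ((2 ^ b * 2 ^ b) * 2 ^ b)) ≡⟨ cong (8 *_) (trans (cong₂ _*_ (two b b) (trans (cong (_* 2 ^ b) (two b b)) (two (b + b) b))) (two (b + b) (b + b + b))) ⟩
  2 ^ 3 * 2 ^ (b + b + (b + b + b))                 ≡⟨ two 3 (b + b + (b + b + b)) ⟩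
  2 ^ (3 + (b + b + (b + b + b)))                   ≡⟨ cong (2 ^_) (sym exponent) ⟩
  2 ^ (5 * suc b ∸ 2)                               ∎
  where
  open ≡-Reasoning
  open +-*-Solver
  two : ∀ x y → 2 ^ x * 2 ^ y ≡ 2 ^ (x + y)
  two x y = sym (^-distribˡ-+-* 2 x y)
  exponent : 5 * suc b ∸ 2 ≡ 3 + (b + b + (b + b + b))
  exponent = trans (cong (_∸ 2) (solve 1 (λ b → con 5 :* (con 1 :+ b) := con 3 :+ (b :+ b :+ (b :+ b :+ b)) :+ con 2) refl b)) (m+n∸n≡m (3 + (b + b + (b + b + b))) 2)

mod-≤ : ∀ x y → ⟦ mod ⟧ x (y + 1) ≤ y
mod-≤ x y = subst (λ z → ⟦ mod ⟧ x z ≤ y) (+-comm 1 y) (s≤s⁻¹ (m%n<n x (suc y)))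

-- Correctness of the program

module Programs (n : ℕ) .{{n≢0 : NonZero n}} (E : ℕ → ℕ → Bool) (ℓ k B : ℕ)
  (B-large : 65536 ≤ B) (linear : 16 * (n + k + 1) ≤ B) (exponential : 2 ^ (15 * k) ≤ B) (ℓ≤n : ℓ ≤ n) where

  bounds : Bd → ℕ
  bounds = loop-bound n k

  open Machine n E bounds B B-large public
  open Algorithm n E ℓ public

  n≤B : n ≤ B
  n≤B = ≤-trans (≤-trans (m≤m+n n (k + 1)) (≤-reflexive (sym (+-assoc n k 1)))) (≤-trans (m≤n*m (n + k + 1) 16) linear)

  n+1≤B : n + 1 ≤ B
  n+1≤B = ≤-trans (+-monoˡ-≤ 1 (m≤m+n n k)) (≤-trans (m≤n*m (n + k + 1) 16) linear)

  small-# : ∀ {x} A → x ≡ # A → x ≤ B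
  small-# A q = ≤-trans (≤-reflexive q) (≤-trans (#≤n A) n≤B)

  partial≤B : ∀ {x} i (A : VSet) → i ≤ n → x ≡ sum i (b2n ∘ A) → x ≤ B
  partial≤B i A p q = ≤-trans (≤-reflexive q) (≤-trans (≤-trans (sum-mono i (λ v _ → b2n≤1 (A v))) (≤-reflexive (sum-one i))) (≤-trans p n≤B))

  Array : ℕ → (ℕ → ℕ) → Store → Set
  Array j f H = ∀ v → v < n → ar H j v ≡ f v

  Holds : VSet → Store → Set
  Holds R = Array aR (b2n ∘ R)

  extend : ∀ {P : ℕ → Set} {i} → (∀ v → v < i → P v) → P i → ∀ v → v < suc i → P v
  extend f p v q with m<1+n⇒m<n∨m≡n q
  ... | inj₁ r    = f v r
  ... | inj₂ refl = p

  Spec-degrees : ∀ {R H} → rg H rN ≡ n → Holds R H → Spec degreesP (λ H′ → Array aI (indeg R) H′ × Array aC (codeg R) H′) H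
  Spec-degrees {R} {H} hn hR =
    spec (WP-for bd-n rV rN degreesBody Inv n hn ≤-refl ((λ _ ()) , (λ _ ())) step (λ _ inv _ → inv))
    where
    Inv : ℕ → Store → Set
    Inv i H′ = (∀ v → v < i → ar H′ aI v ≡ indeg R v) × (∀ v → v < i → ar H′ aC v ≡ codeg R v)
    step : Step rV degreesBody Inv n H
    step i H₁ i<n ri fr (a , b) = tt , tt , WP-for bd-n rU rN degreesIn Inv₂ n (trans (keepR fr rN refl) hn) ≤-refl (refl , refl) step₂ end₂
      where
      H₀ = setR (setR H₁ rS₁ 0) rS₂ 0
      Inv₂ : ℕ → Store → Set
      Inv₂ j H′ = rg H′ rS₁ ≡ sum j (λ u → b2n (R u ∧ E u i)) × rg H′ rS₂ ≡ sum j (λ u → b2n (R u ∧ not (E i u)))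
      step₂ : Step rU degreesIn Inv₂ n H₀
      step₂ j H₂ j<n rj fr₂ (e₁ , e₂) =
        partial≤B (suc j) (λ u → R u ∧ E u i) j<n s₁ , partial≤B (suc j) (λ u → R u ∧ not (E i u)) j<n s₂ , s₁ , s₂
        where
        rv : rg H₂ rV ≡ i
        rv = trans (keepR fr₂ rV refl) ri
        Rj : ar H₂ aR (rg H₂ rU) ≡ b2n (R j)
        Rj = trans (cong (ar H₂ aR) rj) (trans (keepA fr₂ aR j refl) (trans (keepA fr aR j refl) (hR j j<n)))
        s₁ : rg H₂ rS₁ + ar H₂ aR (rg H₂ rU) * b2n (E (rg H₂ rU) (rg H₂ rV)) ≡ sum (suc j) (λ u → b2n (R u ∧ E u i))
        s₁ = cong₂ _+_ e₁ (trans (cong₂ _*_ Rj (cong₂ (λ x y → b2n (E x y)) rj rv)) (b2n-∧ (R j) (E j i)))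
        s₂ : rg H₂ rS₂ + ar H₂ aR (rg H₂ rU) * (1 ∸ b2n (E (rg H₂ rV) (rg H₂ rU))) ≡ sum (suc j) (λ u → b2n (R u ∧ not (E i u)))
        s₂ = cong₂ _+_ e₂ (trans (cong₂ _*_ Rj (trans (cong₂ (λ x y → 1 ∸ b2n (E x y)) rv rj) (b2n-not (E i j)))) (b2n-∧ (R j) (not (E i j))))
      end₂ : ∀ H₂ → Inv₂ n H₂ → LoopFrame rU degreesIn H₀ H₂ → WP (put aI (var rV) (var rS₁) ⨟ put aC (var rV) (var rS₂)) (λ H″ → Inv (suc i) (setR H″ rV (suc i))) H₂
      end₂ H₂ (e₁ , e₂) fr₂ = tt , tt , stored aI a e₁ refl , stored aC b e₂ refl
        where
        rv : rg H₂ rV ≡ i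
        rv = trans (keepR fr₂ rV refl) ri
        stored : ∀ j {f : ℕ → ℕ} {x} → (∀ v → v < i → ar H₁ j v ≡ f v) → x ≡ f i → (j ∈ᵇ []) ≡ false → ∀ v → v < suc i → (ar H₂ j [ rg H₂ rV ↦ x ]) v ≡ f v
        stored j {x = x} old new q = extend
          (λ v p → trans (upd-other (ar H₂ j) x (λ z → <⇒≢ p (trans z rv))) (trans (keepA fr₂ j v q) (old v p)))
          (trans (cong (λ y → (ar H₂ j [ y ↦ x ]) i) rv) (trans (upd-same (ar H₂ j) i x) new))

  low-in : VSet → ℕ → ℕ → VSet
  low-in R w c u = R u ∧ (E u w ∧ (codeg R u <ᵇ c))

  exact-in : VSet → ℕ → ℕ → VSet
  exact-in R w c u = R u ∧ (E u w ∧ (codeg R u ≡ᵇ c))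

  -- The classes of equal codegree partition the vertices, so prefix sums of the buckets count the
  -- vertices up to a threshold.
  sum-exact : ∀ R w c → sum c (λ c → # (exact-in R w c)) ≡ # (low-in R w c)
  sum-exact R w zero = sym (#-zero (low-in R w 0) (λ u _ → ≢true (λ z → none (codeg R u) (∧-right {E u w} (∧-right {R u} z)))))
    where
    none : ∀ x → (x <ᵇ 0) ≡ true → ⊥
    none x ()
  sum-exact R w (suc c) = trans (cong (_+ # (exact-in R w c)) (sum-exact R w c))
    (trans (sym (sum-+ n _ _)) (sum-cong n (λ u _ → split (R u) (E u w) (codeg R u))))
    where
    cmp : ∀ k c → b2n (k <ᵇ c) + b2n (k ≡ᵇ c) ≡ b2n (k <ᵇ suc c)
    cmp zero    zero    = refl
    cmp zero    (suc c) = refl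
    cmp (suc k) zero    = sym (cong b2n (<ᵇ-elimF {k} {0} z≤n))
    cmp (suc k) (suc c) = cmp k c
    split : ∀ r e k → b2n (r ∧ (e ∧ (k <ᵇ c))) + b2n (r ∧ (e ∧ (k ≡ᵇ c))) ≡ b2n (r ∧ (e ∧ (k <ᵇ suc c)))
    split false e     k = refl
    split true  false k = refl
    split true  true  k = cmp k c

  IsTable : VSet → Store → Set
  IsTable R H = ∀ c v → c ≤ n → v < n → ar H aT (c * n + v) ≡ # (low-in R v (suc c))

  -- The column is the residue of the index modulo n; filling one column therefore preserves the
  -- others.
  column : ∀ c v → v < n → (c * n + v) % n ≡ v
  column c v p = trans (cong (_% n) (+-comm (c * n) v)) (trans ([m+kn]%n≡m%n v c n) (m<n⇒m%n≡m p))

  Spec-table : ∀ {R H} → rg H rN ≡ n → Holds R H → Array aC (codeg R) H → Spec tableP (λ H′ → IsTable R H′ × rg H′ rTop ≡ n + 1) H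
  Spec-table {R} {H} hn hR hC =
    spec (subst (_≤ B) (cong (_+ 1) (sym hn)) n+1≤B ,
    WP-for bd-n rW rN tableBody Inv n hn ≤-refl (λ _ _ _ ()) step (λ _ inv fr → inv , trans (keepR fr rTop refl) (cong (_+ 1) hn)))
    where
    H₀ = setR H rTop (rg H rN + 1)
    Inv : ℕ → Store → Set
    Inv w H′ = ∀ c v → c ≤ n → v < w → ar H′ aT (c * n + v) ≡ # (low-in R v (suc c))
    step : Step rW tableBody Inv n H₀
    step w H₁ w<n rw fr old = WP-for bd-n+1 rV rTop zeroBody Inv₁ (n + 1) top₁ ≤-refl (λ _ ()) step₁ next₁
      where
      n₁ : rg H₁ rN ≡ n
      n₁ = trans (keepR fr rN refl) hn
      top₁ : rg H₁ rTop ≡ n + 1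
      top₁ = trans (keepR fr rTop refl) (cong (_+ 1) hn)
      Inv₁ : ℕ → Store → Set
      Inv₁ j H′ = ∀ c → c < j → ar H′ aZ c ≡ 0
      step₁ : Step rV zeroBody Inv₁ (n + 1) H₁
      step₁ j H₂ _ rj fr₂ zeros = tt , extend (λ c p → trans (upd-other (ar H₂ aZ) 0 (λ z → <⇒≢ p (trans z rj))) (zeros c p))
                                              (trans (cong (λ y → (ar H₂ aZ [ y ↦ 0 ]) j) rj) (upd-same (ar H₂ aZ) j 0))
      next₁ : ∀ H₂ → Inv₁ (n + 1) H₂ → LoopFrame rV zeroBody H₁ H₂ → _
      next₁ H₂ zeros fr₂ = WP-for bd-n rU rN bucketBody Inv₂ n (trans (keepR fr₂ rN refl) n₁) ≤-refl zeros step₂ next₂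
        where
        Inv₂ : ℕ → Store → Set
        Inv₂ j H′ = ∀ c → c < n + 1 → ar H′ aZ c ≡ sum j (λ u → b2n (exact-in R w c u))
        step₂ : Step rU bucketBody Inv₂ n H₂
        step₂ j H₃ j<n rj fr₃ inv = partial≤B (suc j) (exact-in R w (codeg R j)) j<n value , cells
          where
          rw₃ : rg H₃ rW ≡ w
          rw₃ = trans (keepR fr₃ rW refl) (trans (keepR fr₂ rW refl) rw)
          Cj : ar H₃ aC (rg H₃ rU) ≡ codeg R j
          Cj = trans (cong (ar H₃ aC) rj) (trans (keepA fr₃ aC j refl) (trans (keepA fr₂ aC j refl) (trans (keepA fr aC j refl) (hC j j<n))))
          Rj : ar H₃ aR (rg H₃ rU) ≡ b2n (R j)
          Rj = trans (cong (ar H₃ aR) rj) (trans (keepA fr₃ aR j refl) (trans (keepA fr₂ aR j refl) (trans (keepA fr aR j refl) (hR j j<n))))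
          codeg≤n : codeg R j < n + 1
          codeg≤n = ≤-trans (s≤s (#≤n _)) (≤-reflexive (+-comm 1 n))
          term : ar H₃ aR (rg H₃ rU) * b2n (E (rg H₃ rU) (rg H₃ rW)) ≡ b2n (exact-in R w (codeg R j) j)
          term = trans (cong₂ _*_ Rj (cong₂ (λ x y → b2n (E x y)) rj rw₃)) (trans (b2n-∧ (R j) (E j w))
                   (sym (trans (cong (λ x → b2n (R j ∧ (E j w ∧ x))) (≡ᵇ-refl (codeg R j))) (cong (λ x → b2n (R j ∧ x)) (∧-true (E j w))))))
            where
            ∧-true : ∀ x → x ∧ true ≡ x
            ∧-true true  = refl
            ∧-true false = refl
          new = ar H₃ aZ (ar H₃ aC (rg H₃ rU)) + ar H₃ aR (rg H₃ rU) * b2n (E (rg H₃ rU) (rg H₃ rW))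
          value : new ≡ sum (suc j) (λ u → b2n (exact-in R w (codeg R j) u))
          value = cong₂ _+_ (trans (cong (ar H₃ aZ) Cj) (inv (codeg R j) codeg≤n)) term
          cells : ∀ c → c < n + 1 → (ar H₃ aZ [ ar H₃ aC (rg H₃ rU) ↦ new ]) c ≡ sum (suc j) (λ u → b2n (exact-in R w c u))
          cells c p = trans (cong (λ y → (ar H₃ aZ [ y ↦ new ]) c) Cj) (by-cell (c ≟ codeg R j))
            where
            by-cell : Dec (c ≡ codeg R j) → (ar H₃ aZ [ codeg R j ↦ new ]) c ≡ sum (suc j) (λ u → b2n (exact-in R w c u))
            by-cell (yes refl) = trans (upd-same (ar H₃ aZ) c new) value
            by-cell (no ne) = trans (upd-other (ar H₃ aZ) new ne) (trans (inv c p) (sym (trans (cong (sum j (λ u → b2n (exact-in R w c u)) +_) nothing) (+-identityʳ _))))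
              where
              nothing : b2n (exact-in R w c j) ≡ 0
              nothing = cong b2n (≢true {exact-in R w c j} (λ z → ne (sym (≡ᵇ-true {codeg R j} (∧-right {E j w} (∧-right {R j} z))))))
        next₂ : ∀ H₃ → Inv₂ n H₃ → LoopFrame rU bucketBody H₂ H₃ → _
        next₂ H₃ exact fr₃ = tt , WP-for bd-n+1 rV rTop prefixBody Inv₃ (n + 1)
            (trans (keepR fr₃ rTop refl) (trans (keepR fr₂ rTop refl) top₁)) ≤-refl (refl , (λ _ ()) , old′) step₃ end₃
          where
          Z : ℕ → ℕ
          Z c = # (exact-in R w c)
          old′ : ∀ c v → c ≤ n → v < w → ar H₃ aT (c * n + v) ≡ # (low-in R v (suc c))
          old′ c v p q = trans (keepA fr₃ aT (c * n + v) refl) (trans (keepA fr₂ aT (c * n + v) refl) (old c v p q))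
          Inv₃ : ℕ → Store → Set
          Inv₃ j H′ = rg H′ rS₁ ≡ sum j Z × (∀ c → c < j → ar H′ aT (c * n + w) ≡ # (low-in R w (suc c)))
                      × (∀ c v → c ≤ n → v < w → ar H′ aT (c * n + v) ≡ # (low-in R v (suc c)))
          step₃ : Step rV prefixBody Inv₃ (n + 1) (setR H₃ rS₁ 0)
          step₃ j H₄ j<n+1 rj fr₄ (s , this , others) =
            small-# (low-in R w (suc j)) value′ , tt , value , extend this₁ this₂ , others₁
            where
            x = rg H₄ rS₁ + ar H₄ aZ (rg H₄ rV)
            value : x ≡ sum (suc j) Z
            value = cong₂ _+_ s (trans (cong (ar H₄ aZ) rj) (trans (keepA fr₄ aZ j refl) (exact j j<n+1)))
            value′ : x ≡ # (low-in R w (suc j))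
            value′ = trans value (sum-exact R w (suc j))
            address′ : rg H₄ rV * rg H₄ rN + rg H₄ rW ≡ j * n + w
            address′ = cong₂ _+_ (cong₂ _*_ rj (trans (keepR fr₄ rN refl) (trans (keepR fr₃ rN refl) (trans (keepR fr₂ rN refl) n₁))))
                                (trans (keepR fr₄ rW refl) (trans (keepR fr₃ rW refl) (trans (keepR fr₂ rW refl) rw)))
            other : ∀ {a} → a ≢ j * n + w → (ar H₄ aT [ rg H₄ rV * rg H₄ rN + rg H₄ rW ↦ x ]) a ≡ ar H₄ aT a
            other ne = upd-other (ar H₄ aT) x (λ z → ne (trans z address′))
            this₁ : ∀ c → c < j → (ar H₄ aT [ rg H₄ rV * rg H₄ rN + rg H₄ rW ↦ x ]) (c * n + w) ≡ # (low-in R w (suc c))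
            this₁ c p = trans (other (λ z → <⇒≢ p (*-cancelʳ-≡ c j n (+-cancelʳ-≡ w (c * n) (j * n) z)))) (this c p)
            this₂ : (ar H₄ aT [ rg H₄ rV * rg H₄ rN + rg H₄ rW ↦ x ]) (j * n + w) ≡ # (low-in R w (suc j))
            this₂ = trans (cong (λ y → (ar H₄ aT [ y ↦ x ]) (j * n + w)) address′) (trans (upd-same (ar H₄ aT) (j * n + w) x) value′)
            others₁ : ∀ c v → c ≤ n → v < w → (ar H₄ aT [ rg H₄ rV * rg H₄ rN + rg H₄ rW ↦ x ]) (c * n + v) ≡ # (low-in R v (suc c))
            others₁ c v p q = trans (other (λ z → <⇒≢ q (trans (sym (column c v (<-trans q w<n))) (trans (cong (_% n) z) (column j w w<n))))) (others c v p q)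
          end₃ : ∀ H₄ → Inv₃ (n + 1) H₄ → LoopFrame rV prefixBody (setR H₃ rS₁ 0) H₄ → Inv (suc w) (setR H₄ rW (suc w))
          end₃ H₄ (_ , this , others) _ c v p q with m<1+n⇒m<n∨m≡n q
          ... | inj₁ r    = others c v p r
          ... | inj₂ refl = this c (≤-trans (s≤s p) (≤-reflexive (+-comm 1 n)))

  record Prepared (R : VSet) (H : Store) : Set where
    field
      hn : rg H rN ≡ n
      hR : Holds R H
      hI : Array aI (indeg R) H
      hC : Array aC (codeg R) H
      hT : IsTable R H

  -- States 0 and 1 both count as right, so the bits have no influence on the initial pressures, and
  -- neither does b.
  right-label : ∀ R c b h u → (label R c b h u <ᵇ 2) ≡ R u ∧ (c <ᵇ codeg R u)
  right-label R c b h u with R u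
  ... | false = refl
  ... | true with c <ᵇ codeg R u
  ...   | false = refl
  ...   | true  = <ᵇ-intro {b2n (indeg R u <ᵇ c + b) * x} (s≤s (*-mono-≤ (b2n≤1 (indeg R u <ᵇ c + b)) (s≤s⁻¹ (m%n<n (remaining (window R c b) h u) 2))))
    where x = remaining (window R c b) h u % 2

  label≤3 : ∀ R c b h u → label R c b h u ≤ 3
  label≤3 R c b h u with R u
  ... | false = ≤-refl
  ... | true with c <ᵇ codeg R u
  ...   | false = s≤s (s≤s z≤n)
  ...   | true  = ≤-trans (*-mono-≤ (b2n≤1 (indeg R u <ᵇ c + b)) (s≤s⁻¹ (m%n<n (remaining (window R c b) h u) 2))) (s≤s z≤n)

  small≤B : ∀ {x} → x ≤ 65536 → x ≤ B
  small≤B p = ≤-trans p B-large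

  Spec-label : ∀ {R H c b h} → Prepared R H → rg H rC ≡ c → rg H rB ≡ b → rg H rH₁ ≡ h →
             Spec labelP (λ H′ → Array aSt (label R c b h) H′ × Array aCnt (pressure (label R c b h)) H′) H
  Spec-label {R} {H} {c} {b} {h} pre hc hb hh =
    spec (tt , tt , WP-for bd-n rV rN labelBody Inv n hn ≤-refl ((λ _ ()) , (λ _ ()) , hh) step (λ _ inv _ → proj₁ inv , proj₁ (proj₂ inv)))
    where
    open Prepared pre
    st = label R c b h
    row = if n <ᵇ c then n else c
    hrow : rg (setR (setR H rHH (rg H rH₁)) rRow (if (if rg H rN <ᵇ rg H rC then 1 else 0) ≡ᵇ 0 then rg H rC else rg H rN)) rRow ≡ row
    hrow = trans (if-b2n (rg H rN <ᵇ rg H rC)) (cong₂ (λ x y → if x <ᵇ y then x else y) hn hc)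
    row≤n : row ≤ n
    row≤n with true-or-false (n <ᵇ c)
    ... | inj₁ z rewrite z = ≤-refl
    ... | inj₂ z rewrite z = <ᵇ-false {n} z
    row-cmp : ∀ x → x ≤ n → (x <ᵇ suc row) ≡ not (c <ᵇ x)
    row-cmp x p with true-or-false (n <ᵇ c)
    ... | inj₂ z rewrite z = not-< c x
    ... | inj₁ z rewrite z = trans (<ᵇ-intro (s≤s p)) (sym (cong not (<ᵇ-elimF {c} {x} (≤-trans p (<⇒≤ (<ᵇ-true {n} z))))))
    -- The in-neighbours are split by the degree cut: the right part is the pressure, the other part
    -- is the table entry.
    balance : ∀ v → indeg R v ≡ pressure st v + # (low-in R v (suc row))
    balance v = trans (sum-cong n (λ u _ → pointwise u)) (sum-+ n _ _)
      where
      pointwise : ∀ u → b2n (R u ∧ E u v) ≡ b2n ((st u <ᵇ 2) ∧ E u v) + b2n (low-in R v (suc row) u)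
      pointwise u = trans (split (R u) (E u v) (c <ᵇ codeg R u))
        (sym (cong₂ (λ x y → b2n (x ∧ E u v) + b2n (R u ∧ (E u v ∧ y))) (right-label R c b h u) (row-cmp (codeg R u) (#≤n _))))
        where
        split : ∀ r e x → b2n (r ∧ e) ≡ b2n ((r ∧ x) ∧ e) + b2n (r ∧ (e ∧ not x))
        split false e     x     = refl
        split true  false true  = refl
        split true  false false = refl
        split true  true  true  = refl
        split true  true  false = refl
    Inv : ℕ → Store → Set
    Inv i H′ = (∀ v → v < i → ar H′ aSt v ≡ st v) × (∀ v → v < i → ar H′ aCnt v ≡ pressure st v) × rg H′ rHH ≡ remaining (window R c b) h i
    H₀ = setR (setR H rHH (rg H rH₁)) rRow (if (if rg H rN <ᵇ rg H rC then 1 else 0) ≡ᵇ 0 then rg H rC else rg H rN)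
    step : Step rV labelBody Inv n H₀
    step i H₁ i<n ri fr (sts , cnts , rem) =
      tt , subst (_≤ B) (sym win) (≤-trans (b2n≤1 (window R c b i)) (small≤B (s≤s z≤n)))
         , subst (_≤ B) (sym code) (≤-trans (label≤3 R c b h i) (small≤B (s≤s (s≤s (s≤s z≤n))))) , tt
         , extend (λ v p → trans (other aSt v p) (sts v p)) (new aSt code)
         , extend (λ v p → trans (other aCnt v p) (cnts v p)) (new aCnt count)
         , trans (cong (λ w → if w ≡ᵇ 0 then rg H₁ rHH else rg H₁ rHH / 2) win)
                 (trans (if-b2n (window R c b i)) (cong (λ x → if window R c b i then x / 2 else x) rem))
      where
      v = rg H₁ rV
      other : ∀ j {x} w → w < i → (ar H₁ j [ v ↦ x ]) w ≡ ar H₁ j w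
      other j {x} w p = upd-other (ar H₁ j) x (λ z → <⇒≢ p (trans z ri))
      new : ∀ j {x y} → x ≡ y → (ar H₁ j [ v ↦ x ]) i ≡ y
      new j {x} q = trans (cong (λ a → (ar H₁ j [ a ↦ x ]) i) ri) (trans (upd-same (ar H₁ j) i x) q)
      Ri : ar H₁ aR v ≡ b2n (R i)
      Ri = trans (cong (ar H₁ aR) ri) (trans (keepA fr aR i refl) (hR i i<n))
      Ii : ar H₁ aI v ≡ indeg R i
      Ii = trans (cong (ar H₁ aI) ri) (trans (keepA fr aI i refl) (hI i i<n))
      Ci : ar H₁ aC v ≡ codeg R i
      Ci = trans (cong (ar H₁ aC) ri) (trans (keepA fr aC i refl) (hC i i<n))
      c₁ : rg H₁ rC ≡ c
      c₁ = trans (keepR fr rC refl) hc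
      b₁ : rg H₁ rB ≡ b
      b₁ = trans (keepR fr rB refl) hb
      Ti : ar H₁ aT (rg H₁ rRow * rg H₁ rN + v) ≡ # (low-in R i (suc row))
      Ti = trans (cong (ar H₁ aT) (cong₂ _+_ (cong₂ _*_ (trans (keepR fr rRow refl) hrow) (trans (keepR fr rN refl) hn)) ri))
                 (trans (keepA fr aT (row * n + i) refl) (hT row i row≤n i<n))
      count : ar H₁ aI v ∸ ar H₁ aT (rg H₁ rRow * rg H₁ rN + v) ≡ pressure st i
      count = trans (cong₂ _∸_ (trans Ii (balance i)) Ti) (m+n∸n≡m (pressure st i) (# (low-in R i (suc row))))
      win : ar H₁ aR v * (b2n (rg H₁ rC <ᵇ ar H₁ aC v) * b2n (ar H₁ aI v <ᵇ rg H₁ rC + rg H₁ rB)) ≡ b2n (window R c b i)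
      win = trans (cong₂ _*_ Ri (trans (cong₂ _*_ (cong₂ (λ x y → b2n (x <ᵇ y)) c₁ Ci) (cong₂ (λ x y → b2n (x <ᵇ y)) Ii (cong₂ _+_ c₁ b₁)))
                                       (b2n-∧ (c <ᵇ codeg R i) (indeg R i <ᵇ c + b))))
                  (b2n-∧ (R i) _)
      w = ar H₁ aR v * (b2n (rg H₁ rC <ᵇ ar H₁ aC v) * b2n (ar H₁ aI v <ᵇ rg H₁ rC + rg H₁ rB))
      code : (if ar H₁ aR v ≡ᵇ 0 then 3 else (if b2n (rg H₁ rC <ᵇ ar H₁ aC v) ≡ᵇ 0 then 2 else w * (rg H₁ rHH % 2))) ≡ st i
      code = trans (cong₂ (λ x y → if x ≡ᵇ 0 then 3 else y) Ri
                 (trans (cong₂ (λ x y → if x ≡ᵇ 0 then 2 else y) (cong₂ (λ x y → b2n (x <ᵇ y)) c₁ Ci) (cong₂ (λ x y → x * (y % 2)) win rem))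
                        (if-b2n (c <ᵇ codeg R i))))
                 (if-b2n (R i))

  record Tracks (st : Status) (h : ℕ) (H : Store) : Set where
    constructor tracks
    field
      onN   : rg H rN ≡ n
      onSt  : Array aSt st H
      onCnt : Array aCnt (pressure st) H
      onHH  : rg H rHH ≡ h

  -- Only the term of t changes, and with a new state of at least 2 it vanishes. This is the O(n)
  -- update that replaces a recount.
  pressure-upd : ∀ st t x v → t < n → (x <ᵇ 2) ≡ false → pressure st v ≡ pressure (st [ t ↦ x ]) v + b2n (st t <ᵇ 2) * b2n (E t v)
  pressure-upd st t x v t<n x≥2 = begin
    pressure st v                                       ≡⟨ sum-cong n (λ u _ → pointwise u) ⟩
    sum n (λ u → b2n (((st [ t ↦ x ]) u <ᵇ 2) ∧ E u v) + y * b2n (u ≡ᵇ t)) ≡⟨ sum-+ n _ _ ⟩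
    pressure (st [ t ↦ x ]) v + sum n (λ u → y * b2n (u ≡ᵇ t))             ≡⟨ cong (pressure (st [ t ↦ x ]) v +_) (trans (sum-* n y (λ u → b2n (u ≡ᵇ t))) (trans (cong (y *_) (sum-δ t<n)) (*-identityʳ y))) ⟩
    pressure (st [ t ↦ x ]) v + y                       ∎
    where
    open ≡-Reasoning
    y = b2n (st t <ᵇ 2) * b2n (E t v)
    pointwise : ∀ u → b2n ((st u <ᵇ 2) ∧ E u v) ≡ b2n (((st [ t ↦ x ]) u <ᵇ 2) ∧ E u v) + y * b2n (u ≡ᵇ t)
    pointwise u with u ≡ᵇ t in z
    ... | false = sym (trans (cong (b2n ((st u <ᵇ 2) ∧ E u v) +_) (*-zeroʳ y)) (+-identityʳ _))
    ... | true with ≡ᵇ-true {u} z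
    ...   | refl = sym (trans (cong₂ (λ a b → b2n (a ∧ E u v) + b) x≥2 (*-identityʳ y)) (b2n-∧ (st u <ᵇ 2) (E u v)))

  chosen≤n : ∀ st h → chosen st h ≤ n
  chosen≤n st h with pending st ≡ᵇ 0
  ... | false = find≤ n _
  ... | true with violated st ≡ᵇ 0
  ...   | true  = z≤n
  ...   | false with h % 2 ≡ᵇ 0
  ...     | true  = find≤ n _
  ...     | false = find≤ n _

  Spec-round : ∀ {st h H} → Tracks st h H → Spec roundP (Tracks (move st h) (advice st h)) H
  Spec-round {st} {h} {H} (tracks hn hs hp hh) =
    spec (tt , tt , WP-for bd-n rV rN searchBody Inv n hn ≤-refl (refl , refl) step next)
    where
    isP isQ isU : ℕ → Bool
    isP v = st v ≡ᵇ 1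
    isQ v = (st v ≡ᵇ 2) ∧ (0 <ᵇ pressure st v)
    isU v = (st v <ᵇ 2) ∧ E v (violated st ∸ 1)
    found : ∀ {i x z} (P : ℕ → Bool) → x ≡ b2n (P i) → z ≡ find i P → ∀ {v} → v ≡ i → (if x ≡ᵇ 0 then z else v + 1) ≡ find (suc i) P
    found {i} P refl refl refl = trans (if-b2n (P i)) (cong (λ y → if P i then y else find i P) (+-comm i 1))
    fits : ∀ {i x} (P : ℕ → Bool) → i < n → x ≡ find (suc i) P → x ≤ B
    fits P p q = ≤-trans (≤-reflexive q) (≤-trans (find≤ _ P) (≤-trans p n≤B))
    H₀ = setR (setR H rP 0) rQ 0
    Inv : ℕ → Store → Set
    Inv i H′ = rg H′ rP ≡ find i isP × rg H′ rQ ≡ find i isQ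
    step : Step rV searchBody Inv n H₀
    step i H₁ i<n ri fr (p , q) = fits isP i<n p′ , fits isQ i<n q′ , p′ , q′
      where
      v = rg H₁ rV
      si : ar H₁ aSt v ≡ st i
      si = trans (cong (ar H₁ aSt) ri) (trans (keepA fr aSt i refl) (hs i i<n))
      ci : ar H₁ aCnt v ≡ pressure st i
      ci = trans (cong (ar H₁ aCnt) ri) (trans (keepA fr aCnt i refl) (hp i i<n))
      p′ : (if b2n (ar H₁ aSt v ≡ᵇ 1) ≡ᵇ 0 then rg H₁ rP else v + 1) ≡ find (suc i) isP
      p′ = found isP (cong (λ x → b2n (x ≡ᵇ 1)) si) p ri
      q′ : (if b2n (ar H₁ aSt v ≡ᵇ 2) * b2n (0 <ᵇ ar H₁ aCnt v) ≡ᵇ 0 then rg H₁ rQ else v + 1) ≡ find (suc i) isQ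
      q′ = found isQ (trans (cong₂ (λ x y → b2n (x ≡ᵇ 2) * b2n (0 <ᵇ y)) si ci) (b2n-∧ (st i ≡ᵇ 2) (0 <ᵇ pressure st i))) q ri
    next : ∀ H₁ → Inv n H₁ → LoopFrame rV searchBody H₀ H₁ → _
    next H₁ (p , q) fr = tt , WP-for bd-n rV rN culpritBody Inv₂ n (trans (keepR fr rN refl) hn) ≤-refl refl step₂ next₂
      where
      H₁′ = setR H₁ rCul 0
      Inv₂ : ℕ → Store → Set
      Inv₂ i H′ = rg H′ rCul ≡ find i isU
      step₂ : Step rV culpritBody Inv₂ n H₁′
      step₂ i H₂ i<n ri fr₂ u = fits isU i<n u′ , u′
        where
        v = rg H₂ rV
        si : ar H₂ aSt v ≡ st i
        si = trans (cong (ar H₂ aSt) ri) (trans (keepA fr₂ aSt i refl) (trans (keepA fr aSt i refl) (hs i i<n)))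
        u′ : (if b2n (ar H₂ aSt v <ᵇ 2) * b2n (E v (rg H₂ rQ ∸ 1)) ≡ᵇ 0 then rg H₂ rCul else v + 1) ≡ find (suc i) isU
        u′ = found isU (trans (cong₂ (λ x y → b2n (x <ᵇ 2) * b2n y) si (cong₂ (λ x y → E x (y ∸ 1)) ri (trans (keepR fr₂ rQ refl) q))) (b2n-∧ (st i <ᵇ 2) (E i (violated st ∸ 1)))) u ri
      next₂ : ∀ H₂ → Inv₂ n H₂ → LoopFrame rV culpritBody H₁′ H₂ → _
      next₂ H₂ u fr₂ = tt , tt , tt , nonzero , zero′
        where
        p₂ : rg H₂ rP ≡ pending st
        p₂ = trans (keepR fr₂ rP refl) p
        q₂ : rg H₂ rQ ≡ violated st
        q₂ = trans (keepR fr₂ rQ refl) q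
        h₂ : rg H₂ rHH ≡ h
        h₂ = trans (keepR fr₂ rHH refl) (trans (keepR fr rHH refl) hh)
        n₂ : rg H₂ rN ≡ n
        n₂ = trans (keepR fr₂ rN refl) (trans (keepR fr rN refl) hn)
        s₂ : Array aSt st H₂
        s₂ v r = trans (keepA fr₂ aSt v refl) (trans (keepA fr aSt v refl) (hs v r))
        c₂ : Array aCnt (pressure st) H₂
        c₂ v r = trans (keepA fr₂ aCnt v refl) (trans (keepA fr aCnt v refl) (hp v r))
        t₀ = if rg H₂ rP ≡ᵇ 0 then (if rg H₂ rQ ≡ᵇ 0 then 0 else (if rg H₂ rHH % 2 ≡ᵇ 0 then rg H₂ rCul else rg H₂ rQ)) else rg H₂ rP
        t≡ : t₀ ≡ chosen st h
        t≡ = trans (cong₂ (λ x y → if x ≡ᵇ 0 then (if y ≡ᵇ 0 then 0 else (if rg H₂ rHH % 2 ≡ᵇ 0 then rg H₂ rCul else y)) else x) p₂ q₂)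
                   (cong₂ (λ x y → if pending st ≡ᵇ 0 then (if violated st ≡ᵇ 0 then 0 else (if x % 2 ≡ᵇ 0 then y else violated st)) else pending st) h₂ u)
        new = if rg H₂ rP ≡ᵇ 0 then 4 else 2
        new≡ : new ≡ (if pending st ≡ᵇ 0 then 4 else 2)
        new≡ = cong (λ x → if x ≡ᵇ 0 then 4 else 2) p₂
        hh′ = if rg H₂ rP ≡ᵇ 0 then (if rg H₂ rQ ≡ᵇ 0 then rg H₂ rHH else rg H₂ rHH / 2) else rg H₂ rHH
        hh≡ : hh′ ≡ advice st h
        hh≡ = trans (cong₂ (λ x y → if x ≡ᵇ 0 then (if y ≡ᵇ 0 then rg H₂ rHH else rg H₂ rHH / 2) else rg H₂ rHH) p₂ q₂)
                    (cong (λ x → if pending st ≡ᵇ 0 then (if violated st ≡ᵇ 0 then x else x / 2) else x) h₂)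
        H₃ = setR (setR (setR H₂ rT t₀) rNew new) rHH hh′
        stays : chosen st h ≡ 0 → move st h ≡ st
        stays z = cong (λ c → if c ≡ᵇ 0 then st else st [ c ∸ 1 ↦ (if pending st ≡ᵇ 0 then 4 else 2) ]) z
        zero′ : t₀ ≡ 0 → Tracks (move st h) (advice st h) H₃
        zero′ z = subst (λ s → Tracks s (advice st h) H₃) (sym (stays (trans (sym t≡) z))) (tracks n₂ s₂ c₂ hh≡)
        nonzero : t₀ ≢ 0 → _
        nonzero nz = tt , tt , WP-for bd-n rW rN shiftBody Inv₃ n n₂ ≤-refl ((λ _ ()) , (λ v _ → c₂ v)) step₃ end₃
          where
          t = t₀ ∸ 1
          moved : Σ ℕ (λ c → chosen st h ≡ suc c)
          moved with chosen st h in z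
          ... | zero  = ⊥-elim (nz (trans t≡ z))
          ... | suc c = c , refl
          t≡c : t ≡ proj₁ moved
          t≡c = cong (_∸ 1) (trans t≡ (proj₂ moved))
          t<n : t < n
          t<n = ≤-trans (s≤s (≤-reflexive t≡c)) (subst (_≤ n) (proj₂ moved) (chosen≤n st h))
          move≡ : move st h ≡ st [ t ↦ new ]
          move≡ = trans (cong (λ c → if c ≡ᵇ 0 then st else st [ c ∸ 1 ↦ (if pending st ≡ᵇ 0 then 4 else 2) ]) (proj₂ moved))
                        (cong₂ (λ a b → st [ a ↦ b ]) (sym t≡c) (sym new≡))
          new≥2 : (new <ᵇ 2) ≡ false
          new≥2 with rg H₂ rP ≡ᵇ 0
          ... | true  = refl
          ... | false = refl
          st′ = st [ t ↦ new ]
          H₄ = setR (setR H₃ rT t) rF (b2n (ar H₂ aSt t <ᵇ 2))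
          Inv₃ : ℕ → Store → Set
          Inv₃ i H′ = (∀ v → v < i → ar H′ aCnt v ≡ pressure st′ v) × (∀ v → i ≤ v → v < n → ar H′ aCnt v ≡ pressure st v)
          step₃ : Step rW shiftBody Inv₃ n H₄
          step₃ i H₅ i<n ri fr₃ (done , ahead) = tt
            , extend (λ v r → trans (upd-other (ar H₅ aCnt) x (λ z → <⇒≢ r (trans z ri))) (done v r))
                     (trans (cong (λ a → (ar H₅ aCnt [ a ↦ x ]) i) ri) (trans (upd-same (ar H₅ aCnt) i x) value))
            , λ v r s → trans (upd-other (ar H₅ aCnt) x (λ z → <⇒≢ r (sym (trans z ri)))) (ahead v (<⇒≤ r) s)
            where
            x = ar H₅ aCnt (rg H₅ rW) ∸ rg H₅ rF * b2n (E (rg H₅ rT) (rg H₅ rW))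
            value : x ≡ pressure st′ i
            value = trans (cong₂ _∸_ (trans (cong (ar H₅ aCnt) ri) (trans (ahead i ≤-refl i<n) (pressure-upd st t new i t<n new≥2)))
                            (cong₂ _*_ (trans (keepR fr₃ rF refl) (cong (λ y → b2n (y <ᵇ 2)) (s₂ t t<n))) (cong₂ (λ a b → b2n (E a b)) (keepR fr₃ rT refl) ri)))
                          (m+n∸n≡m (pressure st′ i) (b2n (st t <ᵇ 2) * b2n (E t i)))
          end₃ : ∀ H₅ → Inv₃ n H₅ → LoopFrame rW shiftBody H₄ H₅ → WP (put aSt (var rT) (var rNew)) (Tracks (move st h) (advice st h)) H₅
          end₃ H₅ (done , _) fr₃ = tt , subst (λ s → Tracks s (advice st h) (setA H₅ aSt (rg H₅ rT) (rg H₅ rNew))) (sym move≡)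
            (tracks (trans (keepR fr₃ rN refl) n₂) sts done (trans (keepR fr₃ rHH refl) hh≡))
            where
            sts : ∀ v → v < n → (ar H₅ aSt [ rg H₅ rT ↦ rg H₅ rNew ]) v ≡ st′ v
            sts v r = trans (cong₂ (λ a b → (ar H₅ aSt [ a ↦ b ]) v) (keepR fr₃ rT refl) (keepR fr₃ rNew refl))
                            (cong (λ y → if v ≡ᵇ t then new else y) (trans (keepA fr₃ aSt v refl) (s₂ v r)))

  record Tallied (st : Status) (H : Store) : Set where
    constructor tallied
    field
      onStatus : Array aSt st H
      onSize   : rg H rSize ≡ # (left st)
      onGone   : rg H rGone ≡ # (gone st)
      onFault  : rg H rFault ≡ faults st

  Spec-tally : ∀ {st h H} → Tracks st h H → Spec tallyP (Tallied st) H
  Spec-tally {st} {h} {H} (tracks hn hs hp hh) =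
    spec (tt , tt , tt , WP-for bd-n rV rN tallyBody Inv n hn ≤-refl (refl , refl , refl) step end)
    where
    H₀ = setR (setR (setR H rSize 0) rGone 0) rFault 0
    bad : VSet
    bad v = left st v ∧ (0 <ᵇ pressure st v)
    Inv : ℕ → Store → Set
    Inv i H′ = rg H′ rSize ≡ sum i (b2n ∘ left st) × rg H′ rGone ≡ sum i (b2n ∘ gone st) × rg H′ rFault ≡ sum i (b2n ∘ bad)
    step : Step rV tallyBody Inv n H₀
    step i H₁ i<n ri fr (a , b , c) =
      partial≤B (suc i) (left st) i<n a′ , partial≤B (suc i) (gone st) i<n b′ , partial≤B (suc i) bad i<n c′ , a′ , b′ , c′
      where
      v = rg H₁ rV
      si : ar H₁ aSt v ≡ st i
      si = trans (cong (ar H₁ aSt) ri) (trans (keepA fr aSt i refl) (hs i i<n))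
      ci : ar H₁ aCnt v ≡ pressure st i
      ci = trans (cong (ar H₁ aCnt) ri) (trans (keepA fr aCnt i refl) (hp i i<n))
      a′ : rg H₁ rSize + b2n (ar H₁ aSt v ≡ᵇ 2) ≡ sum (suc i) (b2n ∘ left st)
      a′ = cong₂ _+_ a (cong (λ x → b2n (x ≡ᵇ 2)) si)
      b′ : rg H₁ rGone + b2n (ar H₁ aSt v ≡ᵇ 4) ≡ sum (suc i) (b2n ∘ gone st)
      b′ = cong₂ _+_ b (cong (λ x → b2n (x ≡ᵇ 4)) si)
      c′ : rg H₁ rFault + b2n (ar H₁ aSt v ≡ᵇ 2) * b2n (0 <ᵇ ar H₁ aCnt v) ≡ sum (suc i) (b2n ∘ bad)
      c′ = cong₂ _+_ c (trans (cong₂ (λ x y → b2n (x ≡ᵇ 2) * b2n (0 <ᵇ y)) si ci) (b2n-∧ (left st i) (0 <ᵇ pressure st i)))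
    end : ∀ H₁ → Inv n H₁ → LoopFrame rV tallyBody H₀ H₁ → Tallied st H₁
    end H₁ (a , b , c) fr = tallied (λ v p → trans (keepA fr aSt v refl) (hs v p)) a b c

  Spec-cut : ∀ {R H c b h h′} → Prepared R H → rg H rC ≡ c → rg H rB ≡ b → rg H rH₁ ≡ h → rg H rH₂ ≡ h′ → b ≤ k →
           Spec cutP (Tallied (cutF R c b h h′)) H
  Spec-cut {R} {H} {c} {b} {h} {h′} pre hc hb h1 h2 b≤k =
    Spec-seq (Spec-label pre hc hb h1) after-label
    where
    open Prepared pre
    s₀ : Status × ℕ
    s₀ = label R c b h , h′
    Inv : ℕ → Store → Set
    Inv i H′ = Tracks (proj₁ (iterate round i s₀)) (proj₂ (iterate round i s₀)) H′
    after-label : ∀ H₁ → Array aSt (label R c b h) H₁ × Array aCnt (pressure (label R c b h)) H₁ → Frame (writesR labelP) (writesA labelP) H H₁ →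
                  Spec (asg rHH (var rH₂) ⨟ asg rRounds (num 6 ⊗ var rB) ⨟ for bd-6k rRound rRounds roundP ⨟ tallyP) (Tallied (cutF R c b h h′)) H₁
    after-label H₁ (sts , cnts) fr =
      spec (tt , ≤-trans (*-monoʳ-≤ 6 b₁≤k) (≤-trans 6k≤ linear)
         , WP-for bd-6k rRound rRounds roundP Inv (6 * b) (cong (6 *_) b₁) (*-monoʳ-≤ 6 b≤k)
             (tracks (trans (keepR fr rN refl) hn) sts cnts (trans (keepR fr rH₂ refl) h2)) step (λ H₂ t _ → wp (Spec-tally t)))
      where
      b₁ : rg H₁ rB ≡ b
      b₁ = trans (keepR fr rB refl) hb
      b₁≤k : rg H₁ rB ≤ k
      b₁≤k = ≤-trans (≤-reflexive b₁) b≤k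
      6k≤ : 6 * k ≤ 16 * (n + k + 1)
      6k≤ = *-mono-≤ {6} {16} (m≤m+n 6 10) (≤-trans (m≤n+m k n) (m≤m+n (n + k) 1))
      step : Step rRound roundP Inv (6 * b) (setR (setR H₁ rHH (rg H₁ rH₂)) rRounds (6 * rg H₁ rB))
      step i H₂ _ _ _ t = wp (Spec-mono {Q = Inv (suc i)} {Q′ = λ H₃ → Inv (suc i) (setR H₃ rRound (suc i))} (λ { H₃ (tracks a b c d) → tracks a b c d }) (Spec-round t))

  Spec-prepare : ∀ {R H} → rg H rN ≡ n → Holds R H → Spec prepareP (λ H′ → Prepared R H′ × rg H′ rTop ≡ n + 1) H
  Spec-prepare {R} {H} hn hR = Spec-seq (Spec-degrees {R} {H} hn hR) after
    where
    after : ∀ H₁ → Array aI (indeg R) H₁ × Array aC (codeg R) H₁ → Frame (writesR degreesP) (writesA degreesP) H H₁ →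
            Spec tableP (λ H′ → Prepared R H′ × rg H′ rTop ≡ n + 1) H₁
    after H₁ (hi , hc) fr = Spec-frame (Spec-table {R} {H₁} n₁ r₁ hc) (λ H₂ post fr₂ → record
      { hn = trans (keepR fr₂ rN refl) n₁
      ; hR = λ v p → trans (keepA fr₂ aR v refl) (r₁ v p)
      ; hI = λ v p → trans (keepA fr₂ aI v refl) (hi v p)
      ; hC = λ v p → trans (keepA fr₂ aC v refl) (hc v p)
      ; hT = proj₁ post } , proj₂ post)
      where
      n₁ : rg H₁ rN ≡ n
      n₁ = trans (keepR fr rN refl) hn
      r₁ : Holds R H₁
      r₁ v p = trans (keepA fr aR v refl) (hR v p)

  Prepared-frame : ∀ {R rs as H H′} → Prepared R H → Frame rs as H H′ → (rN ∈ᵇ rs) ≡ false →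
                   (aR ∈ᵇ as) ≡ false → (aI ∈ᵇ as) ≡ false → (aC ∈ᵇ as) ≡ false → (aT ∈ᵇ as) ≡ false → Prepared R H′
  Prepared-frame p fr a b c d e = record
    { hn = trans (keepR fr rN a) hn
    ; hR = λ v q → trans (keepA fr aR v b) (hR v q)
    ; hI = λ v q → trans (keepA fr aI v c) (hI v q)
    ; hC = λ v q → trans (keepA fr aC v d) (hC v q)
    ; hT = λ x v q r → trans (keepA fr aT (x * n + v) e) (hT x v q r) }
    where open Prepared p

  Prepared-same : ∀ {R H H′} → Prepared R H → rg H′ rN ≡ rg H rN → (∀ j i → ar H′ j i ≡ ar H j i) → Prepared R H′
  Prepared-same p q f = record
    { hn = trans q hn
    ; hR = λ v r → trans (f aR v) (hR v r)
    ; hI = λ v r → trans (f aI v) (hI v r)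
    ; hC = λ v r → trans (f aC v) (hC v r)
    ; hT = λ x v r s → trans (f aT (x * n + v)) (hT x v r s) }
    where open Prepared p

  bool≤B : ∀ {x} b → x ≡ b2n b → x ≤ B
  bool≤B b q = small≤B (≤-trans (≤-reflexive q) (≤-trans (b2n≤1 b) (s≤s z≤n)))

  Spec-strip : ∀ {R H} → rg H rN ≡ n → rg H rL ≡ ℓ → Holds R H → Spec stripP (Holds (stripF R)) H
  Spec-strip {R} {H} hn hL hR = Spec-seq (Spec-prepare {R} {H} hn hR) after
    where
    Inv : ℕ → Store → Set
    Inv i H′ = rg H′ rLast ≡ proj₁ (scan R i) × rg H′ rSLast ≡ proj₂ (scan R i)
    after : ∀ H₁ → Prepared R H₁ × rg H₁ rTop ≡ n + 1 → Frame (writesR prepareP) (writesA prepareP) H H₁ → _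
    after H₁ (pre , top) fr = spec (tt , tt , tt , tt , tt ,
      WP-for bd-n+1 rScan rTop scanBody Inv (n + 1) top ≤-refl (refl , refl) step next)
      where
      H₂ = setR (setR (setR (setR (setR H₁ rB 0) rH₁ 0) rH₂ 0) rLast 0) rSLast 0
      pre₂ : Prepared R H₂
      pre₂ = Prepared-same pre refl (λ _ _ → refl)
      step : Step rScan scanBody Inv (n + 1) H₂
      step i H₃ i<n+1 ri fr₃ (last , slast) = tt , bind cutP {H = H₃′}
        (wp (Spec-cut {R} {H₃′} {i} {0} {0} {0} (Prepared-same pre₃ refl (λ _ _ → refl)) ri (keepR fr₃ rB refl) (keepR fr₃ rH₁ refl) (keepR fr₃ rH₂ refl) z≤n)) cut
        where
        pre₃ : Prepared R H₃
        pre₃ = Prepared-frame pre₂ fr₃ refl refl refl refl refl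
        H₃′ = setR H₃ rC (rg H₃ rScan)
        cut : ∀ H₄ → Tallied (cutF R i 0 0 0) H₄ → Frame (writesR cutP) (writesA cutP) H₃′ H₄ →
              WP (asg rOk ((var rFault ≐ num 0) ⊗ (var rSize ≺ num 1 ⊕ (var rSLast ⊕ var rL))) ⨟
                  asg rSLast (ite (var rOk) (var rSize) (var rSLast)) ⨟
                  asg rLast (ite (var rOk) (num 1 ⊕ var rC) (var rLast))) (λ H″ → Inv (suc i) (setR H″ rScan (suc i))) H₄
        cut H₄ (tallied sts size gn fault) fr₄ =
          bool≤B ok ok≡ , tt , ≤-trans (≤-reflexive last′) last≤ , last′ , slast′
          where
          ok = free R i (proj₂ (scan R i))
          L₄ : rg H₄ rL ≡ ℓ
          L₄ = trans (keepR fr₄ rL refl) (trans (keepR fr₃ rL refl) (trans (keepR fr rL refl) hL))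
          sl₄ : rg H₄ rSLast ≡ proj₂ (scan R i)
          sl₄ = trans (keepR fr₄ rSLast refl) slast
          c₄ : rg H₄ rC ≡ i
          c₄ = trans (keepR fr₄ rC refl) ri
          x = b2n (rg H₄ rFault ≡ᵇ 0) * b2n (rg H₄ rSize <ᵇ suc (rg H₄ rSLast + rg H₄ rL))
          ok≡ : x ≡ b2n ok
          ok≡ = trans (cong₂ (λ a b → b2n (a ≡ᵇ 0) * b2n b) fault (cong₂ (λ a b → a <ᵇ suc b) size (cong₂ _+_ sl₄ L₄))) (b2n-∧ (faults (cutF R i 0 0 0) ≡ᵇ 0) _)
          pick : ∀ {A : Set} (f : ℕ × ℕ → A) {y z} → y ≡ f (suc i , # (left (cutF R i 0 0 0))) → z ≡ f (scan R i) → (if x ≡ᵇ 0 then z else y) ≡ f (scan R (suc i))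
          pick f {y} {z} p q = trans (cong (λ a → if a ≡ᵇ 0 then z else y) ok≡) (trans (if-b2n ok) (distribute ok p q))
            where
            distribute : ∀ b {y z} → y ≡ f (suc i , # (left (cutF R i 0 0 0))) → z ≡ f (scan R i) →
                         (if b then y else z) ≡ f (if b then (suc i , # (left (cutF R i 0 0 0))) else scan R i)
            distribute true  p q = p
            distribute false p q = q
          slast′ : (if x ≡ᵇ 0 then rg H₄ rSLast else rg H₄ rSize) ≡ proj₂ (scan R (suc i))
          slast′ = pick proj₂ size sl₄
          last′ : (if x ≡ᵇ 0 then rg H₄ rLast else suc (rg H₄ rC)) ≡ proj₁ (scan R (suc i))
          last′ = pick proj₁ (cong suc c₄) (trans (keepR fr₄ rLast refl) last)
          last≤ : proj₁ (scan R (suc i)) ≤ B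
          last≤ = ≤-trans (Scanned.l≤m (scanned R (suc i))) (≤-trans i<n+1 n+1≤B)
      next : ∀ H₃ → Inv (n + 1) H₃ → LoopFrame rScan scanBody H₂ H₃ → WP (for bd-n rV rN keepBody) (Holds (stripF R)) H₃
      next H₃ (last , _) fr₃ = WP-for bd-n rV rN keepBody Inv₂ n (Prepared.hn pre₃) ≤-refl ((λ _ ()) , (λ v _ → Prepared.hR pre₃ v)) step₂ (λ _ inv _ → proj₁ inv)
        where
        pre₃ : Prepared R H₃
        pre₃ = Prepared-frame pre₂ fr₃ refl refl refl refl refl
        last₃ : rg H₃ rLast ≡ proj₁ (scan R (suc n))
        last₃ = trans last (cong (λ m → proj₁ (scan R m)) (+-comm n 1))
        Inv₂ : ℕ → Store → Set
        Inv₂ i H′ = (∀ v → v < i → ar H′ aR v ≡ b2n (stripF R v)) × (∀ v → i ≤ v → v < n → ar H′ aR v ≡ b2n (R v))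
        step₂ : Step rV keepBody Inv₂ n H₃
        step₂ i H₄ i<n ri fr₄ (done , ahead) = bool≤B (stripF R i) value
          , extend (λ v p → trans (upd-other (ar H₄ aR) x (λ z → <⇒≢ p (trans z ri))) (done v p))
                   (trans (cong (λ a → (ar H₄ aR [ a ↦ x ]) i) ri) (trans (upd-same (ar H₄ aR) i x) value))
          , λ v p q → trans (upd-other (ar H₄ aR) x (λ z → <⇒≢ p (sym (trans z ri)))) (ahead v (<⇒≤ p) q)
          where
          x = ar H₄ aR (rg H₄ rV) * (1 ∸ b2n (ar H₄ aC (rg H₄ rV) <ᵇ rg H₄ rLast))
          value : x ≡ b2n (stripF R i)
          value = trans (cong₂ _*_ (trans (cong (ar H₄ aR) ri) (ahead i ≤-refl i<n))
                          (trans (cong₂ (λ a b → 1 ∸ b2n (a <ᵇ b)) (trans (cong (ar H₄ aC) ri) (trans (keepA fr₄ aC i refl) (Prepared.hC pre₃ i i<n))) (trans (keepR fr₄ rLast refl) last₃))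
                                 (b2n-not (codeg R i <ᵇ proj₁ (scan R (suc n))))))
                        (b2n-∧ (R i) _)

  2^≤B : ∀ x → x ≤ 15 * k → 2 ^ x ≤ B
  2^≤B x p = ≤-trans (^-monoʳ-≤ 2 p) exponential

  record Digits (b g : ℕ) (H : Store) : Set where
    constructor digits
    field
      dB   : rg H rB ≡ b
      dM   : rg H rM ≡ ⟦ mod ⟧ g (b + 2)
      dOff : rg H rOff ≡ ⟦ mod ⟧ (rem₁ b g) (4 * b + 1)
      dH₁  : rg H rH₁ ≡ ⟦ mod ⟧ (rem₂ b g) (2 ^ (5 * b ∸ 2))
      dH₂  : rg H rH₂ ≡ ⟦ mod ⟧ (rem₃ b g) (2 ^ b)
      dI₁  : rg H rI₁ ≡ ⟦ mod ⟧ (rem₄ b g) (2 ^ (5 * b ∸ 2))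
      dI₂  : rg H rI₂ ≡ ⟦ mod ⟧ (rem₅ b g) (2 ^ b)
      dG   : rg H rG ≡ rem₆ b g

  -- The registers are variables here, so their distinctness enters as Boolean equations, which are
  -- `refl` at every use.
  Spec-digit : ∀ r q {H g m} → (rG ≡ᵇ r) ≡ false → (q ≡ᵇ r) ≡ false → (r ≡ᵇ rG) ≡ false → rg H rG ≡ g → rg H q ≡ m →
               Spec (digitP r q) (λ H′ → rg H′ r ≡ ⟦ mod ⟧ g m × rg H′ rG ≡ ⟦ div ⟧ g m) H
  Spec-digit r q {H} {g} {m} x y z hg hq = spec (tt , tt , kept , cong₂ ⟦ div ⟧ same-g same-q)
    where
    d = ⟦ mod ⟧ (rg H rG) (rg H q)
    same-g : (rg H [ r ↦ d ]) rG ≡ g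
    same-g = trans (cong (λ b → if b then d else rg H rG) x) hg
    same-q : (rg H [ r ↦ d ]) q ≡ m
    same-q = trans (cong (λ b → if b then d else rg H q) y) hq
    kept : ∀ {v} → ((rg H [ r ↦ d ]) [ rG ↦ v ]) r ≡ ⟦ mod ⟧ g m
    kept {v} = trans (cong (λ b → if b then v else (rg H [ r ↦ d ]) r) z) (trans (upd-same (rg H) r d) (cong₂ ⟦ mod ⟧ hg hq))

  record Moduli (b g : ℕ) (H : Store) : Set where
    constructor moduli
    field
      mB   : rg H rB ≡ b
      m₁   : rg H rMod₁ ≡ b + 2
      m₂   : rg H rMod₂ ≡ 4 * b + 1
      mBig : rg H rBig ≡ 2 ^ (5 * b ∸ 2)
      mOne : rg H rOne ≡ 2 ^ b
      mG   : rg H rG ≡ g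

  Spec-moduli : ∀ {H b g} → rg H rCredit ≡ suc b → rg H rPow ≡ 2 ^ b → rg H rG ≡ g → suc b ≤ k → Spec moduliP (Moduli (suc b) g) H
  Spec-moduli {H} {b} {g} hb hp hg b<k = spec
    ( tt
    , subst (λ x → x + 2 ≤ B) (*-identityˡ (rg H rCredit)) (small-multiple 1 2 (s≤s z≤n) (m≤m+n 2 14)) , small-multiple 4 1 (m≤m+n 4 12) (s≤s z≤n)
    , subst (_≤ B) (sym big) (2^≤B (5 * suc b ∸ 2) (≤-trans (m∸n≤m (5 * suc b) 2) (*-mono-≤ (m≤m+n 5 10) b<k)))
    , subst (_≤ B) (cong (2 *_) (sym hp)) (2^≤B (suc b) (≤-trans b<k (m≤n*m k 15)))
    , moduli hb (cong (_+ 2) hb) (cong (λ x → 4 * x + 1) hb) big (cong (2 *_) hp) hg)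
    where
    big : 8 * ((rg H rPow * rg H rPow) * ((rg H rPow * rg H rPow) * rg H rPow)) ≡ 2 ^ (5 * suc b ∸ 2)
    big = trans (cong (λ p → 8 * ((p * p) * ((p * p) * p))) hp) (2^-product b)
    small-multiple : ∀ x y → x ≤ 16 → y ≤ 16 → x * rg H rCredit + y ≤ B
    small-multiple x y p q = ≤-trans (+-mono-≤ (*-mono-≤ p (≤-trans (≤-reflexive hb) (≤-trans b<k (m≤n+m k n)))) q)
      (≤-trans (≤-reflexive (sym (*-distribˡ-+ 16 (n + k) 1))) linear)

  Spec-digits : ∀ {H b g} → rg H rCredit ≡ suc b → rg H rPow ≡ 2 ^ b → rg H rG ≡ g → suc b ≤ k → Spec digitsP (Digits (suc b) g) H
  Spec-digits {H} {b′} {g} hb hp hg b<k =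
    Spec-seq (Spec-moduli {H} {b′} {g} hb hp hg b<k) (λ { H₁ (moduli hB m₁ m₂ big one g₀) f₁ →
    Spec-seq (Spec-digit rM rMod₁ {H₁} refl refl refl g₀ m₁) (λ { H₂ (d₁ , g₁) f₂ →
    Spec-seq (Spec-digit rOff rMod₂ {H₂} refl refl refl g₁ (trans (keepR f₂ rMod₂ refl) m₂)) (λ { H₃ (d₂ , g₂) f₃ →
    Spec-seq (Spec-digit rH₁ rBig {H₃} refl refl refl g₂ (trans (keepR f₃ rBig refl) (trans (keepR f₂ rBig refl) big))) (λ { H₄ (d₃ , g₃) f₄ →
    Spec-seq (Spec-digit rH₂ rOne {H₄} refl refl refl g₃ (trans (keepR f₄ rOne refl) (trans (keepR f₃ rOne refl) (trans (keepR f₂ rOne refl) one)))) (λ { H₅ (d₄ , g₄) f₅ →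
    Spec-seq (Spec-digit rI₁ rBig {H₅} refl refl refl g₄ (trans (keepR f₅ rBig refl) (trans (keepR f₄ rBig refl) (trans (keepR f₃ rBig refl) (trans (keepR f₂ rBig refl) big))))) (λ { H₆ (d₅ , g₅) f₆ →
    Spec-frame (Spec-digit rI₂ rOne {H₆} refl refl refl g₅ (trans (keepR f₆ rOne refl) (trans (keepR f₅ rOne refl) (trans (keepR f₄ rOne refl) (trans (keepR f₃ rOne refl) (trans (keepR f₂ rOne refl) one)))))) (λ { H₇ (d₆ , g₆) f₇ → digits
      (trans (keepR f₇ rB refl) (trans (keepR f₆ rB refl) (trans (keepR f₅ rB refl) (trans (keepR f₄ rB refl) (trans (keepR f₃ rB refl) (trans (keepR f₂ rB refl) hB))))))
      (trans (keepR f₇ rM refl) (trans (keepR f₆ rM refl) (trans (keepR f₅ rM refl) (trans (keepR f₄ rM refl) (trans (keepR f₃ rM refl) d₁)))))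
      (trans (keepR f₇ rOff refl) (trans (keepR f₆ rOff refl) (trans (keepR f₅ rOff refl) (trans (keepR f₄ rOff refl) d₂))))
      (trans (keepR f₇ rH₁ refl) (trans (keepR f₆ rH₁ refl) (trans (keepR f₅ rH₁ refl) d₃)))
      (trans (keepR f₇ rH₂ refl) (trans (keepR f₆ rH₂ refl) d₄))
      (trans (keepR f₇ rI₁ refl) d₅)
      d₆
      g₆ })})})})})})})

  best≤ : ∀ R b m h h′ c → best R b m h h′ c ≤ c
  best≤ R b m h h′ zero = z≤n
  best≤ R b m h h′ (suc c) with sweep-ok R b m h h′ c
  ... | true  = n≤1+n c
  ... | false = m≤n⇒m≤1+n (best≤ R b m h h′ c)

  Spec-sweep : ∀ {R H} b m h h′ → Prepared R H → rg H rL ≡ ℓ → rg H rB ≡ b → rg H rM ≡ m → rg H rH₁ ≡ h → rg H rH₂ ≡ h′ → b ≤ k →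
             Spec sweepP (λ H′ → rg H′ rBest ≡ best R b m h h′ (suc ℓ ∸ 2 * b)) H
  Spec-sweep {R} {H} b m h h′ pre hl hb hm h1 h2 b≤k =
    spec (tt , ≤-trans (≤-reflexive bound) (≤-trans bound≤ n+1≤B) ,
          WP-for bd-n+1 rSweep rBound sweepBody Inv (suc ℓ ∸ 2 * b) bound bound≤ refl step (λ _ inv _ → inv))
    where
    bound : suc (rg H rL) ∸ 2 * rg H rB ≡ suc ℓ ∸ 2 * b
    bound = cong₂ (λ x y → suc x ∸ 2 * y) hl hb
    bound≤ : suc ℓ ∸ 2 * b ≤ n + 1
    bound≤ = ≤-trans (m∸n≤m (suc ℓ) (2 * b)) (≤-trans (s≤s ℓ≤n) (≤-reflexive (+-comm 1 n)))
    H₁ = setR (setR H rBest 0) rBound (suc (rg H rL) ∸ 2 * rg H rB)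
    Inv : ℕ → Store → Set
    Inv i H′ = rg H′ rBest ≡ best R b m h h′ i
    step : Step rSweep sweepBody Inv (suc ℓ ∸ 2 * b) H₁
    step i H₂ i< ri fr old = tt , bind cutP {H = H₂′}
      (wp (Spec-cut {R} {H₂′} {i} {b} {h} {h′} (Prepared-same pre₂ refl (λ _ _ → refl)) ri (trans (keepR fr rB refl) hb) (trans (keepR fr rH₁ refl) h1) (trans (keepR fr rH₂ refl) h2) b≤k)) cut
      where
      H₂′ = setR H₂ rC (rg H₂ rSweep)
      pre₂ : Prepared R H₂
      pre₂ = Prepared-frame (Prepared-same pre refl (λ _ _ → refl)) fr refl refl refl refl refl
      cut : ∀ H₃ → Tallied (cutF R i b h h′) H₃ → Frame (writesR cutP) (writesA cutP) H₂′ H₃ →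
            WP (asg rBest (ite ((var rFault ≐ num 0) ⊗ ((var rGone ≺ num 1 ⊕ var rM) ⊗ ((var rC ≺ num 1 ⊕ var rSize) ⊗ (var rSize ≺ num 1 ⊕ (var rC ⊕ var rB))))) (var rC) (var rBest)))
               (λ H″ → Inv (suc i) (setR H″ rSweep (suc i))) H₃
      cut H₃ (tallied sts size gn fault) fr₃ = tt , trans (cong (λ a → if a ≡ᵇ 0 then rg H₃ rBest else rg H₃ rC) ok≡) (trans (if-b2n (sweep-ok R b m h h′ i))
          (cong₂ (λ x y → if sweep-ok R b m h h′ i then x else y) c₃ (trans (keepR fr₃ rBest refl) old)))
        where
        st = cutF R i b h h′
        c₃ : rg H₃ rC ≡ i
        c₃ = trans (keepR fr₃ rC refl) ri
        b₃ : rg H₃ rB ≡ b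
        b₃ = trans (keepR fr₃ rB refl) (trans (keepR fr rB refl) hb)
        m₃ : rg H₃ rM ≡ m
        m₃ = trans (keepR fr₃ rM refl) (trans (keepR fr rM refl) hm)
        ok≡ : b2n (rg H₃ rFault ≡ᵇ 0) * (b2n (rg H₃ rGone <ᵇ suc (rg H₃ rM)) * (b2n (rg H₃ rC <ᵇ suc (rg H₃ rSize)) * b2n (rg H₃ rSize <ᵇ suc (rg H₃ rC + rg H₃ rB))))
              ≡ b2n (sweep-ok R b m h h′ i)
        ok≡ = trans (cong₂ (λ x y → b2n (x ≡ᵇ 0) * y) fault
                (trans (cong₂ _*_ (cong₂ (λ x y → b2n (x <ᵇ suc y)) gn m₃)
                  (trans (cong₂ _*_ (cong₂ (λ x y → b2n (x <ᵇ suc y)) c₃ size) (cong₂ (λ x y → b2n (x <ᵇ suc y)) size (cong₂ _+_ c₃ b₃)))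
                         (b2n-∧ (i <ᵇ suc (# (left st))) (# (left st) <ᵇ suc (i + b)))))
                  (b2n-∧ (# (gone st) <ᵇ suc m) _)))
                (b2n-∧ (faults st ≡ᵇ 0) _)

  Spec-settle : ∀ {R H} b m off h h′ i i′ → Prepared R H → rg H rL ≡ ℓ → rg H rB ≡ b → rg H rM ≡ m → rg H rOff ≡ off →
              rg H rBest ≡ best R b m h h′ (suc ℓ ∸ 2 * b) → rg H rI₁ ≡ i → rg H rI₂ ≡ i′ → b ≤ k → off ≤ 4 * b →
              Spec settleP (Holds (payF R b m off h h′ i i′)) H
  Spec-settle {R} {H} b m off h h′ i i′ pre hl hb hm hoff hbest hi₁ hi₂ b≤k off≤ =
    spec (≤-trans (≤-reflexive c≡) c≤B , tt , tt , bind cutP {H = H₁}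
      (wp (Spec-cut {R} {H₁} {c} {b} {i} {i′} (Prepared-same pre refl (λ _ _ → refl)) c≡ hb hi₁ hi₂ b≤k)) cut)
    where
    c = centre R b m off h h′
    c₀ = (if b2n (rg H rM ≡ᵇ suc (rg H rB)) ≡ᵇ 0 then rg H rBest else rg H rL) + rg H rOff ∸ 2 * rg H rB
    c≡ : c₀ ≡ c
    c≡ = cong₂ _∸_ (cong₂ _+_ (trans (if-b2n (rg H rM ≡ᵇ suc (rg H rB))) (trans (cong₂ (λ x y → if x ≡ᵇ suc y then rg H rL else rg H rBest) hm hb)
                       (cong₂ (λ x y → if m ≡ᵇ suc b then x else y) hl hbest))) hoff) (cong (2 *_) hb)
    c≤B : c ≤ B
    c≤B = ≤-trans (m∸n≤m _ (2 * b)) (≤-trans (+-mono-≤ (if-bound (m ≡ᵇ suc b) {z = n + 1} (≤-trans ℓ≤n (m≤m+n n 1))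
             (≤-trans (best≤ R b m h h′ (suc ℓ ∸ 2 * b)) (≤-trans (m∸n≤m (suc ℓ) (2 * b)) (≤-trans (s≤s ℓ≤n) (≤-reflexive (+-comm 1 n))))))
             (≤-trans off≤ (*-monoʳ-≤ 4 b≤k))) (≤-trans small-sum linear))
      where
      open +-*-Solver
      small-sum : n + 1 + 4 * k ≤ 16 * (n + k + 1)
      small-sum = ≤-trans (m≤m+n (n + 1 + 4 * k) (15 * n + 12 * k + 15))
        (≤-reflexive (solve 2 (λ n k → n :+ con 1 :+ con 4 :* k :+ (con 15 :* n :+ con 12 :* k :+ con 15) := con 16 :* (n :+ k :+ con 1)) refl n k))
    H₁ = setR (setR (setR H rC c₀) rH₁ (rg H rI₁)) rH₂ (rg H rI₂)
    st = cutF R c b i i′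
    cut : ∀ H₂ → Tallied st H₂ → Frame (writesR cutP) (writesA cutP) H₁ H₂ →
          WP (asg rOk ((var rFault ≐ num 0) ⊗ (var rGone ⊕ (var rSize ⊖ var rL) ≺ num 1 ⊕ var rB)) ⨟ for bd-n rV rN acceptBody) (Holds (payF R b m off h h′ i i′)) H₂
    cut H₂ (tallied sts size gn fault) fr = bool≤B (accept st b) ok≡ ,
      WP-for bd-n rV rN acceptBody Inv n (Prepared.hn pre₂) ≤-refl ((λ _ ()) , (λ v _ → Prepared.hR pre₂ v)) step (λ _ inv _ → proj₁ inv)
      where
      pre₂ : Prepared R H₂
      pre₂ = Prepared-frame (Prepared-same pre refl (λ _ _ → refl)) fr refl refl refl refl refl
      x = b2n (rg H₂ rFault ≡ᵇ 0) * b2n (rg H₂ rGone + (rg H₂ rSize ∸ rg H₂ rL) <ᵇ suc (rg H₂ rB))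
      ok≡ : x ≡ b2n (accept st b)
      ok≡ = trans (cong₂ (λ a y → b2n (a ≡ᵇ 0) * b2n y) fault (cong₂ (λ a y → a <ᵇ suc y)
              (cong₂ _+_ gn (cong₂ _∸_ size (trans (keepR fr rL refl) hl))) (trans (keepR fr rB refl) hb)))
              (b2n-∧ (faults st ≡ᵇ 0) _)
      new = payF R b m off h h′ i i′
      Inv : ℕ → Store → Set
      Inv j H′ = (∀ v → v < j → ar H′ aR v ≡ b2n (new v)) × (∀ v → j ≤ v → v < n → ar H′ aR v ≡ b2n (R v))
      step : Step rV acceptBody Inv n (setR H₂ rOk x)
      step j H₃ j<n rj fr₃ (done , ahead) = tt
        , extend (λ v p → trans (upd-other (ar H₃ aR) y (λ z → <⇒≢ p (trans z rj))) (done v p))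
                 (trans (cong (λ a → (ar H₃ aR [ a ↦ y ]) j) rj) (trans (upd-same (ar H₃ aR) j y) value))
        , λ v p q → trans (upd-other (ar H₃ aR) y (λ z → <⇒≢ p (sym (trans z rj)))) (ahead v (<⇒≤ p) q)
        where
        y = if rg H₃ rOk ≡ᵇ 0 then ar H₃ aR (rg H₃ rV) else b2n (ar H₃ aSt (rg H₃ rV) <ᵇ 2)
        value : y ≡ b2n (new j)
        value = trans (cong₂ (λ a r → if a ≡ᵇ 0 then r else b2n (ar H₃ aSt (rg H₃ rV) <ᵇ 2)) (trans (keepR fr₃ rOk refl) ok≡) (trans (cong (ar H₃ aR) rj) (ahead j ≤-refl j<n)))
                (trans (if-b2n (accept st b))
                (trans (cong (λ s → if accept st b then b2n (s <ᵇ 2) else b2n (R j)) (trans (cong (ar H₃ aSt) rj) (trans (keepA fr₃ aSt j refl) (sts j j<n))))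
                       (choose (accept st b))))
          where
          choose : ∀ t → (if t then b2n (right st j) else b2n (R j)) ≡ b2n (if t then right st j else R j)
          choose true  = refl
          choose false = refl

  Spec-pay : ∀ {R H b g} → rg H rN ≡ n → rg H rL ≡ ℓ → Holds R H → rg H rCredit ≡ suc b → rg H rPow ≡ 2 ^ b → rg H rG ≡ g → suc b ≤ k →
             Spec payP (λ H′ → Holds (payD R (suc b) g) H′ × rg H′ rG ≡ rem₆ (suc b) g) H
  Spec-pay {R} {H} {b} {g} hn hl hR hb hp hg b<k = Spec-seq (Spec-prepare {R} {H} hn hR) after-prepare
    where
    Post : Store → Set
    Post H′ = Holds (payD R (suc b) g) H′ × rg H′ rG ≡ rem₆ (suc b) g
    m = ⟦ mod ⟧ g (suc b + 2)
    off = ⟦ mod ⟧ (rem₁ (suc b) g) (4 * suc b + 1)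
    h = ⟦ mod ⟧ (rem₂ (suc b) g) (2 ^ (5 * suc b ∸ 2))
    h′ = ⟦ mod ⟧ (rem₃ (suc b) g) (2 ^ suc b)
    i = ⟦ mod ⟧ (rem₄ (suc b) g) (2 ^ (5 * suc b ∸ 2))
    i′ = ⟦ mod ⟧ (rem₅ (suc b) g) (2 ^ suc b)
    after-prepare : ∀ H₁ → Prepared R H₁ × rg H₁ rTop ≡ n + 1 → Frame (writesR prepareP) (writesA prepareP) H H₁ → Spec (digitsP ⨟ sweepP ⨟ settleP) Post H₁
    after-prepare H₁ (pre , _) fr = Spec-seq
      (Spec-digits {H₁} {b} {g} (trans (keepR fr rCredit refl) hb) (trans (keepR fr rPow refl) hp) (trans (keepR fr rG refl) hg) b<k) after-digits
      where
      l₁ : rg H₁ rL ≡ ℓ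
      l₁ = trans (keepR fr rL refl) hl
      after-digits : ∀ H₂ → Digits (suc b) g H₂ → Frame (writesR digitsP) (writesA digitsP) H₁ H₂ → Spec (sweepP ⨟ settleP) Post H₂
      after-digits H₂ (digits dB dM dOff dH₁ dH₂ dI₁ dI₂ dG) fr₂ = Spec-seq
        (Spec-sweep {R} {H₂} (suc b) m h h′ pre₂ l₂ dB dM dH₁ dH₂ b<k) after-sweep
        where
        pre₂ : Prepared R H₂
        pre₂ = Prepared-frame pre fr₂ refl refl refl refl refl
        l₂ : rg H₂ rL ≡ ℓ
        l₂ = trans (keepR fr₂ rL refl) l₁
        after-sweep : ∀ H₃ → rg H₃ rBest ≡ best R (suc b) m h h′ (suc ℓ ∸ 2 * suc b) →
                      Frame (writesR sweepP) (writesA sweepP) H₂ H₃ → Spec settleP Post H₃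
        after-sweep H₃ hbest fr₃ = Spec-frame
          (Spec-settle {R} {H₃} (suc b) m off h h′ i i′ (Prepared-frame pre₂ fr₃ refl refl refl refl refl) (trans (keepR fr₃ rL refl) l₂)
            (trans (keepR fr₃ rB refl) dB) (trans (keepR fr₃ rM refl) dM) (trans (keepR fr₃ rOff refl) dOff) hbest
            (trans (keepR fr₃ rI₁ refl) dI₁) (trans (keepR fr₃ rI₂ refl) dI₂) b<k (mod-≤ (rem₁ (suc b) g) (4 * suc b)))
          (λ H₄ held fr₄ → held , trans (keepR fr₄ rG refl) (trans (keepR fr₃ rG refl) dG))

  -- The machine has no exponentiation; `rPow` follows the credit by doubling and supplies the
  -- radices that are powers of two.
  record Sim (s : Config) (H : Store) : Set where
    constructor sim
    field
      onN : rg H rN ≡ n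
      onL : rg H rL ≡ ℓ
      onR : Holds (proj₁ s) H
      onC : rg H rCredit ≡ credit s
      onP : rg H rPow ≡ 2 ^ credit s
      onG : rg H rG ≡ proj₂ (proj₂ s)

  k≤B : suc k ≤ B
  k≤B = ≤-trans (≤-trans (≤-reflexive (+-comm 1 k)) (+-monoˡ-≤ 1 (m≤n+m k n))) (≤-trans (m≤n*m (n + k + 1) 16) linear)

  Spec-tick : ∀ {s H} → Sim s H → suc (credit s) ≤ k → Spec tickBody (Sim (tick s)) H
  Spec-tick {R , b , g} {H} (sim hn hl hR hb hp hg) b<k =
    Spec-asg (≤-trans (≤-reflexive (cong suc hb)) (≤-trans b<k (≤-trans (n≤1+n k) k≤B))) (Spec-asg tt (Spec-asg tt (Spec-cnd odd even)))
    where
    H₀ = setR (setR (setR H rCredit (suc (rg H rCredit))) rZ (rg H rG % 2)) rG (rg H rG / 2)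
    even : rg H rG % 2 ≡ 0 → Spec (asg rPow (num 2 ⊗ var rPow)) (Sim (tick (R , b , g))) H₀
    even z = spec (subst (_≤ B) (cong (2 *_) (sym hp)) (2^≤B (suc b) (≤-trans b<k (m≤n*m k 15))) ,
                   subst (λ x → Sim (tick-on (x ≡ᵇ 0) (R , b , g)) (setR H₀ rPow (2 * rg H rPow))) (sym (trans (cong (_% 2) (sym hg)) z))
                     (sim hn hl hR (cong suc hb) (cong (2 *_) hp) (cong (_/ 2) hg)))
    odd : rg H rG % 2 ≢ 0 → Spec (stripP ⨟ payP ⨟ asg rCredit (num 0) ⨟ asg rPow (num 1)) (Sim (tick (R , b , g))) H₀
    odd nz = Spec-seq (Spec-strip {R} {H₀} hn hl hR) after-strip
      where
      tick≡ : tick-on false (R , b , g) ≡ tick (R , b , g)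
      tick≡ = cong (λ x → tick-on x (R , b , g)) (sym (≡ᵇ-false (λ z → nz (trans (cong (_% 2) hg) z))))
      after-strip : ∀ H₁ → Holds (stripF R) H₁ → Frame (writesR stripP) (writesA stripP) H₀ H₁ →
                    Spec (payP ⨟ asg rCredit (num 0) ⨟ asg rPow (num 1)) (Sim (tick (R , b , g))) H₁
      after-strip H₁ h₁ fr₁ = Spec-seq
        (Spec-pay {stripF R} {H₁} {b} {g / 2} (trans (keepR fr₁ rN refl) hn) (trans (keepR fr₁ rL refl) hl) h₁ (trans (keepR fr₁ rCredit refl) (cong suc hb))
           (trans (keepR fr₁ rPow refl) hp) (trans (keepR fr₁ rG refl) (cong (_/ 2) hg)) b<k)
        (λ { H₂ (h₂ , g₂) fr₂ → spec (tt , tt , subst (λ s → Sim s (setR (setR H₂ rCredit 0) rPow 1)) tick≡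
               (sim (trans (keepR fr₂ rN refl) (trans (keepR fr₁ rN refl) hn)) (trans (keepR fr₂ rL refl) (trans (keepR fr₁ rL refl) hl)) h₂ refl refl g₂)) })

  everything : VSet
  everything _ = true

  final : ℕ → ℕ
  final g = # (stripF (proj₁ (iterate tick k (everything , 0 , g))))

  Spec-guess : ∀ {H} → rg H rN ≡ n → rg H rL ≡ ℓ → rg H rK ≡ k →
               Spec guessBody (λ H′ → rg H′ rRes ≡ (if final (rg H rGuess) ≡ᵇ 0 then 1 else rg H rRes)) H
  Spec-guess {H} hn hl hk = Spec-asg tt (Spec-asg tt (Spec-asg tt (Spec-seq fill after-fill)))
    where
    G = rg H rGuess
    H₀ = setR (setR (setR H rG G) rCredit 0) rPow 1
    Goal : Store → Set
    Goal H′ = rg H′ rRes ≡ (if final G ≡ᵇ 0 then 1 else rg H rRes)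
    fill : Spec (for bd-n rV rN fillBody) (Holds everything) H₀
    fill = Spec-for (λ i H′ → ∀ v → v < i → ar H′ aR v ≡ 1) n hn ≤-refl (λ _ ()) step (λ _ inv _ → inv)
      where
      step : ∀ i H′ → i < n → rg H′ rV ≡ i → LoopFrame rV fillBody H₀ H′ → (∀ v → v < i → ar H′ aR v ≡ 1) →
             Spec fillBody (λ H″ → ∀ v → v < suc i → ar (setR H″ rV (suc i)) aR v ≡ 1) H′
      step i H′ _ ri _ old = spec (tt , extend (λ v p → trans (upd-other (ar H′ aR) 1 (λ z → <⇒≢ p (trans z ri))) (old v p))
                                               (trans (cong (λ a → (ar H′ aR [ a ↦ 1 ]) i) ri) (upd-same (ar H′ aR) i 1)))
    after-fill : ∀ H₁ → Holds everything H₁ → LoopFrame rV fillBody H₀ H₁ →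
                 Spec (for bd-k rIter rK tickBody ⨟ stripP ⨟ asg rCount (num 0) ⨟ for bd-n rV rN countBody ⨟ asg rRes (ite (var rCount) (var rRes) (num 1))) Goal H₁
    after-fill H₁ h₁ fr₁ = Spec-seq ticks after-ticks
      where
      s₀ : Config
      s₀ = everything , 0 , G
      ticks : Spec (for bd-k rIter rK tickBody) (Sim (iterate tick k s₀)) H₁
      ticks = Spec-for (λ i H′ → Sim (iterate tick i s₀) H′) k (trans (keepR fr₁ rK refl) hk) ≤-refl
        (sim (trans (keepR fr₁ rN refl) hn) (trans (keepR fr₁ rL refl) hl) h₁ (keepR fr₁ rCredit refl) (keepR fr₁ rPow refl) (keepR fr₁ rG refl))
        -- The credit never exceeds the number of ticks so far, so a cut in tick i has b ≤ i + 1 ≤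
        -- k.
        (λ i H′ i<k _ _ inv → Spec-mono (λ { H″ (sim a b c d e f) → sim a b c d e f }) (Spec-tick inv (≤-trans (s≤s (proj₁ (tick-sound i everything G))) i<k)))
        (λ _ inv _ → inv)
      R = proj₁ (iterate tick k s₀)
      after-ticks : ∀ H₂ → Sim (iterate tick k s₀) H₂ → LoopFrame rIter tickBody H₁ H₂ →
                    Spec (stripP ⨟ asg rCount (num 0) ⨟ for bd-n rV rN countBody ⨟ asg rRes (ite (var rCount) (var rRes) (num 1))) Goal H₂
      after-ticks H₂ (sim n₂ l₂ r₂ _ _ _) fr₂ = Spec-seq (Spec-strip {R} {H₂} n₂ l₂ r₂) after-strip
        where
        after-strip : ∀ H₃ → Holds (stripF R) H₃ → Frame (writesR stripP) (writesA stripP) H₂ H₃ →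
                      Spec (asg rCount (num 0) ⨟ for bd-n rV rN countBody ⨟ asg rRes (ite (var rCount) (var rRes) (num 1))) Goal H₃
        after-strip H₃ h₃ fr₃ = Spec-asg tt (Spec-seq counting (λ H₄ e fr₄ → spec (tt ,
            trans (cong₂ (λ x y → if x ≡ᵇ 0 then 1 else y) e (trans (keepR fr₄ rRes refl) (trans (keepR fr₃ rRes refl) (trans (keepR fr₂ rRes refl) (keepR fr₁ rRes refl))))) refl)))
          where
          counting : Spec (for bd-n rV rN countBody) (λ H′ → rg H′ rCount ≡ final G) (setR H₃ rCount 0)
          counting = Spec-for (λ i H′ → rg H′ rCount ≡ sum i (b2n ∘ stripF R)) n (trans (keepR fr₃ rN refl) n₂) ≤-refl refl step (λ _ inv _ → inv)
            where
            step : ∀ i H′ → i < n → rg H′ rV ≡ i → LoopFrame rV countBody (setR H₃ rCount 0) H′ → rg H′ rCount ≡ sum i (b2n ∘ stripF R) →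
                   Spec countBody (λ H″ → rg (setR H″ rV (suc i)) rCount ≡ sum (suc i) (b2n ∘ stripF R)) H′
            step i H′ i<n ri fr e = spec (partial≤B (suc i) (stripF R) i<n value , value)
              where
              value : rg H′ rCount + ar H′ aR (rg H′ rV) ≡ sum (suc i) (b2n ∘ stripF R)
              value = cong₂ _+_ e (trans (cong (ar H′ aR) ri) (trans (keepA fr aR i refl) (h₃ i i<n)))

  Outcome : ℕ → ℕ → Set
  Outcome i x = (x ≡ 1 × ∃[ g ] Success k everything g) ⊎ (x ≡ 0 × (∀ g → g < i → ¬ Success k everything g))

  Spec-main : ∀ {H} → rg H rN ≡ n → rg H rL ≡ ℓ → rg H rK ≡ k → Spec mainP (λ H′ → Outcome (2 ^ (15 * k)) (rg H′ rRes)) H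
  Spec-main {H} hn hl hk = Spec-asg tt (Spec-seq powers after-powers)
    where
    H₀ = setR H rAll 1
    powers : Spec (for bd-k rIter rK allBody) (λ H′ → rg H′ rAll ≡ 2 ^ (15 * k)) H₀
    powers = Spec-for (λ i H′ → rg H′ rAll ≡ 2 ^ (15 * i)) k hk ≤-refl refl step (λ _ inv _ → inv)
      where
      step : ∀ i H′ → i < k → rg H′ rIter ≡ i → LoopFrame rIter allBody H₀ H′ → rg H′ rAll ≡ 2 ^ (15 * i) →
             Spec allBody (λ H″ → rg (setR H″ rIter (suc i)) rAll ≡ 2 ^ (15 * suc i)) H′
      step i H′ i<k _ _ e = spec (≤-trans (≤-reflexive value) (2^≤B (15 * suc i) (*-monoʳ-≤ 15 i<k)) , value)
        where
        value : 32768 * rg H′ rAll ≡ 2 ^ (15 * suc i)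
        value = trans (cong (32768 *_) e) (trans (sym (^-distribˡ-+-* 2 15 (15 * i))) (cong (2 ^_) (sym (*-suc 15 i))))
    after-powers : ∀ H₁ → rg H₁ rAll ≡ 2 ^ (15 * k) → LoopFrame rIter allBody H₀ H₁ →
                   Spec (asg rRes (num 0) ⨟ for bd-2^15k rGuess rAll guessBody) (λ H′ → Outcome (2 ^ (15 * k)) (rg H′ rRes)) H₁
    after-powers H₁ e fr₁ = Spec-asg tt (Spec-for (λ i H′ → Outcome i (rg H′ rRes)) (2 ^ (15 * k)) e ≤-refl (inj₂ (refl , λ _ ())) step (λ _ inv _ → inv))
      where
      step : ∀ i H′ → i < 2 ^ (15 * k) → rg H′ rGuess ≡ i → LoopFrame rGuess guessBody (setR H₁ rRes 0) H′ → Outcome i (rg H′ rRes) →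
             Spec guessBody (λ H″ → Outcome (suc i) (rg (setR H″ rGuess (suc i)) rRes)) H′
      step i H′ _ gi fr out = Spec-mono (λ H″ q → next out (trans q (cong (λ g → if final g ≡ᵇ 0 then 1 else rg H′ rRes) gi)))
        (Spec-guess {H′} (trans (keepR fr rN refl) (trans (keepR fr₁ rN refl) hn)) (trans (keepR fr rL refl) (trans (keepR fr₁ rL refl) hl)) (trans (keepR fr rK refl) (trans (keepR fr₁ rK refl) hk)))
        where
        next : ∀ {x y} → Outcome i x → y ≡ (if final i ≡ᵇ 0 then 1 else x) → Outcome (suc i) y
        next {x} {y} o q with true-or-false (final i ≡ᵇ 0)
        ... | inj₁ z = inj₁ (trans q (cong (λ b → if b then 1 else x) z) , i , success (≡ᵇ0 z))
        ... | inj₂ z with o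
        ...   | inj₁ (x≡1 , found) = inj₁ (trans q (trans (cong (λ b → if b then 1 else x) z) x≡1) , found)
        ...   | inj₂ (x≡0 , none)  = inj₂ (trans q (trans (cong (λ b → if b then 1 else x) z) x≡0) , λ g p → go g (m<1+n⇒m<n∨m≡n p))
          where
          go : ∀ g → g < i ⊎ g ≡ i → ¬ Success k everything g
          go g (inj₁ p) = none g p
          go g (inj₂ refl) (success s) = true≢false (cong (_≡ᵇ 0) s) z

-- Running time

-- Exponents a, b, c of a monomial (2 ^ (15 * k)) ^ a * suc k ^ b * n ^ c.
record Rate : Set where
  constructor rate
  field
    in-2^15k in-k in-n : ℕ

open Rate

_⊔ᴿ_ : Rate → Rate → Rate
r ⊔ᴿ s = rate (in-2^15k r ⊔ in-2^15k s) (in-k r ⊔ in-k s) (in-n r ⊔ in-n s)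

value : Rate → ℕ → ℕ → ℕ
value r n k = (2 ^ (15 * k)) ^ in-2^15k r * suc k ^ in-k r * n ^ in-n r

iterated : Bd → Rate → Rate
iterated bd-n     r = record r { in-n = suc (in-n r) }
iterated bd-n+1   r = record r { in-n = suc (in-n r) }
iterated bd-k     r = record r { in-k = suc (in-k r) }
iterated bd-6k    r = record r { in-k = suc (in-k r) }
iterated bd-2^15k r = record r { in-2^15k = suc (in-2^15k r) }

iterated-factor : Bd → ℕ
iterated-factor bd-n     = 1
iterated-factor bd-n+1   = 2
iterated-factor bd-k     = 1
iterated-factor bd-6k    = 6
iterated-factor bd-2^15k = 1

-- Exponents are joined by maximum and constants are added in `cost-factor`. The order of growth of
-- a concrete program is thereby found by evaluation.
cost-rate : Pr → Rate
cost-rate (p ⨟ q)       = cost-rate p ⊔ᴿ cost-rate q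
cost-rate (cnd e p q)   = cost-rate p ⊔ᴿ cost-rate q
cost-rate (for x r q p) = iterated x (cost-rate p)
cost-rate nop           = rate 0 0 0
cost-rate (asg r e)     = rate 0 0 0
cost-rate (put j d e)   = rate 0 0 0

cost-factor : Pr → ℕ
cost-factor (p ⨟ q)       = cost-factor p + cost-factor q
cost-factor (cnd e p q)   = suc (costᵉ ⌊ e ⌋ᵉ) + (cost-factor p + cost-factor q)
cost-factor (for x r q p) = 6 + iterated-factor x * (8 + cost-factor p)
cost-factor nop           = wc (λ _ → 0) nop
cost-factor (asg r e)     = wc (λ _ → 0) (asg r e)
cost-factor (put j d e)   = wc (λ _ → 0) (put j d e)

module _ (n k : ℕ) (1≤n : 1 ≤ n) where

  private
    instance
      n≢0 : NonZero n
      n≢0 = >-nonZero 1≤n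
      2^15k≢0 : NonZero (2 ^ (15 * k))
      2^15k≢0 = m^n≢0 2 (15 * k)

  value-mono : ∀ {r s} → in-2^15k r ≤ in-2^15k s → in-k r ≤ in-k s → in-n r ≤ in-n s → value r n k ≤ value s n k
  value-mono p q r = *-mono-≤ (*-mono-≤ (^-monoʳ-≤ (2 ^ (15 * k)) p) (^-monoʳ-≤ (suc k) q)) (^-monoʳ-≤ n r)

  1≤value : ∀ r → 1 ≤ value r n k
  1≤value r = value-mono {rate 0 0 0} {r} z≤n z≤n z≤n

  value-⊔ˡ : ∀ r s → value r n k ≤ value (r ⊔ᴿ s) n k
  value-⊔ˡ r s = value-mono {r} {r ⊔ᴿ s} (m≤m⊔n _ _) (m≤m⊔n _ _) (m≤m⊔n _ _)

  value-⊔ʳ : ∀ r s → value s n k ≤ value (r ⊔ᴿ s) n k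
  value-⊔ʳ r s = value-mono {s} {r ⊔ᴿ s} (m≤n⊔m (in-2^15k r) _) (m≤n⊔m (in-k r) _) (m≤n⊔m (in-n r) _)

  -- The factor 2 comes from n + 1 ≤ 2 n for n ≥ 1. The base `suc k` instead of k keeps the
  -- monomials positive at k = 0, so that they can also bound additive constants.
  value-iterated : ∀ x r → loop-bound n k x * value r n k ≤ iterated-factor x * value (iterated x r) n k
  value-iterated x r = by-bound x
    where
    open +-*-Solver
    A = (2 ^ (15 * k)) ^ in-2^15k r
    K = suc k ^ in-k r
    M = n ^ in-n r
    by-bound : ∀ x → loop-bound n k x * (A * K * M) ≤ iterated-factor x * value (iterated x r) n k
    by-bound bd-n     = ≤-reflexive (solve 4 (λ a b c n → n :* (a :* b :* c) := con 1 :* (a :* b :* (n :* c))) refl A K M n)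
    by-bound bd-n+1   = ≤-trans (*-monoˡ-≤ (A * K * M) (+-monoʳ-≤ n 1≤n))
                          (≤-reflexive (solve 4 (λ a b c n → (n :+ n) :* (a :* b :* c) := con 2 :* (a :* b :* (n :* c))) refl A K M n))
    by-bound bd-k     = ≤-trans (*-monoˡ-≤ (A * K * M) (n≤1+n k))
                          (≤-reflexive (solve 4 (λ a b c l → l :* (a :* b :* c) := con 1 :* (a :* (l :* b) :* c)) refl A K M (suc k)))
    by-bound bd-6k    = ≤-trans (*-monoˡ-≤ (A * K * M) (*-monoʳ-≤ 6 (n≤1+n k)))
                          (≤-reflexive (solve 4 (λ a b c l → con 6 :* l :* (a :* b :* c) := con 6 :* (a :* (l :* b) :* c)) refl A K M (suc k)))
    by-bound bd-2^15k = ≤-reflexive (solve 4 (λ a b c y → y :* (a :* b :* c) := con 1 :* (y :* a :* b :* c)) refl A K M (2 ^ (15 * k)))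

  wc-bound : ∀ p → wc (loop-bound n k) p ≤ cost-factor p * value (cost-rate p) n k
  wc-join : ∀ p q → wc (loop-bound n k) p + wc (loop-bound n k) q ≤ (cost-factor p + cost-factor q) * value (cost-rate p ⊔ᴿ cost-rate q) n k

  wc-bound (p ⨟ q)     = wc-join p q
  wc-bound (cnd e p q) = ≤-trans (+-mono-≤ (≤-trans (≤-reflexive (sym (*-identityʳ c))) (*-monoʳ-≤ c (1≤value s))) (≤-trans (m⊔n≤m+n (wc (loop-bound n k) p) (wc (loop-bound n k) q)) (wc-join p q)))
                                 (≤-reflexive (sym (*-distribʳ-+ (value s n k) c (cost-factor p + cost-factor q))))
    where
    c = suc (costᵉ ⌊ e ⌋ᵉ)
    s = cost-rate p ⊔ᴿ cost-rate q
  wc-bound (for x r q p) = begin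
    6 + N * (8 + wc (loop-bound n k) p)     ≤⟨ +-mono-≤ (≤-trans (≤-reflexive (sym (*-identityʳ 6))) (*-monoʳ-≤ 6 (1≤value (iterated x (cost-rate p))))) (*-monoʳ-≤ N inner) ⟩
    6 * V + N * (c * v)                     ≡⟨ cong (6 * V +_) (trans (sym (*-assoc N c v)) (trans (cong (_* v) (*-comm N c)) (*-assoc c N v))) ⟩
    6 * V + c * (N * v)                     ≤⟨ +-monoʳ-≤ (6 * V) (*-monoʳ-≤ c (value-iterated x (cost-rate p))) ⟩
    6 * V + c * (d * V)                     ≡⟨ cong (6 * V +_) (trans (sym (*-assoc c d V)) (cong (_* V) (*-comm c d))) ⟩
    6 * V + d * c * V                       ≡⟨ sym (*-distribʳ-+ V 6 (d * c)) ⟩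
    (6 + d * c) * V                         ∎
    where
    open ≤-Reasoning
    N = loop-bound n k x
    d = iterated-factor x
    c = 8 + cost-factor p
    v = value (cost-rate p) n k
    V = value (iterated x (cost-rate p)) n k
    inner : 8 + wc (loop-bound n k) p ≤ c * v
    inner = ≤-trans (+-mono-≤ (≤-trans (≤-reflexive (sym (*-identityʳ 8))) (*-monoʳ-≤ 8 (1≤value (cost-rate p)))) (wc-bound p))
                    (≤-reflexive (sym (*-distribʳ-+ v 8 (cost-factor p))))
  wc-bound nop         = ≤-refl
  wc-bound (asg r e)   = ≤-reflexive (sym (*-identityʳ _))
  wc-bound (put j d e) = ≤-reflexive (sym (*-identityʳ _))

  wc-join p q = ≤-trans
    (+-mono-≤ (≤-trans (wc-bound p) (*-monoʳ-≤ (cost-factor p) (value-⊔ˡ (cost-rate p) (cost-rate q))))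
              (≤-trans (wc-bound q) (*-monoʳ-≤ (cost-factor q) (value-⊔ʳ (cost-rate p) (cost-rate q)))))
    (≤-reflexive (sym (*-distribʳ-+ (value (cost-rate p ⊔ᴿ cost-rate q) n k) (cost-factor p) (cost-factor q))))

-- The extreme nesting is strings, ticks, sizes of a scan or sweep, rounds, vertices: one loop over
-- strings, two of length O(k), two of length O(n).
cost-rate-main : cost-rate mainP ≡ rate 1 2 2
cost-rate-main = refl

k<2^k : ∀ k → suc k ≤ 2 ^ k
k<2^k zero    = ≤-refl
k<2^k (suc k) = ≤-trans (+-mono-≤ (m^n>0 2 k) (k<2^k k)) (≤-reflexive (cong (2 ^ k +_) (sym (+-identityʳ _))))

-- One factor k + 1 is at most 2 ^ k and moves into the exponential; the other is at most twice the
-- maximum of k and 1.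
main-cost-bound : ∀ n k → value (rate 1 2 2) n k ≤ 2 * (2 ^ (16 * k) * (k ⊔ 1) * n ^ 2)
main-cost-bound n k = begin
  (2 ^ (15 * k)) ^ 1 * suc k ^ 2 * n ^ 2               ≡⟨ cong (λ x → (2 ^ (15 * k)) ^ 1 * (suc k * x) * n ^ 2) (*-identityʳ (suc k)) ⟩
  (2 ^ (15 * k)) ^ 1 * (suc k * suc k) * n ^ 2         ≤⟨ *-monoˡ-≤ (n ^ 2) (*-mono-≤ (≤-reflexive (*-identityʳ (2 ^ (15 * k)))) (*-mono-≤ (k<2^k k) suc≤2max)) ⟩
  2 ^ (15 * k) * (2 ^ k * (2 * (k ⊔ 1))) * n ^ 2       ≡⟨ solve 4 (λ a b m s → a :* (b :* (con 2 :* m)) :* s := con 2 :* (b :* a :* m :* s)) refl (2 ^ (15 * k)) (2 ^ k) (k ⊔ 1) (n ^ 2) ⟩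
  2 * (2 ^ k * 2 ^ (15 * k) * (k ⊔ 1) * n ^ 2)         ≡⟨ cong (λ x → 2 * (x * (k ⊔ 1) * n ^ 2)) (sym (^-distribˡ-+-* 2 k (15 * k))) ⟩
  2 * (2 ^ (16 * k) * (k ⊔ 1) * n ^ 2)                 ∎
  where
  open ≤-Reasoning
  open +-*-Solver
  suc≤2max : suc k ≤ 2 * (k ⊔ 1)
  suc≤2max = ≤-trans (+-mono-≤ (m≤n⊔m k 1) (m≤m⊔n k 1)) (≤-reflexive (cong (k ⊔ 1 +_) (sym (+-identityʳ _))))

-- Word length, the complete program and fixed-parameter tractability

word-bound : ℕ → ℕ → ℕ
word-bound n k = (2 ^ k * n) ^ 16

module _ (n k : ℕ) (2≤n : 2 ≤ n) (k<n : k < n) where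

  private
    N = 2 ^ k * n
    n≤N : n ≤ N
    n≤N = ≤-trans (≤-reflexive (sym (+-identityʳ n))) (*-monoˡ-≤ n (m^n>0 2 k))
    2≤N : 2 ≤ N
    2≤N = ≤-trans 2≤n n≤N
    instance
      N≢0 : NonZero N
      N≢0 = >-nonZero (≤-trans (s≤s z≤n) 2≤N)

  word-bound-large : 65536 ≤ word-bound n k
  word-bound-large = ^-monoˡ-≤ 16 2≤N

  word-bound-linear : 16 * (n + k + 1) ≤ word-bound n k
  word-bound-linear = begin
    16 * (n + k + 1) ≤⟨ *-monoʳ-≤ 16 (≤-trans (≤-reflexive (+-assoc n k 1)) (+-mono-≤ n≤N (≤-trans (≤-reflexive (+-comm k 1)) (≤-trans k<n n≤N)))) ⟩
    16 * (N + N)     ≡⟨ cong (λ x → 16 * (N + x)) (sym (+-identityʳ N)) ⟩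
    16 * (2 * N)     ≤⟨ *-mono-≤ (^-monoˡ-≤ 4 2≤N) (*-monoˡ-≤ N 2≤N) ⟩
    N ^ 4 * (N * N)  ≡⟨ cong (λ x → N ^ 4 * (N * x)) (sym (*-identityʳ N)) ⟩
    N ^ 4 * N ^ 2    ≡⟨ sym (^-distribˡ-+-* N 4 2) ⟩
    N ^ 6            ≤⟨ ^-monoʳ-≤ N {6} {16} (m≤m+n 6 10) ⟩
    N ^ 16           ∎
    where open ≤-Reasoning

  word-bound-exponential : 2 ^ (15 * k) ≤ word-bound n k
  word-bound-exponential = begin
    2 ^ (15 * k) ≡⟨ cong (2 ^_) (*-comm 15 k) ⟩
    2 ^ (k * 15) ≡⟨ sym (^-*-assoc 2 k 15) ⟩
    (2 ^ k) ^ 15 ≤⟨ ^-monoˡ-≤ 15 (m≤m*n (2 ^ k) n {{>-nonZero (≤-trans (s≤s z≤n) 2≤n)}}) ⟩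
    N ^ 15       ≤⟨ ^-monoʳ-≤ N {15} {16} (m≤m+n 15 1) ⟩
    N ^ 16       ∎
    where open ≤-Reasoning

  -- The sixth power of the bound B = N ^ 16 is N ^ 96. As N ≥ 2, any larger exponent gives a strict
  -- inequality; 128 is the one that the word length provides.
  word-bound-fits : ∀ w → N ^ 128 ≤ 2 ^ w → word-bound n k ^ 6 < 2 ^ w
  word-bound-fits w p = begin-strict
    (N ^ 16) ^ 6 ≡⟨ ^-*-assoc N 16 6 ⟩
    N ^ 96       <⟨ ^-monoʳ-< N 2≤N {96} {128} (m≤m+n 97 31) ⟩
    N ^ 128      ≤⟨ p ⟩
    2 ^ w        ∎
    where open ≤-Reasoning

-- Compiled code writes only registers above 4, so the prologue places n and n² in registers 3 and
-- 4, and the output register receives the result, `rRes`, at the very end.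
program : Cmd
program = set 3 (reg 0) ⨾ set 4 (op mul (reg 0) (reg 0)) ⨾ ⌊ mainP ⌋ ⨾ set 0 (reg 48)

wf-main : wf mainP ≡ true
wf-main = refl

module _ {n : ℕ} (D : Digraph n) (ℓ k : ℕ) (sc : Semicomplete D) (1≤ℓ : 1 ≤ ℓ) (k+ℓ<n : k + ℓ < n)
         (w : ℕ) (fits : (2 ^ k * n) ^ 128 ≤ 2 ^ w) where

  private
    B = word-bound n k
    k<n : k < n
    k<n = ≤-trans (s≤s (m≤m+n k ℓ)) k+ℓ<n
    ℓ≤n : ℓ ≤ n
    ℓ≤n = ≤-trans (m≤n+m ℓ k) (<⇒≤ k+ℓ<n)
    2≤n : 2 ≤ n
    2≤n = ≤-trans (s≤s (≤-trans 1≤ℓ (m≤n+m ℓ k))) k+ℓ<n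
    instance
      n≢0 : NonZero n
      n≢0 = >-nonZero (≤-trans (s≤s z≤n) 2≤n)
    B-large = word-bound-large n k 2≤n k<n
    B-linear = word-bound-linear n k 2≤n k<n
    B^6<2^w = word-bound-fits n k 2≤n k<n w fits

  open Link D ℓ
  open Programs n arcs ℓ k B B-large B-linear (word-bound-exponential n k 2≤n k<n) ℓ≤n
  open Complete arcs-loopless (arcs-semicomplete sc)

  private
    start : Store
    start = ⟪ (instanceRegisters n ℓ k [ 3 ↦ n ]) [ 4 ↦ n * n ] , (λ _ _ → 0) ⟫

    started : State
    started = ⟨ rg start , adjacencyMatrix D ⟩

    n²≤B : n * n ≤ B
    n²≤B = ≤-trans (≤-trans (*-mono-≤ n≤N n≤N) (≤-reflexive (cong (N *_) (sym (*-identityʳ N))))) (^-monoʳ-≤ N {2} {16} (m≤m+n 2 14))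
      where
      N = 2 ^ k * n
      n≤N : n ≤ N
      n≤N = ≤-trans (≤-reflexive (sym (+-identityʳ n))) (*-monoˡ-≤ n (m^n>0 2 k))
      instance
        N≢0 : NonZero N
        N≢0 = >-nonZero (≤-trans (≤-trans (s≤s z≤n) 2≤n) n≤N)

    represents : Rep started start
    represents = record
      { regs = λ _ → refl
      ; arrs = λ j i _ → adjacencyMatrix-outside D _ (m≤m+n (n * n) (i * 16 + j))
      ; inp  = λ u v → adjacencyMatrix-matrix D _
      ; reg3 = refl ; reg4 = refl }

    start-small : Small start
    start-small = small (λ r → if-bound (r ≡ᵇ 4) n²≤B (if-bound (r ≡ᵇ 3) n≤B (instance-small r))) (λ _ _ → z≤n)
      where
      instance-small : ∀ r → instanceRegisters n ℓ k r ≤ B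
      instance-small 0 = n≤B
      instance-small 1 = ≤-trans ℓ≤n n≤B
      instance-small 2 = ≤-trans (<⇒≤ k<n) n≤B
      instance-small (suc (suc (suc _))) = z≤n

    outcome-correct : ∀ {x} → Outcome (2 ^ (15 * k)) x → x ≡ 1 ⇔ DCOC D ℓ k
    outcome-correct {x} out = mk⇔ (to out) (from out)
      where
      to : Outcome (2 ^ (15 * k)) x → x ≡ 1 → DCOC D ℓ k
      to (inj₁ (_ , g , s)) _ = Solvable⇒DCOC k k<n (success-sound k everything g s)
      to (inj₂ (refl , _)) ()
      from : Outcome (2 ^ (15 * k)) x → DCOC D ℓ k → x ≡ 1
      from (inj₁ (e , _)) _ = e
      from (inj₂ (_ , none)) d with success-complete 1≤ℓ k k everything k ≤-refl ≤-refl (DCOC⇒Solvable sc k d)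
      ... | g , g< , s = ⊥-elim (none g g< s)

  program-correct : ∃[ σ ] ∃[ t ] (Semantics.Run (modWord w) program (initial D ℓ k) σ t
                      × t ≤ 8 + wc (loop-bound n k) mainP × (output σ ≡ 1 ⇔ DCOC D ℓ k))
  program-correct = conclude (WP-sound w B^6<2^w mainP {Q = Verdict} {σ = started} {H = start} wf-main represents start-small (wp (Spec-main {start} refl refl refl)))
    where
    open Semantics (modWord w) using (Run; run-seq; run-set)
    Verdict : Store → Set
    Verdict H = Outcome (2 ^ (15 * k)) (rg H rRes)
    square : modWord w (n * n) ≡ n * n
    square = wrap-id w B^6<2^w 1 (B≤B^1 n²≤B) (s≤s z≤n)
    setup : Run (set 4 (op mul (reg 0) (reg 0))) ⟨ instanceRegisters n ℓ k [ 3 ↦ n ] , adjacencyMatrix D ⟩ started 4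
    setup = subst (λ x → Run (set 4 (op mul (reg 0) (reg 0))) ⟨ instanceRegisters n ℓ k [ 3 ↦ n ] , adjacencyMatrix D ⟩
                             ⟨ (instanceRegisters n ℓ k [ 3 ↦ n ]) [ 4 ↦ x ] , adjacencyMatrix D ⟩ 4) square run-set
    conclude : Halts w B^6<2^w ⌊ mainP ⌋ (wc (loop-bound n k) mainP) started Verdict →
               ∃[ σ ] ∃[ t ] (Run program (initial D ℓ k) σ t × t ≤ 8 + wc (loop-bound n k) mainP × (output σ ≡ 1 ⇔ DCOC D ℓ k))
    conclude (σ , t , H , run , t≤ , rep , sm , out) =
      ⟨ registers σ [ 0 ↦ registers σ 48 ] , memory σ ⟩ , 2 + (4 + (t + 2)) , run-seq run-set (run-seq setup (run-seq run run-set))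
      , ≤-trans (+-monoʳ-≤ 6 (+-monoˡ-≤ 2 t≤)) (≤-reflexive (cong (6 +_) (+-comm (wc (loop-bound n k) mainP) 2)))
      , outcome-correct (subst (Outcome (2 ^ (15 * k))) (sym (regs rep 48)) out)

-- The 8 pays for the prologue and the epilogue, the 2 comes from `main-cost-bound`.
time-factor : ℕ
time-factor = 8 + 2 * cost-factor mainP

program-time : ∀ n k → 1 ≤ n → 8 + wc (loop-bound n k) mainP ≤ time-factor * (2 ^ (16 * k) * (k ⊔ 1) * n ^ 2)
program-time n k p = begin
  8 + wc (loop-bound n k) mainP          ≤⟨ +-mono-≤ (≤-trans (≤-reflexive (sym (*-identityʳ 8))) (*-monoʳ-≤ 8 1≤X)) main-bound ⟩
  8 * X + c * value (rate 1 2 2) n k     ≤⟨ +-monoʳ-≤ (8 * X) (*-monoʳ-≤ c (main-cost-bound n k)) ⟩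
  8 * X + c * (2 * X)                    ≡⟨ cong (8 * X +_) (trans (sym (*-assoc c 2 X)) (cong (_* X) (*-comm c 2))) ⟩
  8 * X + 2 * c * X                      ≡⟨ sym (*-distribʳ-+ X 8 (2 * c)) ⟩
  time-factor * X                            ∎
  where
  open ≤-Reasoning
  X = 2 ^ (16 * k) * (k ⊔ 1) * n ^ 2
  c = cost-factor mainP
  main-bound : wc (loop-bound n k) mainP ≤ c * value (rate 1 2 2) n k
  main-bound = subst (λ r → wc (loop-bound n k) mainP ≤ c * value r n k) cost-rate-main (wc-bound n k p mainP)
  1≤X : 1 ≤ X
  1≤X = *-mono-≤ (*-mono-≤ (m^n>0 2 (16 * k)) (m≤n⊔m k 1)) (^-monoˡ-≤ 2 p)

program-solves : SolvesDCOCWithin Semicomplete (λ n k → time-factor * (2 ^ (16 * k) * (k ⊔ 1) * n ^ 2)) program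
program-solves = 128 , λ n D ℓ k sc 1≤ℓ k+ℓ<n w fits →
  let σ , t , run , t≤ , correct = program-correct D ℓ k sc 1≤ℓ k+ℓ<n w fits
  in σ , t , run , ≤-trans t≤ (program-time n k (≤-trans (s≤s z≤n) k+ℓ<n)) , correct

power-program : ℕ → ℕ → Cmd
power-program c b =
  set 1 (lit c) ⨾
  while (reg 0) (set 1 (op mul (reg 1) (lit b)) ⨾ set 0 (op sub (reg 0) (lit 1))) ⨾
  set 0 (reg 1)

power-computable : ∀ c b → Computable (λ k → c * b ^ k)
power-computable c b = power-program c b , halts
  where
  open Semantics id
  body = set 1 (op mul (reg 1) (lit b)) ⨾ set 0 (op sub (reg 0) (lit 1))
  loop : ∀ m a σ → registers σ 0 ≡ m → registers σ 1 ≡ a →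
         ∃[ σ′ ] ∃[ t ] (Run (while (reg 0) body) σ σ′ t × registers σ′ 1 ≡ a * b ^ m)
  loop zero    a σ p q = σ , _ , while-stop p , trans q (sym (*-identityʳ a))
  loop (suc m) a σ p q with loop m (a * b) ⟨ (registers σ [ 1 ↦ registers σ 1 * b ]) [ 0 ↦ registers σ 0 ∸ 1 ] , memory σ ⟩
                              (cong (_∸ 1) p) (cong (_* b) q)
  ... | σ′ , t , r , e = σ′ , _ , while-step (λ z → case0 (trans (sym p) z)) (run-seq run-set run-set) r , trans e (*-assoc a b (b ^ m))
    where
    case0 : suc m ≡ 0 → ⊥
    case0 ()
  halts : ∀ m → ∃[ σ ] ∃[ t ] (Run (power-program c b) ⟨ (λ _ → 0) [ 0 ↦ m ] , (λ _ → 0) ⟩ σ t × output σ ≡ c * b ^ m)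
  halts m with loop m c ⟨ ((λ _ → 0) [ 0 ↦ m ]) [ 1 ↦ c ] , (λ _ → 0) ⟩ refl refl
  ... | σ , t , r , e = _ , _ , run-seq run-set (run-seq r run-set) , e

-- The maximum of k and 1 is at most 2 ^ k. What remains is a pure exponential with base 2 ^ 17,
-- which a single loop of multiplications computes.
parameter-bound : ∀ c n k → c * (2 ^ (16 * k) * (k ⊔ 1) * n ^ 2) ≤ c * (2 ^ 17) ^ k * n ^ 2
parameter-bound c n k = ≤-trans (*-monoʳ-≤ c (*-monoˡ-≤ (n ^ 2) powers)) (≤-reflexive (sym (*-assoc c ((2 ^ 17) ^ k) (n ^ 2))))
  where
  max≤ : ∀ k → k ⊔ 1 ≤ 2 ^ k
  max≤ k = ⊔-lub (≤-trans (n≤1+n k) (k<2^k k)) (m^n>0 2 k)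
  powers : 2 ^ (16 * k) * (k ⊔ 1) ≤ (2 ^ 17) ^ k
  powers = ≤-trans (*-monoʳ-≤ (2 ^ (16 * k)) (max≤ k))
    (≤-reflexive (trans (sym (^-distribˡ-+-* 2 (16 * k) k)) (trans (cong (2 ^_) (+-comm (16 * k) k)) (sym (^-*-assoc 2 17 k)))))

tractable : ∀ c p → SolvesDCOCWithin Semicomplete (λ n k → c * (2 ^ (16 * k) * (k ⊔ 1) * n ^ 2)) p → FixedParameterTractableOn Semicomplete
tractable c p (d , solves) = p , (λ k → c * (2 ^ 17) ^ k) , 2 , power-computable c (2 ^ 17) , d , λ n D ℓ k sc 1≤ℓ k+ℓ<n w fits →
  let σ , t , run , t≤ , correct = solves n D ℓ k sc 1≤ℓ k+ℓ<n w fits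
  in σ , t , run , ≤-trans t≤ (parameter-bound c n k) , correct

theorem4p1 : (∃[ p ] ∃[ C ] SolvesDCOCWithin Semicomplete
    (λ n k → C * (2 ^ (16 * k) * (k ⊔ 1) * n ^ 2)) p)
    × FixedParameterTractableOn Semicomplete
theorem4p1 = (program , time-factor , program-solves) , tractable time-factor program program-solves
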